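{- Let $\mathcal{G}$ and $\mathcal{G}^*$ be two graph classes such that for every graph $G$ in $\mathcal{G}$ and every vertex $v$ of $G$ the graph $G-N[v]$ is in $\mathcal{G}^*$. Assume that for each graph $G$ in $\mathcal{G}^*$ with $n$ vertices and $m$ edges one can compute in time $f(n,m)$ a rational (resp. integer or unit) well-covering system of $G$ with size at most $g(n,m)$, where $f$ and $g$ are nondecreasing functions. Then for any graph $G$ in $\mathcal{G}$ with $n$ vertices and $m$ edges, one can compute in time $\mathcal{O}(n\cdot(n+m+f(n,m)))$ a rational (resp. integer or unit) well-covering system of $G$ with size at most $n\cdot g(n,m)+n-1$.
   Context: All graphs are finite, simple, and undirected. $N[v]$ denotes the closed neighborhood of $v$ in $G$, that is, $v$ together with all vertices adjacent to $v$; $G-N[v]$ is the graph obtained from $G$ by deleting all vertices in $N[v]$. An independent set is a set of pairwise nonadjacent vertices; it is maximal if it is not contained in any larger independent set. A weight function $w:V(G)\to\mathbb{R}$ is a well-covered weighting of $G$ if all maximal independent sets $I$ of $G$ have the same weight $w(I)=\sum_{v\in I}w(v)$. A well-covering system of $G$ is a system $\mathcal{S}$ of homogeneous linear equations with real coefficients over the variables $\{x_v: v\in V(G)\}$ such that $w:V(G)\to\mathbb{R}$ is a well-covered weighting of $G$ if and only if setting $x_v=w(v)$ for all $v\in V(G)$ satisfies all equations of $\mathcal{S}$. Its size $|\mathcal{S}|$ is its number of equations. It is rational (resp. integer, unit) if all its coefficients are rational (resp. integers, in $\{ -1,0,1\}$). A function $f:\mathbb{R}^+\times\mathbb{R}^+\to\mathbb{R}^+$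 (with $\mathbb{R}^+$ the nonnegative reals) is nondecreasing if $0\le x_1\le x_2$ and $0\le y_1\le y_2$ imply $f(x_1,y_1)\le f(x_2,y_2)$. -}

module Defs where

open import Level using (Level; 0ℓ) renaming (suc to lsuc)
open import Algebra.Bundles.Raw using (RawMonoid)
import Algebra.Definitions.RawMonoid as RawMonoidDefs
open import Data.Bool.Base using (if_then_else_)
open import Data.Fin.Base as Fin using (Fin; toℕ)
import Data.Fin.Properties as Fin
open import Data.Fin.Subset using (Subset; _∈_; _⊂_)
open import Data.Fin.Subset.Properties using (_∈?_)
open import Data.Integer.Base as ℤ using (ℤ; -[1+_]) renaming (+_ to pos)
open import Data.List.Base using (List; []; _∷_; _++_; [_]; map; concatMap; foldr; length; filter; lookup; allFin; cartesianProduct)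
import Data.List.Membership.Propositional as List
open import Data.List.Relation.Unary.All using (All)
open import Data.List.Relation.Unary.Unique.Propositional using (Unique)
open import Data.Nat.Base as ℕ using (ℕ; zero; suc; _⊔_)
import Data.Nat.Properties as ℕ
open import Data.Product.Base using (Σ; ∃; _×_; _,_; proj₁; proj₂)
open import Data.Rational.Unnormalised.Base as ℚ using (ℚᵘ; 0ℚᵘ; 1ℚᵘ; ½; mkℚᵘ)
import Data.Rational.Unnormalised.Properties as ℚ
open import Data.Rational.Unnormalised.Solver using (module +-*-Solver)
open import Data.Sum.Base using (_⊎_)
open import Function.Base using (_∘_)
open import Function.Bundles using (_⇔_; _↔_; Inverse)
open import Relation.Binary.Core using (Rel)
import Relation.Binary.Definitions as B
open import Relation.Binary.PropositionalEquality using (_≡_; refl; subst)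
open import Relation.Nullary using (¬_; does)
open import Relation.Nullary.Decidable using (¬?; _⊎-dec_; _×-dec_)
open import Relation.Unary using (Pred; Decidable)

-- Real numbers: Cauchy sequences of rationals, each carrying a modulus of convergence,
-- considered up to _≃ᴿ_.

IsCauchy : (ℕ → ℚᵘ) → Set
IsCauchy x = ∀ ε → .{{ℚ.Positive ε}} →
  ∃ λ N → ∀ m n → N ℕ.≤ m → N ℕ.≤ n → ℚ.∣ x m ℚ.- x n ∣ ℚ.≤ ε

record ℝ : Set where
  constructor mkℝ
  field
    seq    : ℕ → ℚᵘ
    cauchy : IsCauchy seq

open ℝ public

infix  4 _≃ᴿ_ _≤ᴿ_
infix  8 -ᴿ_
infixl 6 _+ᴿ_ _-ᴿ_
infixl 7 _*ᴿ_

data _≃ᴿ_ (x y : ℝ) : Set where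
  *≃* : (∀ ε → .{{ℚ.Positive ε}} →
           ∃ λ N → ∀ n → N ℕ.≤ n → ℚ.∣ seq x n ℚ.- seq y n ∣ ℚ.≤ ε) → x ≃ᴿ y

data _≤ᴿ_ (x y : ℝ) : Set where
  *≤* : (∀ ε → .{{ℚ.Positive ε}} →
           ∃ λ N → ∀ n → N ℕ.≤ n → seq x n ℚ.≤ seq y n ℚ.+ ε) → x ≤ᴿ y

abstract
  half+half : ∀ ε → ½ ℚ.* ε ℚ.+ ½ ℚ.* ε ℚ.≃ ε
  half+half ε = begin
    ½ ℚ.* ε ℚ.+ ½ ℚ.* ε  ≈⟨ ℚ.≃-sym (ℚ.*-distribʳ-+ ε ½ ½) ⟩
    (½ ℚ.+ ½) ℚ.* ε      ≈⟨ ℚ.*-congʳ {ε} {½ ℚ.+ ½} {1ℚᵘ} (ℚ.*≡* refl) ⟩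
    1ℚᵘ ℚ.* ε            ≈⟨ ℚ.*-identityˡ ε ⟩
    ε                    ∎
    where open import Relation.Binary.Reasoning.Setoid ℚ.≃-setoid

  half-pos : ∀ ε → .{{ℚ.Positive ε}} → ℚ.Positive (½ ℚ.* ε)
  half-pos ε = ℚ.pos*pos⇒pos ½ ε

  bounded : ∀ x → IsCauchy x →
            ∃ λ b → ℚ.Positive b × ∃ λ N → ∀ n → N ℕ.≤ n → ℚ.∣ x n ∣ ℚ.≤ b
  bounded x cx with cx 1ℚᵘ
  ... | N , h = 1ℚᵘ ℚ.+ ℚ.∣ x N ∣ ,
      ℚ.positive (ℚ.<-≤-trans (ℚ.positive⁻¹ 1ℚᵘ) 1≤b) , N , bound
    where
    open ℚ.≤-Reasoning
    1≤b : 1ℚᵘ ℚ.≤ 1ℚᵘ ℚ.+ ℚ.∣ x N ∣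
    1≤b = begin
      1ℚᵘ                   ≃⟨ ℚ.≃-sym (ℚ.+-identityʳ 1ℚᵘ) ⟩
      1ℚᵘ ℚ.+ 0ℚᵘ           ≤⟨ ℚ.+-monoʳ-≤ 1ℚᵘ (ℚ.0≤∣p∣ (x N)) ⟩
      1ℚᵘ ℚ.+ ℚ.∣ x N ∣     ∎
    split : ∀ p q → p ℚ.≃ (p ℚ.- q) ℚ.+ q
    split = solve 2 (λ p q → p := (p :- q) :+ q) ℚ.≃-refl
      where open +-*-Solver
    bound : ∀ n → N ℕ.≤ n → ℚ.∣ x n ∣ ℚ.≤ 1ℚᵘ ℚ.+ ℚ.∣ x N ∣
    bound n N≤n = begin
      ℚ.∣ x n ∣                           ≃⟨ ℚ.∣-∣-cong (split (x n) (x N)) ⟩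
      ℚ.∣ (x n ℚ.- x N) ℚ.+ x N ∣         ≤⟨ ℚ.∣p+q∣≤∣p∣+∣q∣ (x n ℚ.- x N) (x N) ⟩
      ℚ.∣ x n ℚ.- x N ∣ ℚ.+ ℚ.∣ x N ∣     ≤⟨ ℚ.+-monoˡ-≤ ℚ.∣ x N ∣ (h n N N≤n ℕ.≤-refl) ⟩
      1ℚᵘ ℚ.+ ℚ.∣ x N ∣                   ∎

  shrink : ∀ b ε → .{{ℚ.Positive b}} → .{{ℚ.Positive ε}} →
           ∃ λ δ → ℚ.Positive δ × b ℚ.* δ ℚ.≃ ½ ℚ.* ε
  shrink b ε = 1/b ℚ.* (½ ℚ.* ε) ,
      ℚ.pos*pos⇒pos 1/b {{ℚ.1/pos⇒pos b}} (½ ℚ.* ε) {{half-pos ε}} , eq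
    where
    instance
      b≢0 : ℚ.NonZero b
      b≢0 = ℚ.pos⇒nonZero b
    1/b : ℚᵘ
    1/b = ℚ.1/ b
    open import Relation.Binary.Reasoning.Setoid ℚ.≃-setoid
    eq : b ℚ.* (1/b ℚ.* (½ ℚ.* ε)) ℚ.≃ ½ ℚ.* ε
    eq = begin
      b ℚ.* (1/b ℚ.* (½ ℚ.* ε))    ≈⟨ ℚ.≃-sym (ℚ.*-assoc b 1/b (½ ℚ.* ε)) ⟩
      b ℚ.* 1/b ℚ.* (½ ℚ.* ε)      ≈⟨ ℚ.*-congʳ (ℚ.*-inverseʳ b) ⟩
      1ℚᵘ ℚ.* (½ ℚ.* ε)            ≈⟨ ℚ.*-identityˡ (½ ℚ.* ε) ⟩
      ½ ℚ.* ε                      ∎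

  +-cauchy : ∀ x y → IsCauchy x → IsCauchy y → IsCauchy (λ n → x n ℚ.+ y n)
  +-cauchy x y cx cy ε with cx (½ ℚ.* ε) {{half-pos ε}} | cy (½ ℚ.* ε) {{half-pos ε}}
  ... | N₁ , h₁ | N₂ , h₂ = N₁ ⊔ N₂ , close
    where
    open ℚ.≤-Reasoning
    regroup : ∀ a b c d → (a ℚ.+ b) ℚ.- (c ℚ.+ d) ℚ.≃ (a ℚ.- c) ℚ.+ (b ℚ.- d)
    regroup = solve 4 (λ a b c d → (a :+ b) :- (c :+ d) := (a :- c) :+ (b :- d)) ℚ.≃-refl
      where open +-*-Solver
    close : ∀ m n → N₁ ⊔ N₂ ℕ.≤ m → N₁ ⊔ N₂ ℕ.≤ n →
            ℚ.∣ (x m ℚ.+ y m) ℚ.- (x n ℚ.+ y n) ∣ ℚ.≤ ε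
    close m n p q = begin
      ℚ.∣ (x m ℚ.+ y m) ℚ.- (x n ℚ.+ y n) ∣
        ≃⟨ ℚ.∣-∣-cong (regroup (x m) (y m) (x n) (y n)) ⟩
      ℚ.∣ (x m ℚ.- x n) ℚ.+ (y m ℚ.- y n) ∣
        ≤⟨ ℚ.∣p+q∣≤∣p∣+∣q∣ (x m ℚ.- x n) (y m ℚ.- y n) ⟩
      ℚ.∣ x m ℚ.- x n ∣ ℚ.+ ℚ.∣ y m ℚ.- y n ∣
        ≤⟨ ℚ.+-mono-≤ (h₁ m n (ℕ.m⊔n≤o⇒m≤o N₁ N₂ p) (ℕ.m⊔n≤o⇒m≤o N₁ N₂ q))
                      (h₂ m n (ℕ.m⊔n≤o⇒n≤o N₁ N₂ p) (ℕ.m⊔n≤o⇒n≤o N₁ N₂ q)) ⟩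
      ½ ℚ.* ε ℚ.+ ½ ℚ.* ε
        ≃⟨ half+half ε ⟩
      ε ∎

  neg-cauchy : ∀ x → IsCauchy x → IsCauchy (λ n → ℚ.- x n)
  neg-cauchy x cx ε with cx ε
  ... | N , h = N , λ m n p q → begin
      ℚ.∣ (ℚ.- x m) ℚ.- (ℚ.- x n) ∣  ≃⟨ ℚ.∣-∣-cong (swap (x m) (x n)) ⟩
      ℚ.∣ x n ℚ.- x m ∣              ≤⟨ h n m q p ⟩
      ε                              ∎
    where
    open ℚ.≤-Reasoning
    swap : ∀ a b → (ℚ.- a) ℚ.- (ℚ.- b) ℚ.≃ b ℚ.- a
    swap = solve 2 (λ a b → (:- a) :- (:- b) := b :- a) ℚ.≃-refl
      where open +-*-Solver

  *-cauchy : ∀ x y → IsCauchy x → IsCauchy y → IsCauchy (λ n → x n ℚ.* y n)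
  *-cauchy x y cx cy ε with bounded x cx | bounded y cy
  ... | a , a>0 , N₁ , bx | b , b>0 , N₂ , by
    with shrink a ε {{a>0}} | shrink b ε {{b>0}}
  ... | δ , δ>0 , aδ | γ , γ>0 , bγ
    with cy δ {{δ>0}} | cx γ {{γ>0}}
  ... | N₃ , hy | N₄ , hx = (N₁ ⊔ N₂) ⊔ (N₃ ⊔ N₄) , close
    where
    open ℚ.≤-Reasoning
    regroup : ∀ p q r s → p ℚ.* q ℚ.- r ℚ.* s ℚ.≃ p ℚ.* (q ℚ.- s) ℚ.+ s ℚ.* (p ℚ.- r)
    regroup = solve 4 (λ p q r s → p :* q :- r :* s := p :* (q :- s) :+ s :* (p :- r)) ℚ.≃-refl
      where open +-*-Solver
    mult : ∀ p q {c d} → ℚ.∣ p ∣ ℚ.≤ c → ℚ.∣ q ∣ ℚ.≤ d → ℚ.∣ p ℚ.* q ∣ ℚ.≤ c ℚ.* d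
    mult p q {c} {d} p≤c q≤d = begin
      ℚ.∣ p ℚ.* q ∣          ≡⟨ ℚ.∣p*q∣≡∣p∣*∣q∣ p q ⟩
      ℚ.∣ p ∣ ℚ.* ℚ.∣ q ∣
        ≤⟨ ℚ.*-mono-≤-nonNeg {{ℚ.∣-∣-nonNeg p}} {{ℚ.∣-∣-nonNeg q}} p≤c q≤d ⟩
      c ℚ.* d                ∎
    close : ∀ m n → (N₁ ⊔ N₂) ⊔ (N₃ ⊔ N₄) ℕ.≤ m → (N₁ ⊔ N₂) ⊔ (N₃ ⊔ N₄) ℕ.≤ n →
            ℚ.∣ x m ℚ.* y m ℚ.- x n ℚ.* y n ∣ ℚ.≤ ε
    close m n p q = begin
      ℚ.∣ x m ℚ.* y m ℚ.- x n ℚ.* y n ∣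
        ≃⟨ ℚ.∣-∣-cong (regroup (x m) (y m) (x n) (y n)) ⟩
      ℚ.∣ x m ℚ.* (y m ℚ.- y n) ℚ.+ y n ℚ.* (x m ℚ.- x n) ∣
        ≤⟨ ℚ.∣p+q∣≤∣p∣+∣q∣ (x m ℚ.* (y m ℚ.- y n)) (y n ℚ.* (x m ℚ.- x n)) ⟩
      ℚ.∣ x m ℚ.* (y m ℚ.- y n) ∣ ℚ.+ ℚ.∣ y n ℚ.* (x m ℚ.- x n) ∣
        ≤⟨ ℚ.+-mono-≤
             (mult (x m) (y m ℚ.- y n)
               (bx m (ℕ.m⊔n≤o⇒m≤o N₁ N₂ (l m p)))
               (hy m n (ℕ.m⊔n≤o⇒m≤o N₃ N₄ (r m p)) (ℕ.m⊔n≤o⇒m≤o N₃ N₄ (r n q))))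
             (mult (y n) (x m ℚ.- x n)
               (by n (ℕ.m⊔n≤o⇒n≤o N₁ N₂ (l n q)))
               (hx m n (ℕ.m⊔n≤o⇒n≤o N₃ N₄ (r m p)) (ℕ.m⊔n≤o⇒n≤o N₃ N₄ (r n q)))) ⟩
      a ℚ.* δ ℚ.+ b ℚ.* γ
        ≃⟨ ℚ.+-cong aδ bγ ⟩
      ½ ℚ.* ε ℚ.+ ½ ℚ.* ε
        ≃⟨ half+half ε ⟩
      ε ∎
      where
      l : ∀ k → (N₁ ⊔ N₂) ⊔ (N₃ ⊔ N₄) ℕ.≤ k → N₁ ⊔ N₂ ℕ.≤ k
      l k = ℕ.m⊔n≤o⇒m≤o (N₁ ⊔ N₂) (N₃ ⊔ N₄)
      r : ∀ k → (N₁ ⊔ N₂) ⊔ (N₃ ⊔ N₄) ℕ.≤ k → N₃ ⊔ N₄ ℕ.≤ k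
      r k = ℕ.m⊔n≤o⇒n≤o (N₁ ⊔ N₂) (N₃ ⊔ N₄)

  const-cauchy : ∀ q → IsCauchy (λ _ → q)
  const-cauchy q ε = 0 , λ _ _ _ _ → begin
      ℚ.∣ q ℚ.- q ∣  ≃⟨ ℚ.∣-∣-cong (ℚ.+-inverseʳ q) ⟩
      0ℚᵘ            ≤⟨ ℚ.<⇒≤ (ℚ.positive⁻¹ ε) ⟩
      ε              ∎
    where open ℚ.≤-Reasoning

fromℚ : ℚᵘ → ℝ
fromℚ q = mkℝ (λ _ → q) (const-cauchy q)

fromℤ : ℤ → ℝ
fromℤ z = fromℚ (mkℚᵘ z 0)

fromℕ : ℕ → ℝ
fromℕ n = fromℤ (pos n)

0ᴿ 1ᴿ : ℝ
0ᴿ = fromℕ 0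
1ᴿ = fromℕ 1

_+ᴿ_ _*ᴿ_ : ℝ → ℝ → ℝ
x +ᴿ y = mkℝ (λ n → seq x n ℚ.+ seq y n) (+-cauchy (seq x) (seq y) (cauchy x) (cauchy y))
x *ᴿ y = mkℝ (λ n → seq x n ℚ.* seq y n) (*-cauchy (seq x) (seq y) (cauchy x) (cauchy y))

-ᴿ_ : ℝ → ℝ
-ᴿ x = mkℝ (λ n → ℚ.- seq x n) (neg-cauchy (seq x) (cauchy x))

_-ᴿ_ : ℝ → ℝ → ℝ
x -ᴿ y = x +ᴿ (-ᴿ y)

+ᴿ-0ᴿ-rawMonoid : RawMonoid 0ℓ 0ℓ
+ᴿ-0ᴿ-rawMonoid = record { Carrier = ℝ ; _≈_ = _≃ᴿ_ ; _∙_ = _+ᴿ_ ; ε = 0ᴿ }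

open RawMonoidDefs +ᴿ-0ᴿ-rawMonoid public using () renaming (sum to sumᴿ)

-- Nonnegative reals, written ℝ⁺ although zero is included.
ℝ⁺ : Set
ℝ⁺ = Σ ℝ λ x → 0ᴿ ≤ᴿ x

fromℕ⁺ : ℕ → ℝ⁺
fromℕ⁺ n = fromℕ n , *≤* λ ε → 0 , λ _ _ → begin
    0ℚᵘ                       ≃⟨ ℚ.≃-sym (ℚ.+-identityʳ 0ℚᵘ) ⟩
    0ℚᵘ ℚ.+ 0ℚᵘ               ≤⟨ ℚ.+-mono-≤ (ℚ.nonNegative⁻¹ (mkℚᵘ (pos n) 0)) (ℚ.<⇒≤ (ℚ.positive⁻¹ ε)) ⟩
    mkℚᵘ (pos n) 0 ℚ.+ ε      ∎
  where open ℚ.≤-Reasoning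

Nondecreasing : (ℝ⁺ → ℝ⁺ → ℝ⁺) → Set
Nondecreasing f = ∀ x₁ x₂ y₁ y₂ → proj₁ x₁ ≤ᴿ proj₁ x₂ → proj₁ y₁ ≤ᴿ proj₁ y₂ →
  proj₁ (f x₁ y₁) ≤ᴿ proj₁ (f x₂ y₂)

record Graph : Set₁ where
  field
    order  : ℕ
    Adj    : Rel (Fin order) 0ℓ
    adj?   : B.Decidable Adj
    sym    : B.Symmetric Adj
    irrefl : B.Irreflexive _≡_ Adj

open Graph public using (order)

Vertex : Graph → Set
Vertex G = Fin (order G)

size : Graph → ℕ
size G = length (filter (λ e → (proj₁ e Fin.<? proj₂ e) ×-dec Graph.adj? G (proj₁ e) (proj₂ e))
                        (cartesianProduct (allFin (order G)) (allFin (order G))))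

_≅_ : Rel Graph 0ℓ
G ≅ H = Σ (Vertex G ↔ Vertex H) λ φ →
  ∀ u v → Graph.Adj G u v ⇔ Graph.Adj H (Inverse.to φ u) (Inverse.to φ v)

record GraphClass (ℓ : Level) : Set (lsuc 0ℓ Level.⊔ lsuc ℓ) where
  field
    Member : Pred Graph ℓ
    resp-≅ : ∀ {G H} → G ≅ H → Member G → Member H

open GraphClass public using (Member)

-- The vertices satisfying P are renumbered in increasing order.
induced : (G : Graph) {P : Pred (Vertex G) 0ℓ} → Decidable P → Graph
induced G P? = record
  { order  = length vs
  ; Adj    = λ i j → Graph.Adj G (lookup vs i) (lookup vs j)
  ; adj?   = λ i j → Graph.adj? G (lookup vs i) (lookup vs j)
  ; sym    = Graph.sym G
  ; irrefl = λ { refl → Graph.irrefl G refl }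
  }
  where
  vs : List (Vertex G)
  vs = filter P? (allFin (order G))

ClosedNbhd : (G : Graph) → Vertex G → Pred (Vertex G) 0ℓ
ClosedNbhd G v u = u ≡ v ⊎ Graph.Adj G v u

closedNbhd? : (G : Graph) (v : Vertex G) → Decidable (ClosedNbhd G v)
closedNbhd? G v u = (u Fin.≟ v) ⊎-dec Graph.adj? G v u

_-N[_] : (G : Graph) → Vertex G → Graph
G -N[ v ] = induced G (λ u → ¬? (closedNbhd? G v u))

Independent : (G : Graph) → Subset (order G) → Set
Independent G I = ∀ {u v} → u ∈ I → v ∈ I → ¬ Graph.Adj G u v

MaximalIndependent : (G : Graph) → Subset (order G) → Set
MaximalIndependent G I = Independent G I × (∀ J → Independent G J → ¬ (I ⊂ J))

weight : ∀ {n} → (Fin n → ℝ) → Subset n → ℝ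
weight w I = sumᴿ λ v → if does (v ∈? I) then w v else 0ᴿ

WellCoveredWeighting : (G : Graph) → (Vertex G → ℝ) → Set
WellCoveredWeighting G w =
  ∀ I J → MaximalIndependent G I → MaximalIndependent G J → weight w I ≃ᴿ weight w J

-- A homogeneous linear equation ∑ᵥ aᵥ xᵥ = 0 is given by its coefficients.
Equation : ℕ → Set
Equation n = Fin n → ℝ

System : ℕ → Set
System n = List (Equation n)

_Satisfies_ : ∀ {n} → (Fin n → ℝ) → System n → Set
w Satisfies S = All (λ a → sumᴿ (λ v → a v *ᴿ w v) ≃ᴿ 0ᴿ) S

IsWellCoveringSystem : (G : Graph) → System (order G) → Set
IsWellCoveringSystem G S = ∀ w → WellCoveredWeighting G w ⇔ (w Satisfies S)

data Kind : Set where
  rational integer unit : Kind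

CoefficientOfKind : Kind → Pred ℝ 0ℓ
CoefficientOfKind rational c = ∃ λ q → c ≃ᴿ fromℚ q
CoefficientOfKind integer  c = ∃ λ z → c ≃ᴿ fromℤ z
CoefficientOfKind unit     c = c ≃ᴿ -ᴿ 1ᴿ ⊎ c ≃ᴿ 0ᴿ ⊎ c ≃ᴿ 1ᴿ

SystemOfKind : ∀ {n} → Kind → System n → Set
SystemOfKind κ S = All (λ a → ∀ v → CoefficientOfKind κ (a v)) S

-- Model of computation: a random access machine under the uniform cost criterion, presented as a
-- structured language.  A program is a finite syntactic object using finitely
-- many registers and unbounded arrays of natural numbers; each instruction and
-- each evaluation of a branch or loop condition takes one unit of time.
-- Output is written one number at a time to a write-only tape, so the length
-- of the output never exceeds the running time.

data Op : Set where
  add sub mul div : Op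

-- Subtraction is truncated; division rounds down, and n / 0 = 0.
⟦_⟧ : Op → ℕ → ℕ → ℕ
⟦ add ⟧ m n       = m ℕ.+ n
⟦ sub ⟧ m n       = m ℕ.∸ n
⟦ mul ⟧ m n       = m ℕ.* n
⟦ div ⟧ m zero    = 0
⟦ div ⟧ m (suc n) = m ℕ./ suc n

Reg Arr : Set
Reg = ℕ
Arr = ℕ

infixr 5 _︔_

data Program : Set where
  skip  : Program
  const : Reg → ℕ → Program              -- x := k
  arith : Op → Reg → Reg → Reg → Program -- x := y op z
  load  : Reg → Arr → Reg → Program      -- x := a[y]
  store : Arr → Reg → Reg → Program      -- a[x] := y
  write : Reg → Program
  _︔_   : Program → Program → Program
  cond  : Reg → Program → Program → Program -- if x ≠ 0 then _ else _
  while : Reg → Program → Program           -- while x ≠ 0 do _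

record State : Set where
  constructor mkState
  field
    reg : Reg → ℕ
    arr : Arr → ℕ → ℕ

open State public

_[_↦_] : ∀ {A : Set} → (ℕ → A) → ℕ → A → (ℕ → A)
(h [ k ↦ a ]) j = if does (j ℕ.≟ k) then a else h j

setReg : State → Reg → ℕ → State
setReg s x k = mkState (reg s [ x ↦ k ]) (arr s)

setArr : State → Arr → ℕ → ℕ → State
setArr s a i k = mkState (reg s) (arr s [ a ↦ arr s a [ i ↦ k ] ])

infix 3 ⟨_,_⟩⇓⟨_,_,_⟩

-- ⟨ p , s ⟩⇓⟨ s′ , ys , t ⟩ : started in state s, the program p halts in state
-- s′ after exactly t units of time, having written ys (in this order).
data ⟨_,_⟩⇓⟨_,_,_⟩ : Program → State → State → List ℕ → ℕ → Set where
  ⇓skip  : ∀ {s} → ⟨ skip , s ⟩⇓⟨ s , [] , 1 ⟩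
  ⇓const : ∀ {s x k} → ⟨ const x k , s ⟩⇓⟨ setReg s x k , [] , 1 ⟩
  ⇓arith : ∀ {s o x y z} →
           ⟨ arith o x y z , s ⟩⇓⟨ setReg s x (⟦ o ⟧ (reg s y) (reg s z)) , [] , 1 ⟩
  ⇓load  : ∀ {s x a y} → ⟨ load x a y , s ⟩⇓⟨ setReg s x (arr s a (reg s y)) , [] , 1 ⟩
  ⇓store : ∀ {s a x y} → ⟨ store a x y , s ⟩⇓⟨ setArr s a (reg s x) (reg s y) , [] , 1 ⟩
  ⇓write : ∀ {s x} → ⟨ write x , s ⟩⇓⟨ s , [ reg s x ] , 1 ⟩
  ⇓seq   : ∀ {p q s s′ s″ ys zs t u} →
           ⟨ p , s ⟩⇓⟨ s′ , ys , t ⟩ → ⟨ q , s′ ⟩⇓⟨ s″ , zs , u ⟩ →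
           ⟨ p ︔ q , s ⟩⇓⟨ s″ , ys ++ zs , t ℕ.+ u ⟩
  ⇓then  : ∀ {p q s s′ x ys t} → ¬ (reg s x ≡ 0) →
           ⟨ p , s ⟩⇓⟨ s′ , ys , t ⟩ → ⟨ cond x p q , s ⟩⇓⟨ s′ , ys , suc t ⟩
  ⇓else  : ∀ {p q s s′ x ys t} → reg s x ≡ 0 →
           ⟨ q , s ⟩⇓⟨ s′ , ys , t ⟩ → ⟨ cond x p q , s ⟩⇓⟨ s′ , ys , suc t ⟩
  ⇓stop  : ∀ {p s x} → reg s x ≡ 0 → ⟨ while x p , s ⟩⇓⟨ s , [] , 1 ⟩
  ⇓loop  : ∀ {p s s′ s″ x ys zs t u} → ¬ (reg s x ≡ 0) →
           ⟨ p , s ⟩⇓⟨ s′ , ys , t ⟩ → ⟨ while x p , s′ ⟩⇓⟨ s″ , zs , u ⟩ →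
           ⟨ while x p , s ⟩⇓⟨ s″ , ys ++ zs , suc (t ℕ.+ u) ⟩

-- The cells of an array holding xs, padded with zeros.
cells : List ℕ → ℕ → ℕ
cells []       _       = 0
cells (x ∷ xs) zero    = x
cells (x ∷ xs) (suc i) = cells xs i

-- The input occupies array 0; all other memory is initially zero.
initial : List ℕ → State
initial xs = mkState (λ _ → 0) ((λ _ _ → 0) [ 0 ↦ cells xs ])

Runs : Program → List ℕ → List ℕ → ℕ → Set
Runs p xs ys t = ∃ λ s′ → ⟨ p , initial xs ⟩⇓⟨ s′ , ys , t ⟩

-- Graphs are presented by adjacency lists, each in an arbitrary order.
IsAdjacencyLists : (G : Graph) → (Vertex G → List (Vertex G)) → Set
IsAdjacencyLists G nbrs =
  ∀ u → Unique (nbrs u) × (∀ v → (v List.∈ nbrs u) ⇔ Graph.Adj G u v)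

encodeGraph : (n : ℕ) → (Fin n → List (Fin n)) → List ℕ
encodeGraph n nbrs = n ∷ concatMap (λ u → length (nbrs u) ∷ map toℕ (nbrs u)) (allFin n)

-- Equations are written sparsely, as lists of terms q·xᵥ.  Several terms may
-- involve the same variable; the coefficient of that variable is then the sum
-- of theirs.
SparseEquation : ℕ → Set
SparseEquation n = List (Fin n × ℚᵘ)

coefficient : ∀ {n} → SparseEquation n → Fin n → ℚᵘ
coefficient terms v =
  foldr (λ (u , q) c → if does (u Fin.≟ v) then q ℚ.+ c else c) 0ℚᵘ terms

toSystem : ∀ {n} → List (SparseEquation n) → System n
toSystem = map λ terms v → fromℚ (coefficient terms v)

-- Sign and absolute value of the numerator, then the denominator.
encodeℚ : ℚᵘ → List ℕ
encodeℚ (mkℚᵘ (pos n)  d) = 0 ∷ n ∷ suc d ∷ []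
encodeℚ (mkℚᵘ -[1+ n ] d) = 1 ∷ suc n ∷ suc d ∷ []

encodeEquation : ∀ {n} → SparseEquation n → List ℕ
encodeEquation terms = length terms ∷ concatMap (λ (u , q) → toℕ u ∷ encodeℚ q) terms

encodeSystem : ∀ {n} → List (SparseEquation n) → List ℕ
encodeSystem = concatMap encodeEquation

record WritesWellCoveringSystem
         (κ : Kind) (p : Program) (input : List ℕ)
         (G : Graph) (timeBound sizeBound : ℝ) : Set where
  field
    equations : List (SparseEquation (order G))
    time      : ℕ
    runs      : Runs p input (encodeSystem equations) time
    time≤     : fromℕ time ≤ᴿ timeBound
    covering  : IsWellCoveringSystem G (toSystem equations)
    ofKind    : SystemOfKind κ (toSystem equations)
    size≤     : fromℕ (length (toSystem equations)) ≤ᴿ sizeBound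

-- The program must succeed on every adjacency-list presentation of G.
ComputesWellCoveringSystem : Kind → Program → (G : Graph) → (timeBound sizeBound : ℝ) → Set
ComputesWellCoveringSystem κ p G timeBound sizeBound =
  ∀ nbrs → IsAdjacencyLists G nbrs →
    WritesWellCoveringSystem κ p (encodeGraph (order G) nbrs) G timeBound sizeBound

-- f(n, m) for a graph with n vertices and m edges.
_at_ : (ℝ⁺ → ℝ⁺ → ℝ⁺) → Graph → ℝ
f at G = proj₁ (f (fromℕ⁺ (order G)) (fromℕ⁺ (size G)))

{-# OPTIONS --safe #-}
module Submission where

-- Let v₁, …, vₙ be the vertices of G and let Sₖ be a maximal independent set containing vₖ.  The maximal
-- independent sets of G that contain vₖ are the sets {vₖ} ∪ J with J maximal independent in G − N[vₖ], so
-- they all have the same weight exactly if w restricted to G − N[vₖ] is a well-covered weighting.  Hence w is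
-- a well-covered weighting of G if and only if it satisfies the systems of all G − N[vₖ] and the n − 1
-- equations w(Sₖ) − w(S₁) = 0, each of which has coefficients in {−1, 0, 1}.
--
-- For every k the program builds the adjacency lists of G − N[vₖ] and the greedy set Sₖ in time O(n + m),
-- and then runs the given program step by step, translating the vertices in its output as they are written.

open import Defs
open import Level using (Level; 0ℓ)
open import Data.Nat using (ℕ; _<_)
open import Data.Product using (∃)
open import Data.Bool.Base using (Bool; T; _∧_; _∨_; false; if_then_else_; true)
open import Data.Bool.Properties using (∨-conicalʳ; ∨-conicalˡ)
open import Data.Fin.Base as Fin using (Fin; fromℕ<; toℕ)
import Data.Fin.Properties as Fin
open import Data.Fin.Subset using (Subset) renaming (_∈_ to _∈ˢ_)
open import Data.Fin.Subset.Properties using () renaming (_∈?_ to _∈ˢ?_)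
open import Data.Integer.Base as ℤ using (-[1+_]) renaming (+_ to pos)
import Data.Integer.Properties as ℤ
open import Data.List.Base using (List; []; [_]; _++_; _∷_; _∷ʳ_; allFin; cartesianProduct; concatMap; filter; foldl; foldr; length; lookup; map; tabulate)
import Data.List.Membership.DecPropositional as DecMembership
open import Data.List.Membership.Propositional using (_∈_; find; lose)
open import Data.List.Membership.Propositional.Properties using (∈-++⁺ʳ; ∈-++⁺ˡ; ∈-++⁻; ∈-allFin; ∈-cartesianProduct⁺; ∈-filter⁺; ∈-filter⁻; ∈-lookup; ∈-map⁺; ∈-map⁻; ∈-∃++)
open import Data.List.Properties using (++-assoc; ++-identityʳ; concatMap-++; concatMap-cong; concatMap-map; filter-++; filter-accept; filter-reject; foldl-∷ʳ; length-++; length-filter; length-map; length-tabulate; map-++; map-cong; map-tabulate; map-∘; tabulate-lookup; ∷-injective)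
open import Data.List.Relation.Unary.All as All using (All; []; _∷_)
open import Data.List.Relation.Unary.All.Properties as All using (all-filter)
open import Data.List.Relation.Unary.AllPairs using (AllPairs; []; _∷_)
import Data.List.Relation.Unary.AllPairs.Properties as AllPairs
open import Data.List.Relation.Unary.Any using (Any; any?; here; index; there)
open import Data.List.Relation.Unary.Any.Properties using (lookup-index)
open import Data.List.Relation.Unary.Unique.Propositional using (Unique)
import Data.List.Relation.Unary.Unique.Propositional.Properties as UniqueProperties
open import Data.Nat.Base as ℕ using (NonZero; _*_; _+_; _∸_; _≡ᵇ_; _≤_; suc; s≤s; s≤s⁻¹; zero; z≤n)
open import Data.Nat.DivMod using ([m+kn]%n≡m%n; _%_; m<n⇒m%n≡m)
open import Data.Nat.ListAction using (sum)
open import Data.Nat.Properties as ℕ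
open import Data.Nat.Tactic.RingSolver using (solve-∀)
open import Data.Product.Base using (_,_; _×_; proj₁; proj₂)
open import Data.Rational.Unnormalised.Base as ℚ using (0ℚᵘ; 1ℚᵘ; _≃_; mkℚᵘ; ½; ℚᵘ)
import Data.Rational.Unnormalised.Properties as ℚ
open import Data.Rational.Unnormalised.Solver using (module +-*-Solver)
open import Data.Sum.Base using ([_,_]′; _⊎_; inj₁; inj₂)
open import Data.Unit.Base using (tt; ⊤)
import Data.Vec.Base as Vec
open import Data.Vec.Properties using ([]=⇒lookup; lookup⇒[]=; lookup∘tabulate)
open import Function.Base using (_∘_; id)
open import Function.Bundles using (Equivalence; _⇔_; mk⇔)
open import Relation.Binary.Definitions using (tri<; tri>; tri≈)
open import Relation.Binary.PropositionalEquality hiding ([_])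
import Relation.Binary.Reasoning.Setoid as SetoidReasoning
open import Relation.Nullary using (Dec; contradiction; does; no; yes; ¬_)
open import Relation.Nullary.Decidable using (_×-dec_; _⊎-dec_; dec-false; dec-true; decidable-stable; does-⇔; ¬?)
open import Relation.Unary using (Decidable; Pred)

-- Sufficiency is a chain: a maximal independent set S is nonempty, hence contains some vₖ, and w(S)
-- = w(Sₖ) follows from the system of G - N[vₖ], while w(Sₖ) = w(S₁) is an added equation. The first
-- vertex adds none, whence n - 1. The obstacle is the machine. The given program is arbitrary: it
-- names its own registers and arrays, expects zeroed memory and may scatter its writes, so wiping
-- its traces would take bookkeeping; and its output tape is write-only, so vertex numbers cannot be
-- corrected afterwards. It is therefore compiled instruction by instruction, with private memory
-- for each run and an automaton at each `write`, which costs a factor 16 in time. The bounds f and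
-- g are real, so the maximal running time and system size over all vertices are taken among the
-- natural numbers attained. The constant 270 is 2 * 135: an iteration, with its share of the
-- overhead, costs at most 135 units per cell of the encoded graph besides the simulation, and there
-- are at most 1 + n + 2m ≤ 2(n + m) cells when n > 0.

updated : ∀ {A : Set} (h : ℕ → A) k {a} → (h [ k ↦ a ]) k ≡ a
updated h k with k ≡ᵇ k | ≡⇒≡ᵇ k k refl
... | true | _ = refl

updated-≡ : ∀ {A : Set} (h : ℕ → A) {j k a} → j ≡ k → (h [ k ↦ a ]) j ≡ a
updated-≡ h refl = updated h _

untouched : ∀ {A : Set} (h : ℕ → A) {j k a} → ¬ (j ≡ k) → (h [ k ↦ a ]) j ≡ h j
untouched h {j} {k} j≢k with j ≡ᵇ k | ≡ᵇ⇒≡ j k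
... | true  | j≡k = contradiction (j≡k tt) j≢k
... | false | _   = refl

-- Frame conditions and time-bounded execution

writesReg : Program → Reg → Bool
writesReg skip            r = false
writesReg (const x _)     r = does (r ≟ x)
writesReg (arith _ x _ _) r = does (r ≟ x)
writesReg (load x _ _)    r = does (r ≟ x)
writesReg (store _ _ _)   r = false
writesReg (write _)       r = false
writesReg (p ︔ q)         r = writesReg p r ∨ writesReg q r
writesReg (cond _ p q)    r = writesReg p r ∨ writesReg q r
writesReg (while _ p)     r = writesReg p r

writesArr : Program → Arr → Bool
writesArr (store a _ _) b = does (b ≟ a)
writesArr (p ︔ q)       b = writesArr p b ∨ writesArr q b
writesArr (cond _ p q)  b = writesArr p b ∨ writesArr q b
writesArr (while _ p)   b = writesArr p b
writesArr _             b = false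

-- The written registers and arrays are computed from the syntax as Booleans, so for a concrete
-- program the side condition of a frame fact is just `refl`.
record Unchanged (p : Program) (s s′ : State) : Set where
  constructor unchanged
  field
    regs : ∀ r → writesReg p r ≡ false → reg s′ r ≡ reg s r
    arrs : ∀ a → writesArr p a ≡ false → ∀ i → arr s′ a i ≡ arr s a i

open Unchanged public

frame : ∀ {p s s′ ys t} → ⟨ p , s ⟩⇓⟨ s′ , ys , t ⟩ → Unchanged p s s′
frame ⇓skip  = unchanged (λ _ _ → refl) (λ _ _ _ → refl)
frame (⇓const {s} {x} {k}) =
  unchanged (λ r r≢x → cong (if_then k else reg s r) r≢x) (λ _ _ _ → refl)
frame (⇓arith {s} {o} {x} {y} {z}) =
  unchanged (λ r r≢x → cong (if_then ⟦ o ⟧ (reg s y) (reg s z) else reg s r) r≢x) (λ _ _ _ → refl)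
frame (⇓load {s} {x} {a} {y}) =
  unchanged (λ r r≢x → cong (if_then arr s a (reg s y) else reg s r) r≢x) (λ _ _ _ → refl)
frame (⇓store {s} {a} {x} {y}) = unchanged (λ _ _ → refl)
  λ b b≢a i → cong (λ c → (if c then arr s a [ reg s x ↦ reg s y ] else arr s b) i) b≢a
frame ⇓write = unchanged (λ _ _ → refl) (λ _ _ _ → refl)
frame (⇓seq d e) with frame d | frame e
... | unchanged r a | unchanged r′ a′ = unchanged
  (λ x h → trans (r′ x (∨-conicalʳ _ _ h)) (r x (∨-conicalˡ _ _ h)))
  (λ x h i → trans (a′ x (∨-conicalʳ _ _ h) i) (a x (∨-conicalˡ _ _ h) i))
frame (⇓then _ d) with frame d
... | unchanged r a = unchanged (λ x h → r x (∨-conicalˡ _ _ h)) (λ x h → a x (∨-conicalˡ _ _ h))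
frame (⇓else {p = p} _ d) with frame d
... | unchanged r a = unchanged (λ x h → r x (∨-conicalʳ (writesReg p x) _ h)) (λ x h → a x (∨-conicalʳ (writesArr p x) _ h))
frame (⇓stop _) = unchanged (λ _ _ → refl) (λ _ _ _ → refl)
frame (⇓loop _ d e) with frame d | frame e
... | unchanged r a | unchanged r′ a′ = unchanged
  (λ x h → trans (r′ x h) (r x h)) (λ x h i → trans (a′ x h i) (a x h i))

-- A total-correctness triple. The output is fixed exactly but the time only bounded, so that
-- branches of different cost fit the same triple.
record Exec (p : Program) (s : State) (out : List ℕ) (budget : ℕ) (Post : State → Set) : Set where
  constructor exec
  field
    {final} : State
    {time}  : ℕ
    run     : ⟨ p , s ⟩⇓⟨ final , out , time ⟩
    time≤   : time ≤ budget
    post    : Post final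

weaken : ∀ {p s out b b′} {Q R : State → Set} → b ≤ b′ → (∀ {s′} → Unchanged p s s′ → Q s′ → R s′) →
         Exec p s out b Q → Exec p s out b′ R
weaken b≤b′ f (exec d t q) = exec d (≤-trans t b≤b′) (f (frame d) q)

infixr 4 _>>_
_>>_ : ∀ {p q s xs ys b c} {Q R : State → Set} →
       Exec p s xs b Q → (∀ {s′} → Unchanged p s s′ → Q s′ → Exec q s′ ys c R) →
       Exec (p ︔ q) s (xs ++ ys) (b + c) R
exec d t≤ q >> f with f (frame d) q
... | exec e u≤ r = exec (⇓seq d e) (+-mono-≤ t≤ u≤) r

-- For these programs `effect` computes the final state, so postconditions reduce by evaluation.
-- `write` is excluded because such a run is to have empty output.
straight? : Program → Bool
straight? (p ︔ q)     = straight? p ∧ straight? q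
straight? (cond _ _ _) = false
straight? (while _ _)  = false
straight? (write _)    = false
straight? _            = true

effect : Program → State → State
effect (const x k)     s = setReg s x k
effect (arith o x y z) s = setReg s x (⟦ o ⟧ (reg s y) (reg s z))
effect (load x a y)    s = setReg s x (arr s a (reg s y))
effect (store a x y)   s = setArr s a (reg s x) (reg s y)
effect (p ︔ q)         s = effect q (effect p s)
effect _               s = s

cost : Program → ℕ
cost (p ︔ q) = cost p + cost q
cost _       = 1

straight : ∀ p s → T (straight? p) → ⟨ p , s ⟩⇓⟨ effect p s , [] , cost p ⟩
straight skip            s _ = ⇓skip
straight (const x k)     s _ = ⇓const
straight (arith o x y z) s _ = ⇓arith
straight (load x a y)    s _ = ⇓load
straight (store a x y)   s _ = ⇓store
straight (p ︔ q)         s h with straight? p in eq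
... | true = ⇓seq (straight p s (subst T (sym eq) tt)) (straight q (effect p s) h)

block : ∀ p {s} {h : T (straight? p)} {Q : State → Set} → Q (effect p s) → Exec p s [] (cost p) Q
block p {s} {h} q = exec (straight p s h) ≤-refl q

infixr 4 _then_
_then_ : ∀ p {q s ys c} {h : T (straight? p)} {R : State → Set} →
         Exec q (effect p s) ys c R → Exec (p ︔ q) s ys (cost p + c) R
_then_ p {h = h} (exec e u≤ r) = exec (⇓seq (straight p _ h) e) (+-monoʳ-≤ (cost p) u≤) r

module _ {A : Set} (f : A → List ℕ) (β : A → ℕ) (x : Reg) (body : Program) (s₀ : State) (all : List A)
         (Inv : List A → List A → State → Set)
         (step : ∀ done u todo s → done ++ u ∷ todo ≡ all → Unchanged body s₀ s →
                 Inv done (u ∷ todo) s → reg s x ≡ suc (length todo) →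
                 Exec body s (f u) (β u) λ s′ → reg s′ x ≡ length todo × Inv (done ∷ʳ u) todo s′) where

  -- The list exists only in the proof; the machine sees a counter running down.
  -- `Unchanged body s₀ s` hands each step everything the body never writes, relative to the entry
  -- of the loop, so such facts stay out of `Inv`.
  forEach-from : ∀ done todo s → done ++ todo ≡ all → Unchanged body s₀ s → Inv done todo s → reg s x ≡ length todo →
                 Exec (while x body) s (concatMap f todo) (suc (sum (map (λ u → suc (β u)) todo))) (Inv all [])
  forEach-from done [] s eq _ inv x≡0 =
    exec (⇓stop x≡0) ≤-refl (subst (λ xs → Inv xs [] s) (trans (sym (++-identityʳ done)) eq) inv)
  forEach-from done (u ∷ todo) s eq uc inv x≡ with step done u todo s eq uc inv x≡
  ... | exec d t≤ (x≡′ , inv′)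
    with forEach-from (done ∷ʳ u) todo _ (trans (++-assoc done [ u ] todo) eq)
           (unchanged (λ r h → trans (regs (frame d) r h) (regs uc r h))
                      (λ a h i → trans (arrs (frame d) a h i) (arrs uc a h i))) inv′ x≡′
  ... | exec e u≤ q = exec (⇓loop (λ x≡0 → 1+n≢0 (trans (sym x≡) x≡0)) d e)
    (s≤s (≤-trans (+-mono-≤ t≤ u≤) (≤-reflexive (+-suc (β u) _)))) q

  forEach : Inv [] all s₀ → reg s₀ x ≡ length all →
            Exec (while x body) s₀ (concatMap f all) (suc (sum (map (λ u → suc (β u)) all))) (Inv all [])
  forEach = forEach-from [] all s₀ refl (unchanged (λ _ _ → refl) (λ _ _ _ → refl))

-- Adding the budgets of the branches instead of taking their maximum loses only a constant factor
-- and keeps all bounds polynomial.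
if-zero : ∀ {x p q s out b c} {Q : State → Set} →
  (¬ (reg s x ≡ 0) → Exec p s out b Q) → (reg s x ≡ 0 → Exec q s out c Q) →
  Exec (cond x p q) s out (suc (b + c)) Q
if-zero {x} {s = s} {b = b} {c} f g with reg s x ≟ 0
... | yes x≡0 with g x≡0
...   | exec d t≤ q = exec (⇓else x≡0 d) (s≤s (≤-trans t≤ (m≤n+m c b))) q
if-zero {b = b} {c} f g | no x≢0 with f x≢0
...   | exec d t≤ q = exec (⇓then x≢0 d) (s≤s (≤-trans t≤ (m≤m+n b c))) q

silent : ∀ {A : Set} {p s b} {Q : State → Set} (xs : List A) → Exec p s (concatMap (λ _ → []) xs) b Q → Exec p s [] b Q
silent xs = subst (λ o → Exec _ _ o _ _) (none xs)
  where
  none : ∀ {A : Set} (xs : List A) → concatMap (λ _ → List.[] {A = ℕ}) xs ≡ []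
  none []       = refl
  none (x ∷ xs) = none xs

writing : ∀ {x q s ys c} {R : State → Set} → Exec q s ys c R → Exec (write x ︔ q) s (reg s x ∷ ys) (suc c) R
writing (exec d t≤ r) = exec (⇓seq ⇓write d) (s≤s t≤) r

-- Simulation inside one slice of the memory

-- Slice k of an array consists of its cells i * n + k.  Run k of the given program uses slice k only:
-- its register r is cell r * n + k of array 5, and cell i of its array a is cell i * n + k of inner a.
-- Every run therefore starts from zeroed memory, and nothing has to be cleared between runs.
pattern Nᵣ    = 0
pattern Kᵣ    = 1
pattern oneᵣ  = 2
pattern leftᵣ = 3
pattern dueᵣ  = 4
pattern tmp₁ᵣ = 5
pattern tmp₂ᵣ = 6
pattern tmp₃ᵣ = 7
pattern addrᵣ = 8

pattern input = 0
pattern mark  = 1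
pattern new   = 2
pattern old   = 3
pattern sets  = 4

inner : Arr → Arr
inner a = 6 + a

fetch : Reg → Reg → Program
fetch t x = const addrᵣ x ︔ arith mul addrᵣ addrᵣ Nᵣ ︔ arith add addrᵣ addrᵣ Kᵣ ︔ load t 5 addrᵣ

save : Reg → Program
save x = const addrᵣ x ︔ arith mul addrᵣ addrᵣ Nᵣ ︔ arith add addrᵣ addrᵣ Kᵣ ︔ store 5 addrᵣ tmp₂ᵣ

toSlice : Reg → Program
toSlice t = arith mul t t Nᵣ ︔ arith add t t Kᵣ

-- Follows the format of encodeSystem: leftᵣ counts the terms of the current equation that are not yet
-- complete, dueᵣ the numbers still missing from the current term.  Only the first number of a term is a
-- vertex, and only that number is renumbered.
relay : Program
relay =
  cond leftᵣ
    (cond dueᵣ (write tmp₂ᵣ ︔ arith sub dueᵣ dueᵣ oneᵣ ︔ cond dueᵣ skip (arith sub leftᵣ leftᵣ oneᵣ))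
              (load tmp₂ᵣ old tmp₂ᵣ ︔ write tmp₂ᵣ ︔ const dueᵣ 3))
    (write tmp₂ᵣ ︔ const leftᵣ 0 ︔ arith add leftᵣ leftᵣ tmp₂ᵣ)

inSlice : Program → Program
inSlice skip            = skip
inSlice (const x k)     = const tmp₂ᵣ k ︔ save x
inSlice (arith o x y z) = fetch tmp₁ᵣ y ︔ fetch tmp₂ᵣ z ︔ arith o tmp₂ᵣ tmp₁ᵣ tmp₂ᵣ ︔ save x
inSlice (load x a y)    = fetch tmp₂ᵣ y ︔ toSlice tmp₂ᵣ ︔ load tmp₂ᵣ (inner a) tmp₂ᵣ ︔ save x
inSlice (store a x y)   = fetch tmp₁ᵣ x ︔ toSlice tmp₁ᵣ ︔ fetch tmp₂ᵣ y ︔ store (inner a) tmp₁ᵣ tmp₂ᵣ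
inSlice (write x)       = fetch tmp₂ᵣ x ︔ relay
inSlice (p ︔ q)         = inSlice p ︔ inSlice q
inSlice (cond x p q)    = fetch tmp₃ᵣ x ︔ cond tmp₃ᵣ (inSlice p) (inSlice q)
inSlice (while x p)     = fetch tmp₃ᵣ x ︔ while tmp₃ᵣ (inSlice p ︔ fetch tmp₃ᵣ x)

module _ (r : Reg) (≢3 : (r ≡ᵇ 3) ≡ false) (≢4 : (r ≡ᵇ 4) ≡ false) (≢5 : (r ≡ᵇ 5) ≡ false)
         (≢6 : (r ≡ᵇ 6) ≡ false) (≢7 : (r ≡ᵇ 7) ≡ false) (≢8 : (r ≡ᵇ 8) ≡ false) where

  inSlice-regs : ∀ p → writesReg (inSlice p) r ≡ false
  inSlice-regs skip            = refl
  inSlice-regs (const x k)     rewrite ≢6 | ≢8 = refl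
  inSlice-regs (arith o x y z) rewrite ≢5 | ≢6 | ≢8 = refl
  inSlice-regs (load x a y)    rewrite ≢6 | ≢8 = refl
  inSlice-regs (store a x y)   rewrite ≢5 | ≢6 | ≢8 = refl
  inSlice-regs (write x)       rewrite ≢3 | ≢4 | ≢6 | ≢8 = refl
  inSlice-regs (p ︔ q)         rewrite inSlice-regs p = inSlice-regs q
  inSlice-regs (cond x p q)    rewrite ≢7 | ≢8 | inSlice-regs p = inSlice-regs q
  inSlice-regs (while x p)     rewrite ≢7 | ≢8 | inSlice-regs p = refl

module _ (b : Arr) (≢5 : (b ≡ᵇ 5) ≡ false) (≢inner : ∀ a → (b ≡ᵇ inner a) ≡ false) where

  inSlice-arrs : ∀ p → writesArr (inSlice p) b ≡ false
  inSlice-arrs skip            = refl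
  inSlice-arrs (const x k)     rewrite ≢5 = refl
  inSlice-arrs (arith o x y z) rewrite ≢5 = refl
  inSlice-arrs (load x a y)    rewrite ≢5 = refl
  inSlice-arrs (store a x y)   rewrite ≢inner a = refl
  inSlice-arrs (write x)       = refl
  inSlice-arrs (p ︔ q)         rewrite inSlice-arrs p = inSlice-arrs q
  inSlice-arrs (cond x p q)    rewrite inSlice-arrs p = inSlice-arrs q
  inSlice-arrs (while x p)     rewrite inSlice-arrs p = refl

%-slice : ∀ i {n k} .{{_ : NonZero n}} → k < n → (i * n + k) % n ≡ k
%-slice i {n} {k} k<n = begin
  (i * n + k) % n  ≡⟨ cong (_% n) (+-comm (i * n) k) ⟩
  (k + i * n) % n  ≡⟨ [m+kn]%n≡m%n k i n ⟩
  k % n            ≡⟨ m<n⇒m%n≡m k<n ⟩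
  k                ∎
  where open ≡-Reasoning

-- The residue modulo n identifies the slice; the quotient is then cancelled.
slice-injective : ∀ {n k k′} i i′ → k < n → k′ < n → i * n + k ≡ i′ * n + k′ → i ≡ i′ × k ≡ k′
slice-injective {n@(suc _)} {k} {k′} i i′ k<n k′<n eq = *-cancelʳ-≡ i i′ n
    (+-cancelʳ-≡ k (i * n) (i′ * n) (trans eq (cong (i′ * n +_) (sym k≡k′)))) , k≡k′
  where
  k≡k′ : k ≡ k′
  k≡k′ = trans (sym (%-slice i k<n)) (trans (cong (_% n) eq) (%-slice i′ k′<n))

slice-updated : ∀ (h : ℕ → ℕ) {n k} → k < n → ∀ i {v} j → (h [ i * n + k ↦ v ]) (j * n + k) ≡ ((λ j → h (j * n + k)) [ i ↦ v ]) j
slice-updated h {n} {k} k<n i j with j ≡ᵇ i | ≡ᵇ⇒≡ j i | ≡⇒≡ᵇ j i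
... | true  | j≡i | _ = updated-≡ h (cong (λ i → i * n + k) (j≡i tt))
... | false | _   | j≢i = untouched h λ eq → j≢i (proj₁ (slice-injective j i k<n k<n eq))

slice-untouched : ∀ (h : ℕ → ℕ) {n k k′} → k < n → k′ < n → ¬ (k′ ≡ k) → ∀ i {v} j →
                  (h [ i * n + k ↦ v ]) (j * n + k′) ≡ h (j * n + k′)
slice-untouched h k<n k′<n k′≢k i j = untouched h λ eq → k′≢k (proj₂ (slice-injective j i k′<n k<n eq))

relayed : (ℕ → ℕ) → ℕ → ℕ → ℕ → ℕ
relayed ι (suc _) 0 x = ι x
relayed ι _       _ x = x

-- Mirrors one execution of `relay` on the pair (`leftᵣ`, `dueᵣ`). The 3 counts what follows the
-- vertex in a term: sign, absolute value of the numerator, denominator.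
advance : ℕ → ℕ → ℕ → ℕ × ℕ
advance 0       d             x = x , d
advance (suc l) 0             x = suc l , 3
advance (suc l) 1             x = l , 0
advance (suc l) (suc (suc d)) x = suc l , suc d

translate : (ℕ → ℕ) → ℕ × ℕ → List ℕ → List ℕ
translate ι (l , d) []       = []
translate ι (l , d) (x ∷ xs) = relayed ι l d x ∷ translate ι (advance l d x) xs

advance* : ℕ × ℕ → List ℕ → ℕ × ℕ
advance* m       []       = m
advance* (l , d) (x ∷ xs) = advance* (advance l d x) xs

translate-++ : ∀ ι m xs ys → translate ι m (xs ++ ys) ≡ translate ι m xs ++ translate ι (advance* m xs) ys
translate-++ ι m       []       ys = refl
translate-++ ι (l , d) (x ∷ xs) ys = cong (relayed ι l d x ∷_) (translate-++ ι (advance l d x) xs ys)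

advance*-++ : ∀ m xs ys → advance* m (xs ++ ys) ≡ advance* (advance* m xs) ys
advance*-++ m       []       ys = refl
advance*-++ (l , d) (x ∷ xs) ys = advance*-++ (advance l d x) xs ys

seq⁻¹ : ∀ {p q s s″ out t} → ⟨ p ︔ q , s ⟩⇓⟨ s″ , out , t ⟩ →
        ∃ λ s′ → ∃ λ ys → ∃ λ zs → ∃ λ u → ∃ λ v →
        ⟨ p , s ⟩⇓⟨ s′ , ys , u ⟩ × ⟨ q , s′ ⟩⇓⟨ s″ , zs , v ⟩ × out ≡ ys ++ zs × t ≡ u + v
seq⁻¹ (⇓seq d e) = _ , _ , _ , _ , _ , d , e , refl , refl

output : ∀ {p s xs ys b} {Q : State → Set} → xs ≡ ys → Exec p s xs b Q → Exec p s ys b Q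
output refl e = e

module Slice (n k : ℕ) (k<n : k < n) where

  record Holds (s S : State) : Set where
    constructor holds
    field
      regs : ∀ r → arr S 5 (r * n + k) ≡ reg s r
      arrs : ∀ a i → arr S (inner a) (i * n + k) ≡ arr s a i

  -- The index `5 + a` covers the register array 5 and every `inner a` at once. This is what keeps
  -- the slices of later runs zero.
  record OtherSlicesEqual (S S′ : State) : Set where
    constructor otherSlices
    field
      equal : ∀ a i k′ → k′ < n → ¬ (k′ ≡ k) → arr S′ (5 + a) (i * n + k′) ≡ arr S (5 + a) (i * n + k′)

  module _ {s S : State} {ρ : Reg → ℕ} where

    holds-setReg : ∀ {r i x v} → i ≡ r * n + k → x ≡ v → Holds s S →
                   Holds (setReg s r v) (mkState ρ (arr S [ 5 ↦ arr S 5 [ i ↦ x ] ]))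
    holds-setReg {r} {v = v} refl refl h = holds
        (λ q → trans (slice-updated (arr S 5) k<n r q) (cong (if q ≡ᵇ r then v else_) (Holds.regs h q)))
        (Holds.arrs h)

    holds-setArr : ∀ {a j i x v} → i ≡ j * n + k → x ≡ v → Holds s S →
                   Holds (setArr s a j v) (mkState ρ (arr S [ inner a ↦ arr S (inner a) [ i ↦ x ] ]))
    holds-setArr {a} {j} {v = v} refl refl h = holds (Holds.regs h) cellwise
      where
      cellwise : ∀ b i → (arr S [ inner a ↦ arr S (inner a) [ j * n + k ↦ v ] ]) (inner b) (i * n + k) ≡
                         (arr s [ a ↦ arr s a [ j ↦ v ] ]) b i
      cellwise b i with b ≡ᵇ a | ≡ᵇ⇒≡ b a
      ... | true  | _ = trans (slice-updated (arr S (inner a)) k<n j i) (cong (if i ≡ᵇ j then v else_) (Holds.arrs h a i))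
      ... | false | _ = Holds.arrs h b i

  otherSlices-store : ∀ {S ρ} a {i x} j → i ≡ j * n + k →
                      OtherSlicesEqual S (mkState ρ (arr S [ 5 + a ↦ arr S (5 + a) [ i ↦ x ] ]))
  otherSlices-store {S} {ρ} a {i} {x} j refl = otherSlices equal
    where
    equal : ∀ b i′ k′ → k′ < n → ¬ (k′ ≡ k) →
            (arr S [ 5 + a ↦ arr S (5 + a) [ i ↦ x ] ]) (5 + b) (i′ * n + k′) ≡ arr S (5 + b) (i′ * n + k′)
    equal b i′ k′ k′<n k′≢k with b ≡ᵇ a | ≡ᵇ⇒≡ b a
    ... | true  | b≡a rewrite b≡a tt = slice-untouched (arr S (5 + a)) k<n k′<n k′≢k j i′
    ... | false | _ = refl

  otherSlices-trans : ∀ {S S′ S″} → OtherSlicesEqual S S′ → OtherSlicesEqual S′ S″ → OtherSlicesEqual S S″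
  otherSlices-trans (otherSlices e) (otherSlices f) = otherSlices λ a i k′ p q → trans (f a i k′ p q) (e a i k′ p q)

module Simulation (n k : ℕ) (k<n : k < n) (ι : ℕ → ℕ) where

  open Slice n k k<n

  -- Here ι is simply the content of `old`, which is shared by all runs and only read during a
  -- simulation; `m` is the state of the relay automaton.
  record Ready (m : ℕ × ℕ) (S : State) : Set where
    constructor ready
    field
      N≡   : reg S Nᵣ ≡ n
      K≡   : reg S Kᵣ ≡ k
      one≡ : reg S oneᵣ ≡ 1
      old≡ : ∀ i → arr S old i ≡ ι i
      left≡ : reg S leftᵣ ≡ proj₁ m
      due≡  : reg S dueᵣ ≡ proj₂ m

  Simulated : ℕ × ℕ → State → State → State → Set
  Simulated m s S S′ = Ready m S′ × Holds s S′ × OtherSlicesEqual S S′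

  module _ {m} {S : State} (e : Ready m S) where
    open Ready e

    cell≡ : ∀ i → i * reg S Nᵣ + reg S Kᵣ ≡ i * n + k
    cell≡ i = cong₂ (λ a b → i * a + b) N≡ K≡

    module _ {s} (h : Holds s S) where

      fetched : ∀ x → arr S 5 (x * reg S Nᵣ + reg S Kᵣ) ≡ reg s x
      fetched x = trans (cong (arr S 5) (cell≡ x)) (Holds.regs h x)

      fetched-cell : ∀ x → arr S 5 (x * reg S Nᵣ + reg S Kᵣ) * reg S Nᵣ + reg S Kᵣ ≡ reg s x * n + k
      fetched-cell x = trans (cell≡ (arr S 5 (x * reg S Nᵣ + reg S Kᵣ))) (cong (λ i → i * n + k) (fetched x))

      relay-run : ∀ x {t} → t ≡ x → reg S tmp₂ᵣ ≡ t →
                  Exec relay S [ relayed ι (proj₁ m) (proj₂ m) x ] 8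
                    (λ S′ → Ready (advance (proj₁ m) (proj₂ m) x) S′ × Holds s S′ × OtherSlicesEqual S S′)
      relay-run x refl refl = go m left≡ due≡
        where
        go : ∀ m → reg S leftᵣ ≡ proj₁ m → reg S dueᵣ ≡ proj₂ m →
             Exec relay S [ relayed ι (proj₁ m) (proj₂ m) x ] 8
                    (λ S′ → Ready (advance (proj₁ m) (proj₂ m) x) S′ × Holds s S′ × OtherSlicesEqual S S′)
        go (0 , d) l≡ d≡ = exec
          (⇓else l≡ (⇓seq ⇓write (⇓seq ⇓const ⇓arith))) (≤ᵇ⇒≤ 4 8 tt)
          (ready N≡ K≡ one≡ old≡ refl d≡ , holds (Holds.regs h) (Holds.arrs h) , otherSlices λ _ _ _ _ _ → refl)
        go (suc l , 0) l≡ d≡ = output (cong [_] (old≡ _)) (exec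
          (⇓then (λ eq → 1+n≢0 (trans (sym l≡) eq)) (⇓else d≡ (⇓seq ⇓load (⇓seq ⇓write ⇓const)))) (≤ᵇ⇒≤ 5 8 tt)
          (ready N≡ K≡ one≡ old≡ l≡ refl , holds (Holds.regs h) (Holds.arrs h) , otherSlices λ _ _ _ _ _ → refl))
        go (suc l , 1) l≡ d≡ = exec
          (⇓then (λ eq → 1+n≢0 (trans (sym l≡) eq)) (⇓then (λ eq → 1+n≢0 (trans (sym d≡) eq))
            (⇓seq ⇓write (⇓seq ⇓arith (⇓else (cong₂ _∸_ d≡ one≡) ⇓arith))))) (≤ᵇ⇒≤ 6 8 tt)
          (ready N≡ K≡ one≡ old≡ (cong₂ _∸_ l≡ one≡) (cong₂ _∸_ d≡ one≡) , holds (Holds.regs h) (Holds.arrs h) , otherSlices λ _ _ _ _ _ → refl)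
        go (suc l , suc (suc d)) l≡ d≡ = exec
          (⇓then (λ eq → 1+n≢0 (trans (sym l≡) eq)) (⇓then (λ eq → 1+n≢0 (trans (sym d≡) eq))
            (⇓seq ⇓write (⇓seq ⇓arith (⇓then (λ eq → 1+n≢0 (trans (sym (cong₂ _∸_ d≡ one≡)) eq)) ⇓skip))))) (≤ᵇ⇒≤ 6 8 tt)
          (ready N≡ K≡ one≡ old≡ l≡ (cong₂ _∸_ d≡ one≡) , holds (Holds.regs h) (Holds.arrs h) , otherSlices λ _ _ _ _ _ → refl)

  -- The factor 16 dominates the costliest instruction: `arith` takes 13 units, namely two fetches,
  -- the operation and a save. The rest absorbs the test of branches and loops.
  simulate : ∀ {p s s′ ys t} → ⟨ p , s ⟩⇓⟨ s′ , ys , t ⟩ → ∀ {m S} → Ready m S → Holds s S →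
             Exec (inSlice p) S (translate ι m ys) (16 * t) (Simulated (advance* m ys) s′ S)
  simulate ⇓skip e h = exec ⇓skip (≤ᵇ⇒≤ 1 16 tt) (e , h , otherSlices λ _ _ _ _ _ → refl)
  simulate (⇓const {x = x} {k}) {S = S} e@(ready a b c d f g) h =
    exec (straight (inSlice (const x k)) S tt) (≤ᵇ⇒≤ 5 16 tt)
      (ready a b c d f g , holds-setReg {r = x} (cell≡ e x) refl h , otherSlices-store 0 x (cell≡ e x))
  simulate (⇓arith {o = o} {x} {y} {z}) {S = S} e@(ready a b c d f g) h =
    exec (straight (inSlice (arith o x y z)) S tt) (≤ᵇ⇒≤ 13 16 tt)
      (ready a b c d f g , holds-setReg {r = x} (cell≡ e x) (cong₂ ⟦ o ⟧ (fetched e h y) (fetched e h z)) h ,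
       otherSlices-store 0 x (cell≡ e x))
  simulate (⇓load {s = s} {x = x} {a′} {y}) {S = S} e@(ready a b c d f g) h =
    exec (straight (inSlice (load x a′ y)) S tt) (≤ᵇ⇒≤ 11 16 tt)
      (ready a b c d f g ,
       holds-setReg {r = x} (cell≡ e x) (trans (cong (arr S (inner a′)) (fetched-cell e h y)) (Holds.arrs h a′ (reg s y))) h ,
       otherSlices-store 0 x (cell≡ e x))
  simulate (⇓store {s = s} {a = a′} {x} {y}) {S = S} e@(ready a b c d f g) h =
    exec (straight (inSlice (store a′ x y)) S tt) (≤ᵇ⇒≤ 11 16 tt)
      (ready a b c d f g , holds-setArr (fetched-cell e h x) (fetched e h y) h ,
       otherSlices-store (suc a′) (reg s x) (fetched-cell e h x))
  simulate (⇓write {s = s} {x = x}) {S = S} e@(ready a b c d f g) h =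
    weaken (≤ᵇ⇒≤ 12 16 tt) (λ _ q → q)
      (fetch tmp₂ᵣ x then weaken ≤-refl (λ { _ (e , h , otherSlices o) → e , h , otherSlices o }) (relay-run (ready a b c d f g) (holds (Holds.regs h) (Holds.arrs h)) (reg s x) (fetched e h x) refl))
  simulate (⇓seq {p = p} {ys = ys} {zs} {t} {u} dp dq) {m} e h with simulate dp e h
  ... | exec dp′ tp (e′ , h′ , o′) with simulate dq e′ h′
  ...   | exec dq′ tq (e″ , h″ , o″) = output (sym (translate-++ ι m ys zs))
          (exec (⇓seq dp′ dq′) (≤-trans (+-mono-≤ tp tq) (≤-reflexive (sym (*-distribˡ-+ 16 t u))))
            (subst (λ m → Ready m _) (sym (advance*-++ m ys zs)) e″ , h″ , otherSlices-trans o′ o″))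
  simulate (⇓then {x = x} {t = t} x≢0 dp) {S = S} e@(ready a b c d f g) h
    with simulate dp (ready a b c d f g) (holds (Holds.regs h) (Holds.arrs h))
  ... | exec {time = u} dp′ tp (e′ , h′ , o′) = exec
          (⇓seq (straight (fetch tmp₃ᵣ x) S tt) (⇓then (λ eq → x≢0 (trans (sym (fetched e h x)) eq)) dp′))
          (branch tp) (e′ , h′ , otherSlices (OtherSlicesEqual.equal o′))
    where
    branch : u ≤ 16 * t → 4 + suc u ≤ 16 * suc t
    branch u≤ = ≤-trans (+-monoʳ-≤ 5 u≤) (≤-trans (+-monoˡ-≤ (16 * t) (≤ᵇ⇒≤ 5 16 tt)) (≤-reflexive (sym (*-suc 16 t))))
  simulate (⇓else {x = x} {t = t} x≡0 dp) {S = S} e@(ready a b c d f g) h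
    with simulate dp (ready a b c d f g) (holds (Holds.regs h) (Holds.arrs h))
  ... | exec {time = u} dp′ tp (e′ , h′ , o′) = exec
          (⇓seq (straight (fetch tmp₃ᵣ x) S tt) (⇓else (trans (fetched e h x) x≡0) dp′))
          (branch tp) (e′ , h′ , otherSlices (OtherSlicesEqual.equal o′))
    where
    branch : u ≤ 16 * t → 4 + suc u ≤ 16 * suc t
    branch u≤ = ≤-trans (+-monoʳ-≤ 5 u≤) (≤-trans (+-monoˡ-≤ (16 * t) (≤ᵇ⇒≤ 5 16 tt)) (≤-reflexive (sym (*-suc 16 t))))
  simulate (⇓stop {x = x} x≡0) {S = S} e@(ready a b c d f g) h = exec
    (⇓seq (straight (fetch tmp₃ᵣ x) S tt) (⇓stop (trans (fetched e h x) x≡0))) (≤ᵇ⇒≤ 5 16 tt)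
    (ready a b c d f g , holds (Holds.regs h) (Holds.arrs h) , otherSlices λ _ _ _ _ _ → refl)
  simulate (⇓loop {x = x} {ys = ys} {zs} {t} {u} x≢0 dp dw) {m} {S} e@(ready a b c d f g) h
    with simulate dp (ready a b c d f g) (holds (Holds.regs h) (Holds.arrs h))
  ... | exec {time = t′} dp′ tp (e′ , h′ , o′) with simulate dw e′ h′
  -- The induction hypothesis on the remaining loop starts with a fetch of the tested register. That
  -- fetch is the one ending the simulated body, so the run is cut there and regrouped.
  ...   | exec dw′ tw (e″ , h″ , o″) with seq⁻¹ dw′
  ...     | _ , xs₁ , xs₂ , u₁ , u₂ , df , dw″ , out≡ , time≡ = output out
              (exec (⇓seq (straight (fetch tmp₃ᵣ x) S tt)
                      (⇓loop (λ eq → x≢0 (trans (sym (fetched e h x)) eq)) (⇓seq dp′ df) dw″))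
                time (subst (λ m → Ready m _) (sym (advance*-++ m ys zs)) e″ , h″ , otherSlices-trans (otherSlices (OtherSlicesEqual.equal o′)) o″))
    where
    out : (translate ι m ys ++ xs₁) ++ xs₂ ≡ translate ι m (ys ++ zs)
    out = trans (++-assoc (translate ι m ys) xs₁ xs₂)
            (trans (cong (translate ι m ys ++_) (sym out≡)) (sym (translate-++ ι m ys zs)))
    shuffle : ∀ a b c → 4 + suc ((a + b) + c) ≡ 5 + (a + (b + c))
    shuffle = solve-∀
    factor : ∀ a b → 5 + (16 * a + 16 * b) + 11 ≡ 16 * suc (a + b)
    factor = solve-∀
    time : 4 + suc ((t′ + u₁) + u₂) ≤ 16 * suc (t + u)
    time = begin
      4 + suc ((t′ + u₁) + u₂)    ≡⟨ shuffle t′ u₁ u₂ ⟩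
      5 + (t′ + (u₁ + u₂))        ≡⟨ cong (λ z → 5 + (t′ + z)) (sym time≡) ⟩
      5 + (t′ + _)                ≤⟨ +-monoʳ-≤ 5 (+-mono-≤ tp tw) ⟩
      5 + (16 * t + 16 * u)       ≤⟨ m≤m+n _ 11 ⟩
      5 + (16 * t + 16 * u) + 11  ≡⟨ factor t u ⟩
      16 * suc (t + u)            ∎
      where open ≤-Reasoning

-- Arrays as lists

cells-++ˡ : ∀ xs {ys i} → i < length xs → cells (xs ++ ys) i ≡ cells xs i
cells-++ˡ (x ∷ xs) {i = zero}  _         = refl
cells-++ˡ (x ∷ xs) {i = suc i} (s≤s i<l) = cells-++ˡ xs i<l

cells-length : ∀ xs {y ys} → cells (xs ++ y ∷ ys) (length xs) ≡ y
cells-length []       = refl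
cells-length (x ∷ xs) = cells-length xs

cells-∷ʳ : ∀ xs x i → cells (xs ∷ʳ x) i ≡ (cells xs [ length xs ↦ x ]) i
cells-∷ʳ []       x zero    = refl
cells-∷ʳ []       x (suc i) = refl
cells-∷ʳ (y ∷ xs) x zero    = refl
cells-∷ʳ (y ∷ xs) x (suc i) = cells-∷ʳ xs x i

-- Arrays are padded with zeros, so reserving a cell for a length not yet known takes no store;
-- `cells-replace` fills it in later.
cells-∷ʳ0 : ∀ xs i → cells (xs ∷ʳ 0) i ≡ cells xs i
cells-∷ʳ0 []       zero    = refl
cells-∷ʳ0 []       (suc i) = refl
cells-∷ʳ0 (y ∷ xs) zero    = refl
cells-∷ʳ0 (y ∷ xs) (suc i) = cells-∷ʳ0 xs i

cells-replace : ∀ xs y x ys i → (cells (xs ++ y ∷ ys) [ length xs ↦ x ]) i ≡ cells (xs ++ x ∷ ys) i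
cells-replace []       y x ys zero    = refl
cells-replace []       y x ys (suc i) = refl
cells-replace (z ∷ xs) y x ys zero    = refl
cells-replace (z ∷ xs) y x ys (suc i) = cells-replace xs y x ys i

length-∷ʳ : ∀ {A : Set} (xs : List A) {x} → length (xs ∷ʳ x) ≡ suc (length xs)
length-∷ʳ xs = trans (length-++ xs) (+-comm (length xs) 1)

updated-cong : ∀ {A : Set} {g h : ℕ → A} (k : ℕ) {a : A} → (∀ i → g i ≡ h i) → ∀ i → (g [ k ↦ a ]) i ≡ (h [ k ↦ a ]) i
updated-cong k {a} g≡h i = cong (if i ≡ᵇ k then a else_) (g≡h i)

record Stream (h : ℕ → ℕ) (p : ℕ) (xs : List ℕ) : Set where
  constructor stream
  field ahead : ∀ i → h (p + i) ≡ cells xs i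

stream-head : ∀ {h p x xs} → Stream h p (x ∷ xs) → h p ≡ x
stream-head {h} {p} (stream f) = trans (cong h (sym (+-identityʳ p))) (f 0)

stream-tail : ∀ {h p x xs o} → o ≡ 1 → Stream h p (x ∷ xs) → Stream h (p + o) xs
stream-tail {h} {p} refl (stream f) = stream λ i → trans (cong h (+-assoc p 1 i)) (f (suc i))

stream-drop : ∀ {h p o} xs {ys} → o ≡ length xs → Stream h p (xs ++ ys) → Stream h (p + o) ys
stream-drop {h} {p} []       refl st = subst (λ p → Stream h p _) (sym (+-identityʳ p)) st
stream-drop {h} {p} (x ∷ xs) {ys} refl st =
  subst (λ p → Stream h p ys) (+-assoc p 1 (length xs))
    (stream-drop xs {ys} refl (stream-tail refl st))

stream-cong : ∀ {h h′ p p′ xs} → (∀ i → h′ i ≡ h i) → p′ ≡ p → Stream h p xs → Stream h′ p′ xs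
stream-cong h′≡h refl (stream f) = stream λ i → trans (h′≡h _) (f i)

tabulate-split : ∀ {A : Set} {n} (f : Fin n → A) done {u todo} → done ++ u ∷ todo ≡ tabulate f →
                 ∃ λ i → f i ≡ u × toℕ i ≡ length done
tabulate-split {n = zero}  f []         ()
tabulate-split {n = zero}  f (_ ∷ _)    ()
tabulate-split {n = suc n} f []         eq = Fin.zero , sym (proj₁ (∷-injective eq)) , refl
tabulate-split {n = suc n} f (_ ∷ done) eq with tabulate-split (f ∘ Fin.suc) done (proj₂ (∷-injective eq))
... | i , fi≡u , i≡ = Fin.suc i , fi≡u , cong suc i≡

-- Ties the machine to the list: the counter of a loop over all vertices equals the number of the
-- vertex being processed.
position : ∀ {n} done {u : Fin n} {todo} → done ++ u ∷ todo ≡ allFin n → toℕ u ≡ length done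
position done eq with tabulate-split id done eq
... | i , refl , i≡ = i≡

position< : ∀ {n} done {todo} {x : Fin n} → done ++ todo ≡ allFin n → x ∈ done → toℕ x < length done
position< done {todo} {x} eq x∈ with ∈-∃++ x∈
... | ys , zs , refl = subst₂ _<_ (sym (position ys (trans (sym (++-assoc ys (x ∷ zs) todo)) eq)))
      (sym (trans (length-++ ys) (+-suc (length ys) (length zs)))) (s≤s (m≤m+n _ _))

sum-const : ∀ {A : Set} (xs : List A) c → sum (map (λ _ → c) xs) ≡ length xs * c
sum-const []       c = refl
sum-const (x ∷ xs) c = cong (c +_) (sum-const xs c)

increment : ∀ {a b o} → a ≡ b → o ≡ 1 → a + o ≡ suc b
increment {b = b} refl refl = +-comm b 1

bit : Bool → ℕ
bit b = if b then 1 else 0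

-- The program

pattern vertexᵣ = 9
pattern todoᵣ   = 10
pattern zeroᵣ   = 11
pattern degreeᵣ = 12
pattern readᵣ   = 13
pattern valueᵣ  = 14
pattern nbrᵣ    = 15
pattern cellᵣ   = 16
pattern endᵣ    = 17
pattern headᵣ   = 18
pattern countᵣ  = 19
pattern numberᵣ = 20
pattern nextᵣ   = 21
pattern flagᵣ   = 22
pattern rowᵣ    = 23
pattern roundsᵣ = 24

incr decr : Reg → Program
incr x = arith add x x oneᵣ
decr x = arith sub x x oneᵣ

move : Reg → Reg → Program
move x y = const x 0 ︔ arith add x x y

reset : Program
reset =
  (const vertexᵣ 0 ︔ const zeroᵣ 0 ︔ move todoᵣ Nᵣ) ︔
  while todoᵣ (store mark vertexᵣ zeroᵣ ︔ incr vertexᵣ ︔ decr todoᵣ)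

-- Marks the listed vertices if flagᵣ is nonzero, and only skips the list otherwise.
markList : Program
markList =
  while degreeᵣ
    (load nbrᵣ input readᵣ ︔ incr readᵣ ︔
     load valueᵣ mark nbrᵣ ︔ arith add valueᵣ valueᵣ flagᵣ ︔ store mark nbrᵣ valueᵣ ︔
     decr degreeᵣ)

-- `nextᵣ` survives from one iteration to the next, so the list of the current vertex is found where
-- the previous one ended. Lists have no directory giving their addresses.
markNbhd : Program
markNbhd =
  (move readᵣ nextᵣ ︔ const flagᵣ 1 ︔ store mark Kᵣ oneᵣ ︔ load degreeᵣ input readᵣ ︔ incr readᵣ) ︔
  markList ︔
  move nextᵣ readᵣ

renumber : Program
renumber =
  (const numberᵣ 0 ︔ const vertexᵣ 0 ︔ move todoᵣ Nᵣ) ︔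
  while todoᵣ
    (load valueᵣ mark vertexᵣ ︔
     cond valueᵣ skip (store new vertexᵣ numberᵣ ︔ store old numberᵣ vertexᵣ ︔ incr numberᵣ) ︔
     (incr vertexᵣ ︔ decr todoᵣ))

copyList : Program
copyList =
  while degreeᵣ
    ((load nbrᵣ input readᵣ ︔ incr readᵣ ︔ load valueᵣ mark nbrᵣ) ︔
     cond valueᵣ skip
       (load valueᵣ new nbrᵣ ︔ move cellᵣ endᵣ ︔ toSlice cellᵣ ︔ store (inner 0) cellᵣ valueᵣ ︔
        incr endᵣ ︔ incr countᵣ) ︔
     decr degreeᵣ)

-- The length of a list is known only after the list has been copied: the cell headᵣ is reserved for it.
copy : Program
copy =
  (store (inner 0) Kᵣ numberᵣ ︔ const vertexᵣ 0 ︔ const readᵣ 1 ︔ const endᵣ 1 ︔ move todoᵣ Nᵣ) ︔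
  while todoᵣ
    ((load degreeᵣ input readᵣ ︔ incr readᵣ ︔ load valueᵣ mark vertexᵣ) ︔
     cond valueᵣ
       (arith add readᵣ readᵣ degreeᵣ)
       ((move headᵣ endᵣ ︔ incr endᵣ ︔ const countᵣ 0) ︔
        copyList ︔
        (move cellᵣ headᵣ ︔ toSlice cellᵣ ︔ store (inner 0) cellᵣ countᵣ)) ︔
     (incr vertexᵣ ︔ decr todoᵣ))

-- Row k of sets, that is its cells k * n + u, holds the indicator of the set chosen in run k.
choose : Program
choose =
  (const vertexᵣ 0 ︔ const readᵣ 1 ︔ arith mul rowᵣ Kᵣ Nᵣ ︔ move todoᵣ Nᵣ) ︔
  while todoᵣ
    ((load degreeᵣ input readᵣ ︔ incr readᵣ ︔
      load valueᵣ mark vertexᵣ ︔ arith sub flagᵣ oneᵣ valueᵣ ︔ store sets rowᵣ flagᵣ) ︔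
     markList ︔
     (incr rowᵣ ︔ incr vertexᵣ ︔ decr todoᵣ)) ︔
  (arith mul rowᵣ Kᵣ Nᵣ ︔ arith add rowᵣ rowᵣ Kᵣ ︔ store sets rowᵣ oneᵣ)

-- The value ∣b − c∣ is computed as (b ∸ c) + (c ∸ b), and c ∸ b is also the sign bit.
compare : Program
compare =
  write Nᵣ ︔
  (const vertexᵣ 0 ︔ arith mul rowᵣ Kᵣ Nᵣ ︔ move todoᵣ Nᵣ) ︔
  while todoᵣ
    ((load valueᵣ sets vertexᵣ ︔ load cellᵣ sets rowᵣ ︔
      arith sub nbrᵣ valueᵣ cellᵣ ︔ arith sub cellᵣ cellᵣ valueᵣ ︔ arith add cellᵣ cellᵣ nbrᵣ) ︔
     write vertexᵣ ︔ write nbrᵣ ︔ write cellᵣ ︔ write oneᵣ ︔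
     (incr rowᵣ ︔ incr vertexᵣ ︔ decr todoᵣ))

prepare : Program
prepare = reset ︔ markNbhd ︔ renumber ︔ copy ︔ choose

iteration : Program → Program
iteration p = prepare ︔ inSlice p ︔ cond Kᵣ compare skip ︔ (incr Kᵣ ︔ decr roundsᵣ)

compute : Program → Program
compute p =
  (const oneᵣ 1 ︔ load Nᵣ input zeroᵣ ︔ const nextᵣ 1 ︔ move roundsᵣ Nᵣ) ︔
  while roundsᵣ (iteration p)

-- Correctness of the phases

-- Only zero versus nonzero matters, since marking adds the flag and a cell marked repeatedly grows
-- beyond 1.
record Marks {n} (h : ℕ → ℕ) (Q : Fin n → Set) : Set where
  constructor marks
  field
    nonzero : ∀ x → Q x → ¬ (h (toℕ x) ≡ 0)
    null    : ∀ x → ¬ Q x → h (toℕ x) ≡ 0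

marks-add : ∀ {n} {h i f v} {Q Q′ : Fin n → Set} (u : Fin n) → i ≡ toℕ u → v ≡ h i + f →
            (∀ {x} → Q x → Q′ x) → (¬ (f ≡ 0) → Q′ u) → (∀ {x} → Q′ x → Q x ⊎ (¬ (f ≡ 0) × x ≡ u)) →
            Marks h Q → Marks (h [ i ↦ v ]) Q′
marks-add {h = h} {f = f} {Q = Q} {Q′} u refl refl Q⊆ Q′u ⊆Q (marks on off) = marks on′ off′
  where
  same : ∀ {x v} → ¬ (x ≡ u) → (h [ toℕ u ↦ v ]) (toℕ x) ≡ h (toℕ x)
  same x≢u = untouched h λ eq → x≢u (Fin.toℕ-injective eq)
  on′ : ∀ x → Q′ x → ¬ ((h [ toℕ u ↦ h (toℕ u) + f ]) (toℕ x) ≡ 0)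
  on′ x q′ eq with x Fin.≟ u
  ... | yes refl = let h+f≡0 = trans (sym (updated h (toℕ u))) eq in
    [ (λ q → on u q (m+n≡0⇒m≡0 _ h+f≡0)) , (λ { (f≢0 , _) → f≢0 (m+n≡0⇒n≡0 (h (toℕ u)) h+f≡0) }) ]′ (⊆Q q′)
  ... | no x≢u = [ (λ q → on x q (trans (sym (same x≢u)) eq)) , (λ { (_ , x≡u) → x≢u x≡u }) ]′ (⊆Q q′)
  off′ : ∀ x → ¬ Q′ x → (h [ toℕ u ↦ h (toℕ u) + f ]) (toℕ x) ≡ 0
  off′ x ¬q′ with x Fin.≟ u
  -- A nonzero flag would put u into `Q′`; decidability of `f ≟ 0` turns this into `f ≡ 0`.
  ... | yes refl = trans (updated h (toℕ u)) (cong₂ _+_ (off u (¬q′ ∘ Q⊆)) (decidable-stable (f ≟ 0) (¬q′ ∘ Q′u)))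
  ... | no x≢u   = trans (same x≢u) (off x (¬q′ ∘ Q⊆))

marks-cong : ∀ {n} {g h} {Q Q′ : Fin n → Set} → (∀ i → g i ≡ h i) → (∀ {x} → Q x → Q′ x) → (∀ {x} → Q′ x → Q x) →
             Marks h Q → Marks g Q′
marks-cong g≡h Q⊆ ⊆Q (marks on off) = marks
  (λ x q′ eq → on x (⊆Q q′) (trans (sym (g≡h _)) eq)) (λ x ¬q′ → trans (g≡h _) (off x (¬q′ ∘ Q⊆)))

module _ {n : ℕ} where

  -- `mark` lies outside the slices and is left dirty by the previous iteration. Its size n allows
  -- clearing it every time.
  reset-run : ∀ {s} → reg s Nᵣ ≡ n → reg s oneᵣ ≡ 1 →
              Exec reset s [] (5 + n * 4) (λ s′ → ∀ (u : Fin n) → arr s′ mark (toℕ u) ≡ 0)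
  reset-run {s} N≡ one≡ = weaken
    (≤-reflexive (cong (5 +_) (trans (sum-const (allFin n) 4) (cong (_* 4) (length-tabulate {n = n} id)))))
    (λ _ q u → q (toℕ u) (subst (toℕ u <_) (sym (length-tabulate id)) (Fin.toℕ<n u)))
    ((const vertexᵣ 0 ︔ const zeroᵣ 0 ︔ move todoᵣ Nᵣ) then silent (allFin n)
      (weaken ≤-refl (λ _ q → proj₂ q) (forEach _ (λ _ → 3) todoᵣ _ _ _ Inv step (refl , λ _ ()) (trans N≡ (sym (length-tabulate id))))))
    where
    Inv : List (Fin n) → List (Fin n) → State → Set
    Inv done todo s = reg s vertexᵣ ≡ length done × (∀ j → j < length done → arr s mark j ≡ 0)
    step : ∀ done u todo s′ → done ++ u ∷ todo ≡ allFin n →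
           Unchanged (store mark vertexᵣ zeroᵣ ︔ incr vertexᵣ ︔ decr todoᵣ) (effect (const vertexᵣ 0 ︔ const zeroᵣ 0 ︔ move todoᵣ Nᵣ) s) s′ →
           Inv done (u ∷ todo) s′ → reg s′ todoᵣ ≡ suc (length todo) →
           Exec (store mark vertexᵣ zeroᵣ ︔ incr vertexᵣ ︔ decr todoᵣ) s′ [] 3 λ s″ → reg s″ todoᵣ ≡ length todo × Inv (done ∷ʳ u) todo s″
    step done u todo s′ _ uc (U≡ , zeros) D≡ = block (store mark vertexᵣ zeroᵣ ︔ incr vertexᵣ ︔ decr todoᵣ)
      (cong₂ _∸_ D≡ one≡′ , trans (increment U≡ one≡′) (sym (length-∷ʳ done)) , zeros′)
      where
      one≡′ = trans (regs uc oneᵣ refl) one≡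
      zeros′ : ∀ j → j < length (done ∷ʳ u) → (arr s′ mark [ reg s′ vertexᵣ ↦ reg s′ zeroᵣ ]) j ≡ 0
      zeros′ j j< with j ≟ length done
      ... | yes refl = trans (updated-≡ (arr s′ mark) (sym U≡)) (regs uc zeroᵣ refl)
      ... | no j≢ = trans (untouched (arr s′ mark) (λ eq → j≢ (trans eq U≡)))
                      (zeros j (≤∧≢⇒< (s≤s⁻¹ (subst (j <_) (length-∷ʳ done) j<)) j≢))

  markList-run : ∀ {s} {Q : Fin n → Set} xs {rest} → reg s oneᵣ ≡ 1 → reg s degreeᵣ ≡ length xs →
    Stream (arr s input) (reg s readᵣ) (map toℕ xs ++ rest) → Marks (arr s mark) Q →
    Exec markList s [] (1 + length xs * 7) λ s′ →
      Stream (arr s′ input) (reg s′ readᵣ) rest × Marks (arr s′ mark) (λ x → Q x ⊎ (¬ (reg s flagᵣ ≡ 0) × x ∈ xs))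
  markList-run {s} {Q} xs {rest} one≡ E≡ st ms = weaken
    (≤-reflexive (cong suc (sum-const xs 7))) (λ _ q → q)
    (silent xs (forEach _ (λ _ → 6) degreeᵣ _ s xs Inv step
      (st , marks-cong (λ _ → refl) inj₁ (λ { (inj₁ q) → q ; (inj₂ (_ , ())) }) ms) E≡))
    where
    body = load nbrᵣ input readᵣ ︔ incr readᵣ ︔ load valueᵣ mark nbrᵣ ︔ arith add valueᵣ valueᵣ flagᵣ ︔ store mark nbrᵣ valueᵣ ︔ decr degreeᵣ
    Inv : List (Fin n) → List (Fin n) → State → Set
    Inv done todo s′ = Stream (arr s′ input) (reg s′ readᵣ) (map toℕ todo ++ rest) ×
                       Marks (arr s′ mark) (λ x → Q x ⊎ (¬ (reg s flagᵣ ≡ 0) × x ∈ done))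
    step : ∀ done u todo s′ → done ++ u ∷ todo ≡ xs → Unchanged body s s′ →
           Inv done (u ∷ todo) s′ → reg s′ degreeᵣ ≡ suc (length todo) →
           Exec body s′ [] 6 λ s″ → reg s″ degreeᵣ ≡ length todo × Inv (done ∷ʳ u) todo s″
    step done u todo s′ _ uc (st , ms) E≡ = block body
      (cong₂ _∸_ E≡ one≡′ , stream-tail one≡′ st ,
       marks-add u (stream-head st) (cong (arr s′ mark _ +_) (regs uc flagᵣ refl))
         (λ { (inj₁ q) → inj₁ q ; (inj₂ (f≢0 , x∈)) → inj₂ (f≢0 , ∈-++⁺ˡ x∈) })
         (λ f≢0 → inj₂ (f≢0 , ∈-++⁺ʳ done (here refl)))
         (λ { (inj₁ q) → inj₁ (inj₁ q)
            ; (inj₂ (f≢0 , x∈)) → [ (λ x∈done → inj₁ (inj₂ (f≢0 , x∈done))) , (λ { (here x≡u) → inj₂ (f≢0 , x≡u) }) ]′ (∈-++⁻ done x∈) })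
         ms)
      where one≡′ = trans (regs uc oneᵣ refl) one≡

enc : ∀ {n} → List (Fin n) → List ℕ
enc xs = length xs ∷ map toℕ xs

filter-∷ʳ⁺ : ∀ {A : Set} {Q : Pred A 0ℓ} (Q? : Decidable Q) xs {x} → Q x → filter Q? (xs ∷ʳ x) ≡ filter Q? xs ∷ʳ x
filter-∷ʳ⁺ Q? xs {x} q = trans (filter-++ Q? xs [ x ]) (cong (filter Q? xs ++_) (filter-accept Q? q))

filter-∷ʳ⁻ : ∀ {A : Set} {Q : Pred A 0ℓ} (Q? : Decidable Q) xs {x} → ¬ Q x → filter Q? (xs ∷ʳ x) ≡ filter Q? xs
filter-∷ʳ⁻ Q? xs {x} ¬q =
  trans (filter-++ Q? xs [ x ]) (trans (cong (filter Q? xs ++_) (filter-reject Q? ¬q)) (++-identityʳ _))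

sum-linear : ∀ {A : Set} (f : A → ℕ) a b xs → sum (map (λ x → suc (a + f x * b)) xs) ≡ length xs * suc a + sum (map f xs) * b
sum-linear f a b []       = refl
sum-linear f a b (x ∷ xs) = trans (cong (suc (a + f x * b) +_) (sum-linear f a b xs))
                                  (regroup a b (f x) (length xs) (sum (map f xs)))
  where
  regroup : ∀ a b c d e → suc (a + c * b) + (d * suc a + e * b) ≡ suc d * suc a + (c + e) * b
  regroup = solve-∀

linear-bound : ∀ c a b n m → c + (n * a + m * b) ≤ (c + a + b) * suc (n + m)
linear-bound c a b n m = ≤-trans (m≤m+n _ (c * (n + m) + a * suc m + b * suc n)) (≤-reflexive (expand c a b n m))
  where
  expand : ∀ c a b n m → c + (n * a + m * b) + (c * (n + m) + a * suc m + b * suc n) ≡ (c + a + b) * suc (n + m)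
  expand = solve-∀

module OnGraph (G : Graph) (nbrs : Vertex G → List (Vertex G)) (adjacency : IsAdjacencyLists G nbrs) where

  n : ℕ
  n = order G

  degrees : ℕ
  degrees = sum (map (length ∘ nbrs) (allFin n))

  -- The length of the encoding of G: one cell for n, one for each degree, one for each list entry.
  -- The `suc` absorbs additive constants.
  volume : ℕ
  volume = suc (n + degrees)

  vertices : List (Vertex G)
  vertices = allFin n

  #vertices : length vertices ≡ n
  #vertices = length-tabulate id

  row : Vertex G → List ℕ
  row u = enc (nbrs u)

  nbr⇔ : ∀ u v → (v ∈ nbrs u) ⇔ Graph.Adj G u v
  nbr⇔ u = proj₂ (adjacency u)

  loop-bound : ∀ c a b → c + suc (sum (map (λ u → suc (a + length (nbrs u) * b)) vertices)) ≤ (suc c + suc a + b) * volume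
  loop-bound c a b = ≤-trans (≤-reflexive (trans (+-suc c _) (cong (suc c +_)
    (trans (sum-linear (length ∘ nbrs) a b vertices) (cong (λ l → l * suc a + degrees * b) #vertices)))))
    (linear-bound (suc c) (suc a) b n degrees)

  module Iteration (v : Vertex G) where

    k : ℕ
    k = toℕ v

    k<n : k < n
    k<n = Fin.toℕ<n v

    Far : Vertex G → Set
    Far u = ¬ ClosedNbhd G v u

    far? : Decidable Far
    far? u = ¬? (closedNbhd? G v u)

    markNbhd-run : ∀ {s rest} → reg s Kᵣ ≡ k → reg s oneᵣ ≡ 1 → Stream (arr s input) (reg s nextᵣ) (row v ++ rest) →
      (∀ (u : Fin n) → arr s mark (toℕ u) ≡ 0) →
      Exec markNbhd s [] (6 + (1 + length (nbrs v) * 7 + 2)) λ s′ →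
        Stream (arr s′ input) (reg s′ nextᵣ) rest × Marks (arr s′ mark) (ClosedNbhd G v)
    markNbhd-run {s} K≡ one≡ st zeros = (move readᵣ nextᵣ ︔ const flagᵣ 1 ︔ store mark Kᵣ oneᵣ ︔ load degreeᵣ input readᵣ ︔ incr readᵣ) then
      (markList-run {Q = λ x → x ≡ v} (nbrs v) one≡ (stream-head st) (stream-tail one≡ st)
        (marks-cong (updated-index K≡) id id (marks (λ { x refl eq → 1+n≢0 (trans (sym one≡) (trans (sym (updated (arr s mark) k)) eq)) })
           λ x x≢v → trans (untouched (arr s mark) (x≢v ∘ Fin.toℕ-injective)) (zeros x)))
      >> λ { uc (st′ , ms′) → block (move nextᵣ readᵣ) (st′ , marks-cong (λ _ → refl)
        (λ { (inj₁ x≡v) → inj₁ x≡v ; (inj₂ (_ , x∈)) → inj₂ (Equivalence.to (nbr⇔ v _) x∈) })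
        (λ { (inj₁ x≡v) → inj₁ x≡v ; (inj₂ adj) → inj₂ ((λ ()) , Equivalence.from (nbr⇔ v _) adj) }) ms′) })
      where
      updated-index : ∀ {h : ℕ → ℕ} {i j a} → i ≡ j → ∀ x → (h [ i ↦ a ]) x ≡ (h [ j ↦ a ]) x
      updated-index refl x = refl

    -- The bound b is the next vertex to be visited. It keeps the next write to `new` away from the
    -- entries already made; stale entries of earlier iterations are outside the claim.
    record Numbering (s : State) (us : List (Vertex G)) (b : ℕ) : Set where
      constructor numbering
      field
        number : ∀ j → j < length us → arr s old j ≡ cells (map toℕ us) j × arr s new (cells (map toℕ us) j) ≡ j ×
                                       cells (map toℕ us) j < b

    numbering-∷ʳ : ∀ {s ρ us b i c u} → i ≡ b → c ≡ length us → i ≡ toℕ u → Numbering s us b →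
                   Numbering (mkState ρ (((arr s) [ new ↦ arr s new [ i ↦ c ] ]) [ old ↦ arr s old [ c ↦ i ] ])) (us ∷ʳ u) (suc b)
    numbering-∷ʳ {s} {us = us} {b} {i} {c} {u} refl refl i≡u (numbering f) = numbering f′
      where
      mapped : map toℕ (us ∷ʳ u) ≡ map toℕ us ∷ʳ i
      mapped = trans (map-++ toℕ us [ u ]) (cong (λ i → map toℕ us ∷ʳ i) (sym i≡u))
      f′ : ∀ j → j < length (us ∷ʳ u) → (arr s old [ c ↦ i ]) j ≡ cells (map toℕ (us ∷ʳ u)) j ×
             (arr s new [ i ↦ c ]) (cells (map toℕ (us ∷ʳ u)) j) ≡ j × cells (map toℕ (us ∷ʳ u)) j < suc b
      f′ j j< rewrite mapped with j ≟ length us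
      ... | yes refl rewrite sym (length-map toℕ us) | cells-length (map toℕ us) {i} {[]} =
            updated (arr s old) (length (map toℕ us)) , updated (arr s new) i , ≤-refl
      ... | no j≢ with ≤∧≢⇒< (s≤s⁻¹ (subst (j <_) (length-∷ʳ us) j<)) j≢
      ...   | j<l rewrite cells-++ˡ (map toℕ us) {[ i ]} (subst (j <_) (sym (length-map toℕ us)) j<l) with f j j<l
      ...     | old≡ , new≡ , <b = trans (untouched (arr s old) j≢) old≡ ,
                                   trans (untouched (arr s new) (<⇒≢ <b)) new≡ , m<n⇒m<1+n <b

    renumber-run : ∀ {s} → reg s Nᵣ ≡ n → reg s oneᵣ ≡ 1 → Marks (arr s mark) (ClosedNbhd G v) →
      Exec renumber s [] (4 + suc (n * 9)) λ s′ →
        reg s′ numberᵣ ≡ length (filter far? vertices) × Numbering s′ (filter far? vertices) n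
    renumber-run {s} N≡ one≡ (marks on off) = weaken
      (≤-reflexive (cong (λ l → 4 + suc l) (trans (sum-const vertices 9) (cong (_* 9) #vertices))))
      (λ { uc (U≡ , C≡ , num) → C≡ , subst (Numbering _ _) #vertices num })
      ((const numberᵣ 0 ︔ const vertexᵣ 0 ︔ move todoᵣ Nᵣ) then silent vertices
        (forEach _ (λ _ → 8) todoᵣ body s₁ vertices Inv step (refl , refl , numbering λ _ ()) (trans N≡ (sym #vertices))))
      where
      s₁ = effect (const numberᵣ 0 ︔ const vertexᵣ 0 ︔ move todoᵣ Nᵣ) s
      body = load valueᵣ mark vertexᵣ ︔ cond valueᵣ skip (store new vertexᵣ numberᵣ ︔ store old numberᵣ vertexᵣ ︔ incr numberᵣ) ︔ (incr vertexᵣ ︔ decr todoᵣ)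
      Inv : List (Vertex G) → List (Vertex G) → State → Set
      Inv done todo s′ = reg s′ vertexᵣ ≡ length done × reg s′ numberᵣ ≡ length (filter far? done) × Numbering s′ (filter far? done) (length done)
      step : ∀ done u todo s′ → done ++ u ∷ todo ≡ vertices → Unchanged body s₁ s′ →
             Inv done (u ∷ todo) s′ → reg s′ todoᵣ ≡ suc (length todo) →
             Exec body s′ [] 8 λ s″ → reg s″ todoᵣ ≡ length todo × Inv (done ∷ʳ u) todo s″
      step done u todo s′ eq uc (U≡ , C≡ , num) D≡ = load valueᵣ mark vertexᵣ then
        (if-zero {Q = λ s″ → reg s″ numberᵣ ≡ length (filter far? (done ∷ʳ u)) × Numbering s″ (filter far? (done ∷ʳ u)) (suc (length done))}
          (λ marked → let near = decidable-stable (closedNbhd? G v u) λ far → marked (trans mark≡ (off u far)) in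
             block skip (subst (λ us → reg s′ numberᵣ ≡ length us × Numbering (effect (load valueᵣ mark vertexᵣ) s′) us (suc (length done)))
               (sym (filter-∷ʳ⁻ far? done (λ far → far near)))
               (C≡ , numbering λ j j< → let a , b , c = Numbering.number num j j< in a , b , m<n⇒m<1+n c)))
          (λ unmarked → let far = λ near → on u near (trans (sym mark≡) unmarked) in
             block (store new vertexᵣ numberᵣ ︔ store old numberᵣ vertexᵣ ︔ incr numberᵣ) (subst (λ us → suc-C ≡ length us × Numbering _ us (suc (length done)))
               (sym (filter-∷ʳ⁺ far? done far))
               (trans (increment C≡ one≡′) (sym (length-∷ʳ (filter far? done))) , numbering-∷ʳ U≡ C≡ (trans U≡ (sym u≡)) num)))
        >> λ { uc′ (C≡′ , num′) → block (incr vertexᵣ ︔ decr todoᵣ)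
          (cong₂ _∸_ (trans (regs uc′ todoᵣ refl) D≡) (trans (regs uc′ oneᵣ refl) one≡′) ,
           trans (increment (trans (regs uc′ vertexᵣ refl) U≡) (trans (regs uc′ oneᵣ refl) one≡′)) (sym (length-∷ʳ done)) ,
           C≡′ , subst (Numbering _ _) (sym (length-∷ʳ done)) (numbering (Numbering.number num′))) })
        where
        one≡′ = trans (regs uc oneᵣ refl) one≡
        u≡ = position done eq
        mark≡ : arr s′ mark (reg s′ vertexᵣ) ≡ arr s mark (toℕ u)
        mark≡ = trans (cong (arr s′ mark) (trans U≡ (sym u≡))) (arrs uc mark refl (toℕ u))
        suc-C = reg s′ numberᵣ + reg s′ oneᵣ

    open Slice n k k<n

    record Written (s₀ : State) (out : List ℕ) (s : State) : Set where
      constructor written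
      field
        cell   : ∀ i → arr s (inner 0) (i * n + k) ≡ cells out i
        end    : reg s endᵣ ≡ length out
        others : OtherSlicesEqual s₀ s

    append : ∀ {s₀ out s ρ i y x} → i ≡ reg s endᵣ * n + k → y ≡ x → ρ endᵣ ≡ suc (length out) → Written s₀ out s →
             Written s₀ (out ∷ʳ x) (mkState ρ (arr s [ inner 0 ↦ arr s (inner 0) [ i ↦ y ] ]))
    append {out = out} {s} {x = x} refl refl end′ (written cell end others) = written
      (λ j → trans (slice-updated (arr s (inner 0)) k<n (reg s endᵣ) j)
        (trans (cong (λ l → ((λ j → arr s (inner 0) (j * n + k)) [ l ↦ x ]) j) end)
          (trans (updated-cong (length out) cell j) (sym (cells-∷ʳ out x j)))))
      (trans end′ (sym (length-∷ʳ out)))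
      (otherSlices-trans others (otherSlices-store 1 (reg s endᵣ) refl))

    -- Back-patching of the cell reserved for the length of a list, after the list `ys` itself has
    -- been appended.
    fill : ∀ {s₀ out ys s ρ i y x} → i ≡ length out * n + k → y ≡ x → ρ endᵣ ≡ reg s endᵣ → Written s₀ (out ++ 0 ∷ ys) s →
           Written s₀ (out ++ x ∷ ys) (mkState ρ (arr s [ inner 0 ↦ arr s (inner 0) [ i ↦ y ] ]))
    fill {out = out} {ys} {s} {x = x} refl refl end′ (written cell end others) = written
      (λ j → trans (slice-updated (arr s (inner 0)) k<n (length out) j)
        (trans (updated-cong (length out) cell j) (cells-replace out 0 x ys j)))
      (trans end′ (trans end (trans (length-++ out) (sym (length-++ out)))))
      (otherSlices-trans others (otherSlices-store 1 (length out) refl))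

    written-≡ : ∀ {s₀ o o′ s} → o ≡ o′ → Written s₀ o s → Written s₀ o′ s
    written-≡ refl wr = wr

    module _ (ν : Vertex G → ℕ) where

      copied : List (Vertex G) → List ℕ
      copied xs = map ν (filter far? xs)

      copiedRow : Vertex G → List ℕ
      copiedRow u = length (filter far? (nbrs u)) ∷ copied (nbrs u)

      module _ {s₀ : State} where

        copyList-run : ∀ {s} xs {rest out} → reg s Nᵣ ≡ n → reg s Kᵣ ≡ k → reg s oneᵣ ≡ 1 →
          Marks (arr s mark) (ClosedNbhd G v) → (∀ x → Far x → arr s new (toℕ x) ≡ ν x) →
          reg s degreeᵣ ≡ length xs → reg s countᵣ ≡ 0 → Stream (arr s input) (reg s readᵣ) (map toℕ xs ++ rest) → Written s₀ (out ∷ʳ 0) s →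
          Exec copyList s [] (1 + length xs * 15) λ s′ →
            Stream (arr s′ input) (reg s′ readᵣ) rest × reg s′ countᵣ ≡ length (filter far? xs) × Written s₀ (out ++ 0 ∷ copied xs) s′
        copyList-run {s} xs {rest} {out} N≡ K≡ one≡ (marks on off) new≡ E≡ cnt≡ st wr = weaken
          (≤-reflexive (cong suc (sum-const xs 15))) (λ _ q → q)
          (silent xs (forEach _ (λ _ → 14) degreeᵣ body s xs Inv step (st , cnt≡ , wr) E≡))
          where
          body = (load nbrᵣ input readᵣ ︔ incr readᵣ ︔ load valueᵣ mark nbrᵣ) ︔
            cond valueᵣ skip (load valueᵣ new nbrᵣ ︔ move cellᵣ endᵣ ︔ toSlice cellᵣ ︔ store (inner 0) cellᵣ valueᵣ ︔ incr endᵣ ︔ incr countᵣ) ︔ decr degreeᵣ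
          Inv : List (Vertex G) → List (Vertex G) → State → Set
          Inv done todo s′ = Stream (arr s′ input) (reg s′ readᵣ) (map toℕ todo ++ rest) ×
            reg s′ countᵣ ≡ length (filter far? done) × Written s₀ (out ++ 0 ∷ copied done) s′
          step : ∀ done u todo s′ → done ++ u ∷ todo ≡ xs → Unchanged body s s′ →
                 Inv done (u ∷ todo) s′ → reg s′ degreeᵣ ≡ suc (length todo) →
                 Exec body s′ [] 14 λ s″ → reg s″ degreeᵣ ≡ length todo × Inv (done ∷ʳ u) todo s″
          step done u todo s′ _ uc (st , cnt≡ , wr) E≡ = head then
            (if-zero {Q = λ s″ → reg s″ countᵣ ≡ length (filter far? (done ∷ʳ u)) × Written s₀ (out ++ 0 ∷ copied (done ∷ʳ u)) s″}
              (λ marked → let near = decidable-stable (closedNbhd? G v u) λ far → marked (trans mark≡ (off u far)) in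
                block skip (subst (λ us → reg s′ countᵣ ≡ length us × Written s₀ (out ++ 0 ∷ map ν us) (effect head s′))
                  (sym (filter-∷ʳ⁻ far? done λ far → far near))
                  (cnt≡ , written (Written.cell wr) (Written.end wr) (otherSlices (OtherSlicesEqual.equal (Written.others wr))))))
              (λ unmarked → let far = λ near → on u near (trans (sym mark≡) unmarked) in
                block tail
                  (subst (λ us → reg s′ countᵣ + reg s′ oneᵣ ≡ length us × Written s₀ (out ++ 0 ∷ map ν us) (effect tail (effect head s′)))
                    (sym (filter-∷ʳ⁺ far? done far))
                    (trans (increment cnt≡ one≡′) (sym (length-∷ʳ (filter far? done))) ,
                     written-≡
                       (trans (++-assoc out (0 ∷ copied done) [ ν u ]) (cong (λ ys → out ++ 0 ∷ ys) (sym (map-++ ν (filter far? done) [ u ]))))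
                       (append {s = s′} (cong₂ (λ a b → reg s′ endᵣ * a + b) N≡′ K≡′)
                         (trans (cong (arr s′ new) x≡) (trans (arrs uc new refl _) (new≡ u far)))
                         (increment (Written.end wr) one≡′) wr)))))
            >> λ { uc′ (cnt≡′ , wr′) → block (decr degreeᵣ)
              (cong₂ _∸_ (trans (regs uc′ degreeᵣ refl) E≡) (trans (regs uc′ oneᵣ refl) one≡′) ,
               stream-cong (arrs uc′ input refl) (regs uc′ readᵣ refl) (stream-tail one≡′ st) ,
               cnt≡′ , written (Written.cell wr′) (Written.end wr′) (otherSlices (OtherSlicesEqual.equal (Written.others wr′)))) }
            where
            head = load nbrᵣ input readᵣ ︔ incr readᵣ ︔ load valueᵣ mark nbrᵣ
            tail = load valueᵣ new nbrᵣ ︔ move cellᵣ endᵣ ︔ toSlice cellᵣ ︔ store (inner 0) cellᵣ valueᵣ ︔ incr endᵣ ︔ incr countᵣ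
            one≡′ = trans (regs uc oneᵣ refl) one≡
            N≡′ = trans (regs uc Nᵣ refl) N≡
            K≡′ = trans (regs uc Kᵣ refl) K≡
            x≡ = stream-head st
            mark≡ : arr s′ mark (arr s′ input (reg s′ readᵣ)) ≡ arr s mark (toℕ u)
            mark≡ = trans (cong (arr s′ mark) x≡) (arrs uc mark refl (toℕ u))

      -- Stated for whatever numbering ν the array `new` holds on the far vertices; that ν inverts
      -- the embedding of the subgraph enters only when the result is compared with its encoding.
      copy-run : ∀ {s n′} → reg s Nᵣ ≡ n → reg s Kᵣ ≡ k → reg s oneᵣ ≡ 1 → reg s numberᵣ ≡ n′ →
        Marks (arr s mark) (ClosedNbhd G v) → (∀ x → Far x → arr s new (toℕ x) ≡ ν x) →
        Stream (arr s input) 1 (concatMap row vertices) → (∀ i → arr s (inner 0) (i * n + k) ≡ 0) →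
        Exec copy s [] (40 * volume) λ s′ →
          (∀ i → arr s′ (inner 0) (i * n + k) ≡ cells (n′ ∷ concatMap copiedRow (filter far? vertices)) i) × OtherSlicesEqual s s′
      copy-run {s} {n′} N≡ K≡ one≡ C≡ (marks on off) new≡ st fresh = weaken (loop-bound 6 17 15)
        (λ { _ (_ , _ , wr) → Written.cell wr , Written.others wr })
        (start then silent vertices (forEach _ (λ u → 17 + length (nbrs u) * 15) todoᵣ body s₁ vertices Inv step
          (refl , st , append {out = []} {s = effect (const endᵣ 0) s} K≡ C≡ refl (written fresh refl (otherSlices λ _ _ _ _ _ → refl))) (trans N≡ (sym #vertices))))
        where
        start = store (inner 0) Kᵣ numberᵣ ︔ const vertexᵣ 0 ︔ const readᵣ 1 ︔ const endᵣ 1 ︔ move todoᵣ Nᵣ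
        s₁ = effect start s
        head = load degreeᵣ input readᵣ ︔ incr readᵣ ︔ load valueᵣ mark vertexᵣ
        body = head ︔
          cond valueᵣ (arith add readᵣ readᵣ degreeᵣ)
                 ((move headᵣ endᵣ ︔ incr endᵣ ︔ const countᵣ 0) ︔ copyList ︔ (move cellᵣ headᵣ ︔ toSlice cellᵣ ︔ store (inner 0) cellᵣ countᵣ)) ︔
          (incr vertexᵣ ︔ decr todoᵣ)
        outOf : List (Vertex G) → List ℕ
        outOf us = n′ ∷ concatMap copiedRow us
        outOf-∷ʳ : ∀ us u → outOf (us ∷ʳ u) ≡ outOf us ++ copiedRow u
        outOf-∷ʳ us u = cong (n′ ∷_) (trans (concatMap-++ copiedRow us [ u ]) (cong (concatMap copiedRow us ++_) (++-identityʳ _)))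
        Inv : List (Vertex G) → List (Vertex G) → State → Set
        Inv done todo s′ = reg s′ vertexᵣ ≡ length done × Stream (arr s′ input) (reg s′ readᵣ) (concatMap row todo) ×
          Written s (outOf (filter far? done)) s′
        budget : ∀ m → 3 + (suc (1 + (4 + (1 + m + 5))) + 2) ≡ 17 + m
        budget = solve-∀
        step : ∀ done u todo s′ → done ++ u ∷ todo ≡ vertices → Unchanged body s₁ s′ →
               Inv done (u ∷ todo) s′ → reg s′ todoᵣ ≡ suc (length todo) →
               Exec body s′ [] (17 + length (nbrs u) * 15) λ s″ → reg s″ todoᵣ ≡ length todo × Inv (done ∷ʳ u) todo s″
        step done u todo s′ eq uc (U≡ , st , wr) D≡ = weaken (≤-reflexive (budget (length (nbrs u) * 15))) (λ _ q → q) (head then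
          (if-zero {Q = λ s″ → Stream (arr s″ input) (reg s″ readᵣ) (concatMap row todo) × Written s (outOf (filter far? (done ∷ʳ u))) s″}
            (λ marked → let near = decidable-stable (closedNbhd? G v u) λ far → marked (trans mark≡ (off u far)) in
              block (arith add readᵣ readᵣ degreeᵣ)
                (stream-drop (map toℕ (nbrs u)) (trans (stream-head st) (sym (length-map toℕ (nbrs u)))) (stream-tail one≡′ st) ,
                 subst (λ us → Written s (outOf us) _) (sym (filter-∷ʳ⁻ far? done λ far → far near))
                   (written (Written.cell wr) (Written.end wr) (otherSlices (OtherSlicesEqual.equal (Written.others wr))))))
            (λ unmarked → let far = λ near → on u near (trans (sym mark≡) unmarked) in
              (move headᵣ endᵣ ︔ incr endᵣ ︔ const countᵣ 0) then
              (copyList-run (nbrs u) {out = outOf (filter far? done)} N≡′ K≡′ one≡′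
                (marks-cong (arrs uc mark refl) id id (marks on off)) (λ x far → trans (arrs uc new refl _) (new≡ x far))
                (stream-head st) refl (stream-tail one≡′ st)
                (written (λ i → trans (Written.cell wr i) (sym (cells-∷ʳ0 (outOf (filter far? done)) i)))
                   (trans (increment (Written.end wr) one≡′) (sym (length-∷ʳ (outOf (filter far? done)))))
                   (otherSlices (OtherSlicesEqual.equal (Written.others wr))))
              >> λ { {s″} uc′ (st′ , cnt≡ , wr′) → block (move cellᵣ headᵣ ︔ toSlice cellᵣ ︔ store (inner 0) cellᵣ countᵣ)
                (st′ , written-≡ (sym (trans (cong outOf (filter-∷ʳ⁺ far? done far)) (outOf-∷ʳ (filter far? done) u)))
                   (fill {out = outOf (filter far? done)} {s = s″}
                     (trans (cong₂ (λ a b → a * reg s″ Nᵣ + b) (trans (regs uc′ headᵣ refl) (Written.end wr)) (trans (regs uc′ Kᵣ refl) K≡′))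
                            (cong (λ a → length (outOf (filter far? done)) * a + k) (trans (regs uc′ Nᵣ refl) N≡′)))
                     cnt≡ refl wr′)) }))
          >> λ { uc′ (st′ , wr′) → block (incr vertexᵣ ︔ decr todoᵣ)
            (cong₂ _∸_ (trans (regs uc′ todoᵣ refl) D≡) (trans (regs uc′ oneᵣ refl) one≡′) ,
             trans (increment (trans (regs uc′ vertexᵣ refl) U≡) (trans (regs uc′ oneᵣ refl) one≡′)) (sym (length-∷ʳ done)) ,
             st′ , written (Written.cell wr′) (Written.end wr′) (otherSlices (OtherSlicesEqual.equal (Written.others wr′)))) }))
          where
          one≡′ = trans (regs uc oneᵣ refl) one≡
          N≡′ = trans (regs uc Nᵣ refl) N≡
          K≡′ = trans (regs uc Kᵣ refl) K≡
          mark≡ : arr s′ mark (reg s′ vertexᵣ) ≡ arr s mark (toℕ u)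
          mark≡ = trans (cong (arr s′ mark) (trans U≡ (sym (position done eq)))) (arrs uc mark refl (toℕ u))

    -- The greedy scan reuses the marks of N[v]. Hence v and its neighbours are never selected by
    -- it, and `independentSet` adds v separately.
    Blocked : List (Vertex G) → Vertex G → Set
    Blocked sel u = ClosedNbhd G v u ⊎ Any (λ y → Graph.Adj G y u) sel

    blocked? : ∀ sel → Decidable (Blocked sel)
    blocked? sel u = closedNbhd? G v u ⊎-dec any? (λ y → Graph.adj? G y u) sel

    greedy : List (Vertex G) → Vertex G → List (Vertex G)
    greedy sel u = if does (blocked? sel u) then sel else u ∷ sel

    chosen : List (Vertex G) → List (Vertex G)
    chosen = foldl greedy []

    greedy-blocked : ∀ {sel u} → Blocked sel u → greedy sel u ≡ sel
    greedy-blocked {sel} {u} b rewrite dec-true (blocked? sel u) b = refl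

    greedy-free : ∀ {sel u} → ¬ Blocked sel u → greedy sel u ≡ u ∷ sel
    greedy-free {sel} {u} ¬b rewrite dec-false (blocked? sel u) ¬b = refl

    chosen-∷ʳ : ∀ us u → chosen (us ∷ʳ u) ≡ greedy (chosen us) u
    chosen-∷ʳ us u = foldl-∷ʳ greedy [] u us

    greedy-⊆ : ∀ {sel u x} → x ∈ greedy sel u → x ≡ u ⊎ x ∈ sel
    greedy-⊆ {sel} {u} x∈ with does (blocked? sel u)
    greedy-⊆ x∈          | true  = inj₂ x∈
    greedy-⊆ (here x≡u)  | false = inj₁ x≡u
    greedy-⊆ (there x∈)  | false = inj₂ x∈

    greedy-⊇ : ∀ {sel u x} → x ∈ sel → x ∈ greedy sel u
    greedy-⊇ {sel} {u} x∈ with does (blocked? sel u)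
    ... | true  = x∈
    ... | false = there x∈

    foldl-greedy-⊆ : ∀ {sel} us {x} → x ∈ foldl greedy sel us → x ∈ sel ⊎ x ∈ us
    foldl-greedy-⊆ []       x∈ = inj₁ x∈
    foldl-greedy-⊆ (u ∷ us) x∈ with foldl-greedy-⊆ us x∈
    ... | inj₂ x∈us = inj₂ (there x∈us)
    ... | inj₁ x∈g with greedy-⊆ x∈g
    ...   | inj₁ x≡u  = inj₂ (here x≡u)
    ...   | inj₂ x∈sel = inj₁ x∈sel

    chosen-⊆ : ∀ us {x} → x ∈ chosen us → x ∈ us
    chosen-⊆ us x∈ with foldl-greedy-⊆ us x∈
    ... | inj₂ x∈us = x∈us

    open DecMembership {A = Vertex G} Fin._≟_ using (_∈?_)

    independentSet : List (Vertex G)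
    independentSet = v ∷ chosen vertices

    -- The second conclusion protects the rows of earlier iterations, in particular row 0, which all
    -- comparisons read.
    choose-run : ∀ {s} → reg s Nᵣ ≡ n → reg s Kᵣ ≡ k → reg s oneᵣ ≡ 1 →
      Marks (arr s mark) (ClosedNbhd G v) → Stream (arr s input) 1 (concatMap row vertices) →
      Exec choose s [] (26 * volume) λ s′ →
        (∀ x → arr s′ sets (k * n + toℕ x) ≡ bit (does (x ∈? independentSet))) ×
        (∀ j → j < k * n → arr s′ sets j ≡ arr s sets j)
    choose-run {s} N≡ K≡ one≡ ms st = weaken
      (≤-trans (≤-reflexive (move-tail _)) (loop-bound 8 9 7)) (λ _ q → q)
      (start then
        (silent vertices (forEach _ (λ u → 9 + length (nbrs u) * 7) todoᵣ body s₁ vertices Inv step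
          (refl , st , trans (cong₂ _*_ K≡ N≡) (sym (+-identityʳ (k * n))) ,
           marks-cong (λ _ → refl) inj₁ (λ { (inj₁ q) → q ; (inj₂ ()) }) ms , (λ _ ()) , (λ _ _ → refl))
          (trans N≡ (sym #vertices)))
        -- The scan has put 0 at position v, which is blocked; the last store corrects this cell,
        -- whose index is k * n + k.
        >> λ { {s″} uc (_ , _ , _ , _ , entries , earlier) → block (arith mul rowᵣ Kᵣ Nᵣ ︔ arith add rowᵣ rowᵣ Kᵣ ︔ store sets rowᵣ oneᵣ)
          ((λ x → finish uc entries x (x Fin.≟ v)) ,
           λ j j< → trans (untouched (arr s″ sets) (<⇒≢ (<-≤-trans j< (≤-trans (m≤m+n (k * n) k) (≤-reflexive (sym (corner uc))))))) (earlier j j<)) }))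
      where
      start = const vertexᵣ 0 ︔ const readᵣ 1 ︔ arith mul rowᵣ Kᵣ Nᵣ ︔ move todoᵣ Nᵣ
      s₁ = effect start s
      head = load degreeᵣ input readᵣ ︔ incr readᵣ ︔ load valueᵣ mark vertexᵣ ︔ arith sub flagᵣ oneᵣ valueᵣ ︔ store sets rowᵣ flagᵣ
      body = head ︔ markList ︔ (incr rowᵣ ︔ incr vertexᵣ ︔ decr todoᵣ)
      move-tail : ∀ m → 5 + (m + 3) ≡ 8 + m
      move-tail = solve-∀
      Entries : State → List (Vertex G) → ℕ → Set
      Entries s′ sel b = ∀ x → toℕ x < b → arr s′ sets (k * n + toℕ x) ≡ bit (does (x ∈? sel))
      Inv : List (Vertex G) → List (Vertex G) → State → Set
      Inv done todo s′ = reg s′ vertexᵣ ≡ length done × Stream (arr s′ input) (reg s′ readᵣ) (concatMap row todo) ×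
        reg s′ rowᵣ ≡ k * n + length done × Marks (arr s′ mark) (Blocked (chosen done)) ×
        Entries s′ (chosen done) (length done) × (∀ j → j < k * n → arr s′ sets j ≡ arr s sets j)
      budget : ∀ m → 5 + ((1 + m) + 3) ≡ 9 + m
      budget = solve-∀
      corner : ∀ {s″} → Unchanged (while todoᵣ body) s₁ s″ → reg s″ Kᵣ * reg s″ Nᵣ + reg s″ Kᵣ ≡ k * n + k
      corner uc = cong₂ (λ a b → a * b + a) (trans (regs uc Kᵣ refl) K≡) (trans (regs uc Nᵣ refl) N≡)
      finish : ∀ {s″} (uc : Unchanged (while todoᵣ body) s₁ s″) → Entries s″ (chosen vertices) (length vertices) →
               ∀ x → Dec (x ≡ v) →
               (arr s″ sets [ reg s″ Kᵣ * reg s″ Nᵣ + reg s″ Kᵣ ↦ reg s″ oneᵣ ]) (k * n + toℕ x) ≡ bit (does (x ∈? independentSet))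
      finish {s″} uc entries x (yes refl) = trans (updated-≡ (arr s″ sets) (sym (corner uc)))
        (trans (trans (regs uc oneᵣ refl) one≡) (cong bit (sym (dec-true (v ∈? independentSet) (here refl)))))
      finish {s″} uc entries x (no x≢v) = trans
        (untouched (arr s″ sets) (λ eq → x≢v (Fin.toℕ-injective (+-cancelˡ-≡ (k * n) _ _ (trans eq (corner uc))))))
        (trans (entries x (subst (toℕ x <_) (sym #vertices) (Fin.toℕ<n x)))
          (cong bit (does-⇔ (mk⇔ there λ { (here x≡v) → contradiction x≡v x≢v ; (there x∈) → x∈ }) (x ∈? chosen vertices) (x ∈? independentSet))))
      step : ∀ done u todo s′ → done ++ u ∷ todo ≡ vertices → Unchanged body s₁ s′ →
             Inv done (u ∷ todo) s′ → reg s′ todoᵣ ≡ suc (length todo) →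
             Exec body s′ [] (9 + length (nbrs u) * 7) λ s″ → reg s″ todoᵣ ≡ length todo × Inv (done ∷ʳ u) todo s″
      step done u todo s′ eq uc (U≡ , st , R≡ , ms@(marks on off) , entries , earlier) D≡ =
        weaken (≤-reflexive (budget (length (nbrs u) * 7))) (λ _ q → q)
        (head then markList-run (nbrs u) one≡′ (stream-head st) (stream-tail one≡′ st)
          (marks-cong {h = arr s′ mark} (λ _ → refl) id id ms)
        >> λ { {s″} uc′ (st′ , ms′) → block (incr rowᵣ ︔ incr vertexᵣ ︔ decr todoᵣ)
          (cong₂ _∸_ (trans (regs uc′ todoᵣ refl) D≡) (trans (regs uc′ oneᵣ refl) one≡′) ,
           trans (increment (trans (regs uc′ vertexᵣ refl) U≡) (trans (regs uc′ oneᵣ refl) one≡′)) (sym (length-∷ʳ done)) ,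
           st′ ,
           trans (increment (trans (regs uc′ rowᵣ refl) R≡) (trans (regs uc′ oneᵣ refl) one≡′))
             (trans (sym (+-suc (k * n) (length done))) (cong (k * n +_) (sym (length-∷ʳ done)))) ,
           subst (λ sel → Marks _ (Blocked sel)) (sym (chosen-∷ʳ done u)) (marks-cong (λ _ → refl) marked⇒ ⇒marked ms′) ,
           subst₂ (Entries s″) (sym (chosen-∷ʳ done u)) (sym (length-∷ʳ done)) (λ x x< → trans (arrs uc′ sets refl _) (entry x x< (x Fin.≟ u))) ,
           (λ j j< → trans (arrs uc′ sets refl j) (trans
             (untouched (arr s′ sets) (<⇒≢ (<-≤-trans j< (≤-trans (m≤m+n (k * n) (length done)) (≤-reflexive (sym R≡)))))) (earlier j j<)))) })
        where
        one≡′ = trans (regs uc oneᵣ refl) one≡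
        sel = chosen done
        u≡ = position done eq
        -- Truncated subtraction negates: every nonzero mark, however large, gives 0.
        flag = reg s′ oneᵣ ∸ arr s′ mark (reg s′ vertexᵣ)
        flag≡ : flag ≡ 1 ∸ arr s′ mark (toℕ u)
        flag≡ = cong₂ _∸_ one≡′ (cong (arr s′ mark) (trans U≡ (sym u≡)))
        flag-blocked : Blocked sel u → flag ≡ 0
        flag-blocked b = trans flag≡ (m≤n⇒m∸n≡0 (n≢0⇒n>0 (on u b)))
        flag-free : ¬ Blocked sel u → flag ≡ 1
        flag-free ¬b = trans flag≡ (cong (1 ∸_) (off u ¬b))
        -- Selected vertices have been visited before and thus have smaller numbers than u.
        u∉sel : ¬ (u ∈ sel)
        u∉sel u∈ = <-irrefl u≡ (position< done eq (chosen-⊆ done u∈))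
        marked⇒ : ∀ {x} → Blocked sel x ⊎ (¬ (flag ≡ 0) × x ∈ nbrs u) → Blocked (greedy sel u) x
        marked⇒ (inj₁ (inj₁ near)) = inj₁ near
        marked⇒ (inj₁ (inj₂ adj)) with find adj
        ... | y , y∈ , y~x = inj₂ (lose (greedy-⊇ y∈) y~x)
        marked⇒ (inj₂ (flag≢0 , x∈)) = inj₂ (lose (subst (u ∈_) (sym (greedy-free (flag≢0 ∘ flag-blocked))) (here refl)) (Equivalence.to (nbr⇔ u _) x∈))
        ⇒marked : ∀ {x} → Blocked (greedy sel u) x → Blocked sel x ⊎ (¬ (flag ≡ 0) × x ∈ nbrs u)
        ⇒marked (inj₁ near) = inj₁ (inj₁ near)
        ⇒marked {x} (inj₂ adj) with blocked? sel u
        ... | yes b = inj₁ (inj₂ (subst (Any (λ y → Graph.Adj G y x)) (greedy-blocked b) adj))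
        ... | no ¬b with subst (Any (λ y → Graph.Adj G y x)) (greedy-free ¬b) adj
        ...   | here u~x   = inj₂ ((λ flag≡0 → 1+n≢0 (trans (sym (flag-free ¬b)) flag≡0)) , Equivalence.from (nbr⇔ u _) u~x)
        ...   | there adj′ = inj₁ (inj₂ adj′)
        entry : ∀ x → toℕ x < suc (length done) → Dec (x ≡ u) →
                (arr s′ sets [ reg s′ rowᵣ ↦ flag ]) (k * n + toℕ x) ≡ bit (does (x ∈? greedy sel u))
        entry x _ (yes refl) = trans (updated-≡ (arr s′ sets) (trans (cong (k * n +_) u≡) (sym R≡))) (decide (blocked? sel u))
          where
          decide : Dec (Blocked sel u) → flag ≡ bit (does (u ∈? greedy sel u))
          decide (yes b) = trans (flag-blocked b) (cong bit (sym (dec-false (u ∈? greedy sel u) (u∉sel ∘ subst (u ∈_) (greedy-blocked b)))))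
          decide (no ¬b) = trans (flag-free ¬b) (cong bit (sym (dec-true (u ∈? greedy sel u) (subst (u ∈_) (sym (greedy-free ¬b)) (here refl)))))
        entry x x< (no x≢u) = trans
          (untouched (arr s′ sets) (λ eq → x≢u (Fin.toℕ-injective (trans (+-cancelˡ-≡ (k * n) _ _ (trans eq R≡)) (sym u≡)))))
          (trans (entries x (≤∧≢⇒< (s≤s⁻¹ x<) (λ eq → x≢u (Fin.toℕ-injective (trans eq (sym u≡))))))
            (cong bit (does-⇔ (mk⇔ greedy-⊇ λ x∈ → [ (λ x≡u → contradiction x≡u x≢u) , id ]′ (greedy-⊆ x∈)) (x ∈? sel) (x ∈? greedy sel u))))

    comparison : (Vertex G → Bool) → (Vertex G → Bool) → List ℕ
    comparison b b₀ = n ∷ concatMap (λ u → toℕ u ∷ bit (b₀ u) ∸ bit (b u) ∷ (bit (b u) ∸ bit (b₀ u)) + (bit (b₀ u) ∸ bit (b u)) ∷ 1 ∷ []) vertices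

    compare-run : ∀ {s b b₀} → reg s Nᵣ ≡ n → reg s Kᵣ ≡ k → reg s oneᵣ ≡ 1 →
      (∀ x → arr s sets (toℕ x) ≡ bit (b₀ x)) → (∀ x → arr s sets (k * n + toℕ x) ≡ bit (b x)) →
      Exec compare s (comparison b b₀) (6 + n * 13) (λ _ → ⊤)
    compare-run {s} {b} {b₀} N≡ K≡ one≡ S₀ S = weaken
      (≤-reflexive (cong (6 +_) (trans (sum-const vertices 13) (cong (_* 13) #vertices)))) (λ _ q → q)
      (output (cong (_∷ _) N≡) (writing (start then
        weaken ≤-refl (λ _ _ → tt) (forEach _ (λ _ → 12) todoᵣ body (effect start s) vertices Inv step
          (refl , trans (cong₂ _*_ K≡ N≡) (sym (+-identityʳ (k * n)))) (trans N≡ (sym #vertices))))))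
      where
      start = const vertexᵣ 0 ︔ arith mul rowᵣ Kᵣ Nᵣ ︔ move todoᵣ Nᵣ
      head = load valueᵣ sets vertexᵣ ︔ load cellᵣ sets rowᵣ ︔ arith sub nbrᵣ valueᵣ cellᵣ ︔ arith sub cellᵣ cellᵣ valueᵣ ︔ arith add cellᵣ cellᵣ nbrᵣ
      next = incr rowᵣ ︔ incr vertexᵣ ︔ decr todoᵣ
      body = head ︔ write vertexᵣ ︔ write nbrᵣ ︔ write cellᵣ ︔ write oneᵣ ︔ next
      Inv : List (Vertex G) → List (Vertex G) → State → Set
      Inv done todo s′ = reg s′ vertexᵣ ≡ length done × reg s′ rowᵣ ≡ k * n + length done
      step : ∀ done u todo s′ → done ++ u ∷ todo ≡ vertices → Unchanged body (effect start s) s′ →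
             Inv done (u ∷ todo) s′ → reg s′ todoᵣ ≡ suc (length todo) →
             Exec body s′ (toℕ u ∷ bit (b₀ u) ∸ bit (b u) ∷ (bit (b u) ∸ bit (b₀ u)) + (bit (b₀ u) ∸ bit (b u)) ∷ 1 ∷ []) 12
               λ s″ → reg s″ todoᵣ ≡ length todo × Inv (done ∷ʳ u) todo s″
      step done u todo s′ eq uc (U≡ , R≡) D≡ = output written≡ (exec
        (⇓seq (straight head s′ tt) (⇓seq ⇓write (⇓seq ⇓write (⇓seq ⇓write (⇓seq ⇓write (straight next _ tt))))))
        ≤-refl
        (cong₂ _∸_ D≡ one≡′ , trans (increment U≡ one≡′) (sym (length-∷ʳ done)) ,
         trans (increment R≡ one≡′) (trans (sym (+-suc (k * n) (length done))) (cong (k * n +_) (sym (length-∷ʳ done))))))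
        where
        one≡′ = trans (regs uc oneᵣ refl) one≡
        u≡ = position done eq
        S₀≡ : arr s′ sets (reg s′ vertexᵣ) ≡ bit (b₀ u)
        S₀≡ = trans (cong (arr s′ sets) (trans U≡ (sym u≡))) (trans (arrs uc sets refl _) (S₀ u))
        S≡ : arr s′ sets (reg s′ rowᵣ) ≡ bit (b u)
        S≡ = trans (cong (arr s′ sets) (trans R≡ (cong (k * n +_) (sym u≡)))) (trans (arrs uc sets refl _) (S u))
        written≡ : reg s′ vertexᵣ ∷ arr s′ sets (reg s′ vertexᵣ) ∸ arr s′ sets (reg s′ rowᵣ) ∷
                   (arr s′ sets (reg s′ rowᵣ) ∸ arr s′ sets (reg s′ vertexᵣ)) + (arr s′ sets (reg s′ vertexᵣ) ∸ arr s′ sets (reg s′ rowᵣ)) ∷ reg s′ oneᵣ ∷ []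
                   ≡ toℕ u ∷ bit (b₀ u) ∸ bit (b u) ∷ (bit (b u) ∸ bit (b₀ u)) + (bit (b₀ u) ∸ bit (b u)) ∷ 1 ∷ []
        written≡ = cong₂ _∷_ (trans U≡ (sym u≡))
          (trans (cong₂ (λ c b → c ∸ b ∷ (b ∸ c) + (c ∸ b) ∷ reg s′ oneᵣ ∷ []) S₀≡ S≡) (cong (λ o → _ ∷ _ ∷ o ∷ []) one≡′))

-- Presenting the graph without a closed neighbourhood

lookup-related : ∀ {A : Set} {_~_ : A → A → Set} {xs} → AllPairs _~_ xs → ∀ {i j} → toℕ i < toℕ j → lookup xs i ~ lookup xs j
lookup-related (x~ ∷ _)  {Fin.zero}  {Fin.suc j} _         = All.lookup x~ (∈-lookup j)
lookup-related (_ ∷ xs~) {Fin.suc i} {Fin.suc j} (s≤s i<j) = lookup-related xs~ i<j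

cells-lookup : ∀ {A : Set} (f : A → ℕ) xs i → cells (map f xs) (toℕ i) ≡ f (lookup xs i)
cells-lookup f (x ∷ xs) Fin.zero    = refl
cells-lookup f (x ∷ xs) (Fin.suc i) = cells-lookup f xs i

map-lookup-allFin : ∀ {A : Set} (xs : List A) → map (lookup xs) (allFin (length xs)) ≡ xs
map-lookup-allFin xs = trans (map-tabulate id (lookup xs)) (tabulate-lookup xs)

module SubgraphLists (G : Graph) (nbrs : Vertex G → List (Vertex G)) (adjacency : IsAdjacencyLists G nbrs) where

  open OnGraph G nbrs adjacency

  module Deleting (v : Vertex G) where

    open Iteration v

    H : Graph
    H = G -N[ v ]

    ι : Vertex H → Vertex G
    ι = lookup (filter far? vertices)

    -- Filtering keeps the vertices in increasing order. Besides injectivity, this gives that edges,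
    -- listed with the smaller end first, keep their orientation.
    ι-mono : ∀ {i j} → i Fin.< j → ι i Fin.< ι j
    ι-mono = lookup-related {_~_ = Fin._<_} (AllPairs.filter⁺ far? (AllPairs.tabulate⁺-< {f = id} id))

    ι-injective : ∀ {i j} → ι i ≡ ι j → i ≡ j
    ι-injective {i} {j} eq with Fin.<-cmp i j
    ... | tri< i<j _ _ = contradiction eq (Fin.<⇒≢ (ι-mono i<j))
    ... | tri≈ _ i≡j _ = i≡j
    ... | tri> _ _ j<i = contradiction (sym eq) (Fin.<⇒≢ (ι-mono j<i))

    ι-far : ∀ i → Far (ι i)
    ι-far i = proj₂ (∈-filter⁻ far? {xs = vertices} (∈-lookup i))

    ι-onto : ∀ {u} → Far u → ∃ λ i → u ≡ ι i
    ι-onto {u} far = index u∈ , lookup-index u∈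
      where u∈ = ∈-filter⁺ far? (∈-allFin u) far

    preimage : ∀ {us} → All Far us → ∃ λ is → map ι is ≡ us
    preimage []           = [] , refl
    preimage (far ∷ fars) with ι-onto far | preimage fars
    ... | i , refl | is , refl = i ∷ is , refl

    -- The lists inherit their arbitrary order from `nbrs`. The given program succeeds on every
    -- presentation, so they may be passed on unsorted.
    farNbrs : Vertex H → List (Vertex H)
    farNbrs i = proj₁ (preimage (all-filter far? (nbrs (ι i))))

    ι-farNbrs : ∀ i → map ι (farNbrs i) ≡ filter far? (nbrs (ι i))
    ι-farNbrs i = proj₂ (preimage (all-filter far? (nbrs (ι i))))

    farNbrs-adjacency : IsAdjacencyLists H farNbrs
    farNbrs-adjacency i = unique , λ j → mk⇔ to from
      where
      unique : Unique (farNbrs i)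
      unique = UniqueProperties.map⁻ (subst Unique (sym (ι-farNbrs i)) (AllPairs.filter⁺ far? (proj₁ (adjacency (ι i)))))
      to : ∀ {j} → j ∈ farNbrs i → Graph.Adj G (ι i) (ι j)
      to {j} j∈ = Equivalence.to (nbr⇔ (ι i) (ι j)) (proj₁ (∈-filter⁻ far? (subst (ι j ∈_) (ι-farNbrs i) (∈-map⁺ ι j∈))))
      from : ∀ {j} → Graph.Adj G (ι i) (ι j) → j ∈ farNbrs i
      from {j} adj with ∈-map⁻ ι (subst (ι j ∈_) (sym (ι-farNbrs i)) (∈-filter⁺ far? (Equivalence.from (nbr⇔ (ι i) (ι j)) adj) (ι-far j)))
      ... | j′ , j′∈ , eq = subst (_∈ farNbrs i) (sym (ι-injective eq)) j′∈

    -- Turns what `copy` leaves in the slice into the input format of the given program. Since ν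
    -- inverts ι, renumbering a far neighbour in G is the same as listing its preimage in H.
    encode-farNbrs : ∀ {ν} → (∀ i → ν (ι i) ≡ toℕ i) →
      encodeGraph (order H) farNbrs ≡ order H ∷ concatMap (copiedRow ν) (filter far? vertices)
    encode-farNbrs {ν} ν-ι = cong (order H ∷_) (begin
      concatMap (λ i → enc (farNbrs i)) (allFin (order H))           ≡⟨ concatMap-cong rows (allFin (order H)) ⟩
      concatMap (copiedRow ν ∘ ι) (allFin (order H))                 ≡⟨ concatMap-map (copiedRow ν) ι (allFin (order H)) ⟨
      concatMap (copiedRow ν) (map ι (allFin (order H)))             ≡⟨ cong (concatMap (copiedRow ν)) (map-lookup-allFin (filter far? vertices)) ⟩
      concatMap (copiedRow ν) (filter far? vertices)                 ∎)
      where
      open ≡-Reasoning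
      rows : ∀ i → enc (farNbrs i) ≡ copiedRow ν (ι i)
      rows i = trans (cong₂ _∷_ (sym (length-map ι (farNbrs i))) (trans (map-cong (sym ∘ ν-ι) (farNbrs i)) (map-∘ (farNbrs i))))
                     (cong (λ us → length us ∷ map ν us) (ι-farNbrs i))

-- Translating the written system

module _ {m n : ℕ} (φ : Fin m → Fin n) where

  relabel : SparseEquation m → SparseEquation n
  relabel = map λ (j , q) → φ j , q

  encodeTerm : ∀ {n} → Fin n × ℚᵘ → List ℕ
  encodeTerm (u , q) = toℕ u ∷ encodeℚ q

  module _ {ι : ℕ → ℕ} (ι≡ : ∀ j → ι (toℕ j) ≡ toℕ (φ j)) where

    translate-terms : ∀ ts ys → translate ι (length ts , 0) (concatMap encodeTerm ts ++ ys) ≡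
                      concatMap encodeTerm (relabel ts) ++ translate ι (0 , 0) ys
    translate-terms []                              ys = refl
    -- The encoding of a rational reduces only once the sign is known; either way its three numbers
    -- pass through and leave none due.
    translate-terms ((j , mkℚᵘ (pos _) _) ∷ ts)     ys = cong₂ _∷_ (ι≡ j) (cong (λ zs → _ ∷ _ ∷ _ ∷ zs) (translate-terms ts ys))
    translate-terms ((j , mkℚᵘ (-[1+ _ ]) _) ∷ ts)  ys = cong₂ _∷_ (ι≡ j) (cong (λ zs → _ ∷ _ ∷ _ ∷ zs) (translate-terms ts ys))

    translate-equation : ∀ ts ys → translate ι (0 , 0) (encodeEquation ts ++ ys) ≡ encodeEquation (relabel ts) ++ translate ι (0 , 0) ys
    translate-equation ts ys = cong₂ _∷_ (sym (length-map _ ts)) (translate-terms ts ys)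

    translate-system : ∀ eqs → translate ι (0 , 0) (encodeSystem eqs) ≡ encodeSystem (map relabel eqs)
    translate-system []         = refl
    translate-system (ts ∷ eqs) = trans (translate-equation ts (encodeSystem eqs)) (cong (encodeEquation (relabel ts) ++_) (translate-system eqs))

advance-terms : ∀ {m} (ts : SparseEquation m) ys → advance* (length ts , 0) (concatMap (λ (u , q) → toℕ u ∷ encodeℚ q) ts ++ ys) ≡ advance* (0 , 0) ys
advance-terms []                              ys = refl
advance-terms ((j , mkℚᵘ (pos _) _) ∷ ts)     ys = advance-terms ts ys
advance-terms ((j , mkℚᵘ (-[1+ _ ]) _) ∷ ts)  ys = advance-terms ts ys

-- After a complete system the automaton is back in its initial state, ready for the output of the
-- next run without a reset.
advance-system : ∀ {m} (eqs : List (SparseEquation m)) → advance* (0 , 0) (encodeSystem eqs) ≡ (0 , 0)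
advance-system []         = refl
advance-system (ts ∷ eqs) = trans (advance-terms ts (encodeSystem eqs)) (advance-system eqs)

-- The coefficients of the equation w(S) − w(T) = 0.
sign : Bool → Bool → ℚᵘ
sign true  false = mkℚᵘ (pos 1) 0
sign false true  = mkℚᵘ -[1+ 0 ] 0
sign _     _     = mkℚᵘ (pos 0) 0

encode-sign : ∀ b c → encodeℚ (sign b c) ≡ bit c ∸ bit b ∷ (bit b ∸ bit c) + (bit c ∸ bit b) ∷ 1 ∷ []
encode-sign true  true  = refl
encode-sign true  false = refl
encode-sign false true  = refl
encode-sign false false = refl

module _ {n : ℕ} where

  open DecMembership {A = Fin n} Fin._≟_ using (_∈?_)

  -- Every vertex gets a term, with coefficient 0 if need be, so that the number of terms is n and
  -- can be written in advance.
  difference : List (Fin n) → List (Fin n) → SparseEquation n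
  difference us vs = map (λ x → x , sign (does (x ∈? us)) (does (x ∈? vs))) (allFin n)

  encode-difference : ∀ us vs → encodeEquation (difference us vs) ≡
    n ∷ concatMap (λ x → toℕ x ∷ bit (does (x ∈? vs)) ∸ bit (does (x ∈? us)) ∷
      (bit (does (x ∈? us)) ∸ bit (does (x ∈? vs))) + (bit (does (x ∈? vs)) ∸ bit (does (x ∈? us))) ∷ 1 ∷ []) (allFin n)
  encode-difference us vs = cong₂ _∷_ (trans (length-map _ (allFin n)) (length-tabulate id))
    (trans (concatMap-map _ _ (allFin n)) (concatMap-cong (λ x → cong (toℕ x ∷_) (encode-sign (does (x ∈? us)) (does (x ∈? vs)))) (allFin n)))

encodeSystem-++ : ∀ {n} (xs ys : List (SparseEquation n)) → encodeSystem (xs ++ ys) ≡ encodeSystem xs ++ encodeSystem ys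
encodeSystem-++ = concatMap-++ encodeEquation

encodeSystem-concatMap : ∀ {n} {A : Set} (f : A → List (SparseEquation n)) xs → encodeSystem (concatMap f xs) ≡ concatMap (encodeSystem ∘ f) xs
encodeSystem-concatMap f []       = refl
encodeSystem-concatMap f (x ∷ xs) = trans (encodeSystem-++ (f x) (concatMap f xs)) (cong (encodeSystem (f x) ++_) (encodeSystem-concatMap f xs))

term≤sum : ∀ {A : Set} (f : A → ℕ) {x xs} → x ∈ xs → f x ≤ sum (map f xs)
term≤sum f (here refl) = m≤m+n _ _
term≤sum f (there x∈)  = ≤-trans (term≤sum f x∈) (m≤n+m _ _)

scaled : ∀ a b {x v} → 1 ≤ v → x ≤ v → a + x * b ≤ (a + b) * v
scaled a b {x} {v} 1≤v x≤v = ≤-trans (+-mono-≤ (≤-trans (≤-reflexive (sym (*-identityʳ a))) (*-monoʳ-≤ a 1≤v)) (*-monoˡ-≤ b x≤v))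
  (≤-reflexive (trans (cong (a * v +_) (*-comm v b)) (sym (*-distribʳ-+ v a b))))

-- Execution of the whole program

module Correctness (G : Graph) (nbrs : Vertex G → List (Vertex G)) (adjacency : IsAdjacencyLists G nbrs) where

  open OnGraph G nbrs adjacency
  open SubgraphLists G nbrs adjacency
  open DecMembership {A = Vertex G} Fin._≟_ using (_∈?_)

  independentSetOf : Vertex G → List (Vertex G)
  independentSetOf = Iteration.independentSet

  Row : (ℕ → ℕ) → ℕ → Vertex G → Set
  Row h k v = ∀ x → h (k * n + toℕ x) ≡ bit (does (x ∈? independentSetOf v))

  record Base (k : ℕ) (s : State) : Set where
    constructor base
    field
      N≡     : reg s Nᵣ ≡ n
      K≡     : reg s Kᵣ ≡ k
      one≡   : reg s oneᵣ ≡ 1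
      input≡ : Stream (arr s input) 1 (concatMap row vertices)

  keep : ∀ {k p s s′} → Unchanged p s s′ → writesReg p Nᵣ ≡ false → writesReg p Kᵣ ≡ false → writesReg p oneᵣ ≡ false →
         writesArr p input ≡ false → Base k s → Base k s′
  keep uc a b c d (base N≡ K≡ one≡ input≡) = base (trans (regs uc Nᵣ a) N≡) (trans (regs uc Kᵣ b) K≡)
    (trans (regs uc oneᵣ c) one≡) (stream-cong (arrs uc input d) refl input≡)

  1≤volume : 1 ≤ volume
  1≤volume = s≤s z≤n

  n≤volume : n ≤ volume
  n≤volume = m≤n⇒m≤1+n (m≤m+n n degrees)

  degree≤volume : ∀ v → length (nbrs v) ≤ volume
  degree≤volume v = m≤n⇒m≤1+n (≤-trans (term≤sum (length ∘ nbrs) (∈-allFin v)) (m≤n+m degrees n))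

  module _ (v : Vertex G) where

    open Iteration v
    open Slice n k k<n
    open Deleting v

    record Prepared (s : State) (rest : List ℕ) (s′ : State) : Set where
      field
        stream′ : Stream (arr s′ input) (reg s′ nextᵣ) rest
        graph   : ∀ i → arr s′ (inner 0) (i * n + k) ≡ cells (encodeGraph (order H) farNbrs) i
        others  : OtherSlicesEqual s s′
        old≡    : ∀ i → arr s′ old (toℕ i) ≡ toℕ (ι i)
        chosen≡ : Row (arr s′ sets) k v
        earlier : ∀ j → j < k * n → arr s′ sets j ≡ arr s sets j

    prepare-run : ∀ {s rest} → Base k s → Stream (arr s input) (reg s nextᵣ) (row v ++ rest) →
      (∀ i → arr s (inner 0) (i * n + k) ≡ 0) → Exec prepare s [] (105 * volume) (Prepared s rest)
    prepare-run {s} {rest} b st fresh = weaken budget (λ _ q → q)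
      (reset-run (Base.N≡ b) (Base.one≡ b) >> λ { {s₁} uc₁ zeros → let b₁ = keep uc₁ refl refl refl refl b in
       markNbhd-run (Base.K≡ b₁) (Base.one≡ b₁) (stream-cong (arrs uc₁ input refl) (regs uc₁ nextᵣ refl) st) zeros >>
       λ { {s₂} uc₂ (st₂ , ms₂) → let b₂ = keep uc₂ refl refl refl refl b₁ in
       renumber-run (Base.N≡ b₂) (Base.one≡ b₂) ms₂ >>
       λ { {s₃} uc₃ (C≡ , num) → let b₃ = keep uc₃ refl refl refl refl b₂ ; ms₃ = marks-cong (arrs uc₃ mark refl) id id ms₂ in
       copy-run (λ x → arr s₃ new (toℕ x)) (Base.N≡ b₃) (Base.K≡ b₃) (Base.one≡ b₃) C≡ ms₃ (λ _ _ → refl) (Base.input≡ b₃)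
         (λ i → trans (arrs uc₃ 6 refl _) (trans (arrs uc₂ 6 refl _) (trans (arrs uc₁ 6 refl _) (fresh i)))) >>
       λ { {s₄} uc₄ (graph , others) → let b₄ = keep uc₄ refl refl refl refl b₃ in
       weaken ≤-refl (λ { uc₅ (chosen≡ , earlier) → record
         { stream′ = stream-cong (λ i → trans (arrs uc₅ input refl i) (trans (arrs uc₄ input refl i) (arrs uc₃ input refl i)))
                                 (trans (regs uc₅ nextᵣ refl) (trans (regs uc₄ nextᵣ refl) (regs uc₃ nextᵣ refl))) st₂
         ; graph   = λ i → trans (arrs uc₅ 6 refl _) (trans (graph i) (cong (λ xs → cells xs i) (sym (encode-farNbrs (number-ι num)))))
         ; others  = otherSlices λ a i k′ k′<n k′≢k → trans (arrs uc₅ (5 + a) refl _) (trans (OtherSlicesEqual.equal others a i k′ k′<n k′≢k)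
                       (trans (arrs uc₃ (5 + a) refl _) (trans (arrs uc₂ (5 + a) refl _) (arrs uc₁ (5 + a) refl _))))
         ; old≡    = λ i → trans (arrs uc₅ old refl _) (trans (arrs uc₄ old refl _)
                       (trans (proj₁ (Numbering.number num (toℕ i) (Fin.toℕ<n i))) (cells-lookup toℕ (filter far? vertices) i)))
         ; chosen≡ = chosen≡
         ; earlier = λ j j< → trans (earlier j j<) (trans (arrs uc₄ sets refl j) (trans (arrs uc₃ sets refl j)
                       (trans (arrs uc₂ sets refl j) (arrs uc₁ sets refl j))))
         } })
         (choose-run (Base.N≡ b₄) (Base.K≡ b₄) (Base.one≡ b₄) (marks-cong (arrs uc₄ mark refl) id id ms₃) (Base.input≡ b₄)) } } } })
      where
      number-ι : ∀ {s} → Numbering s (filter far? vertices) n → ∀ i → arr s new (toℕ (ι i)) ≡ toℕ i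
      number-ι {s} num i = trans (cong (arr s new) (sym (cells-lookup toℕ (filter far? vertices) i)))
        (proj₁ (proj₂ (Numbering.number num (toℕ i) (Fin.toℕ<n i))))
      rearrange : ∀ l → 6 + (1 + l * 7 + 2) ≡ 9 + l * 7
      rearrange = solve-∀
      collect : ∀ V → 9 * V + (16 * V + (14 * V + (40 * V + 26 * V))) ≡ 105 * V
      collect = solve-∀
      -- The summands of 105 are 9 for `reset`, 16 for `markNbhd`, 14 for `renumber`, 40 for `copy`
      -- and 26 for `choose`.
      budget : (5 + n * 4) + ((6 + (1 + length (nbrs v) * 7 + 2)) + ((4 + suc (n * 9)) + (40 * volume + 26 * volume))) ≤ 105 * volume
      budget = ≤-trans (+-mono-≤ (scaled 5 4 1≤volume n≤volume)
        (+-mono-≤ (≤-trans (≤-reflexive (rearrange (length (nbrs v)))) (scaled 9 7 1≤volume (degree≤volume v)))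
          (+-monoˡ-≤ (40 * volume + 26 * volume) (scaled 5 9 1≤volume n≤volume)))) (≤-reflexive (collect volume))

  module Main (p : Program) (v₀ : Vertex G) (v₀≡0 : toℕ v₀ ≡ 0)
              (eqs : ∀ v → List (SparseEquation (order (G -N[ v ])))) (time : Vertex G → ℕ)
              (runs : ∀ v → Runs p (encodeGraph (order (G -N[ v ])) (Deleting.farNbrs v)) (encodeSystem (eqs v)) (time v)) where

    comparisonsAt : Vertex G → List (SparseEquation n)
    comparisonsAt v = if toℕ v ≡ᵇ 0 then [] else [ difference (independentSetOf v) (independentSetOf v₀) ]

    equationsAt : Vertex G → List (SparseEquation n)
    equationsAt v = map (relabel (Deleting.ι v)) (eqs v) ++ comparisonsAt v

    -- Runs still to come find zeroed memory, while slices below k keep the remains of finished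
    -- runs.
    Fresh : ℕ → State → Set
    Fresh k s = ∀ a i k′ → k ≤ k′ → k′ < n → arr s (5 + a) (i * n + k′) ≡ 0

    -- Guarded by `0 < k` because row 0 is only written in iteration 0.
    FirstRow : ℕ → State → Set
    FirstRow k s = 0 < k → ∀ x → arr s sets (toℕ x) ≡ bit (does (x ∈? independentSetOf v₀))

    record Between (k : ℕ) (input′ : List ℕ) (s : State) : Set where
      constructor between
      field
        K≡     : reg s Kᵣ ≡ k
        ahead  : Stream (arr s input) (reg s nextᵣ) input′
        left≡  : reg s leftᵣ ≡ 0
        due≡   : reg s dueᵣ ≡ 0
        fresh  : Fresh k s
        first  : FirstRow k s

    module _ (v : Vertex G) where

      open Iteration v
      open Slice n k k<n
      open Deleting v

      simulate-run : ∀ {s} → Base k s → reg s leftᵣ ≡ 0 → reg s dueᵣ ≡ 0 →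
        (∀ i → arr s (inner 0) (i * n + k) ≡ cells (encodeGraph (order H) farNbrs) i) →
        (∀ r → arr s 5 (r * n + k) ≡ 0) → (∀ a i → arr s (7 + a) (i * n + k) ≡ 0) →
        (∀ i → arr s old (toℕ i) ≡ toℕ (ι i)) →
        Exec (inSlice p) s (encodeSystem (map (relabel ι) (eqs v))) (16 * time v) λ s′ →
          reg s′ leftᵣ ≡ 0 × reg s′ dueᵣ ≡ 0 × OtherSlicesEqual s s′
      simulate-run {s} (base N≡ K≡ one≡ _) left≡ due≡ graph no-regs no-arrs old≡ =
        output (translate-system ι old≡ (eqs v)) (weaken ≤-refl
          (λ { _ (e , _ , others) → trans (Simulation.Ready.left≡ e) (cong proj₁ (advance-system (eqs v))) ,
                                    trans (Simulation.Ready.due≡ e) (cong proj₂ (advance-system (eqs v))) , others })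
          (Simulation.simulate n k k<n (arr s old) (proj₂ (runs v)) {m = 0 , 0} {S = s}
            (Simulation.ready N≡ K≡ one≡ (λ _ → refl) left≡ due≡)
            -- The slice matches `initial`: array 0 of the given program is `inner 0`, filled by
            -- `copy`, and `7 + a` is `inner (suc a)`, still zero.
            (holds no-regs λ { zero i → graph i ; (suc a) i → no-arrs a i })))

      compare-step : ∀ {s} → Base k s → FirstRow k s → Row (arr s sets) k v →
        Exec (cond Kᵣ compare skip) s (encodeSystem (comparisonsAt v)) (21 * volume) (λ _ → ⊤)
      compare-step {s} (base N≡ K≡ one≡ _) first chosen≡ = weaken budget (λ _ q → q) (if-zero
        (λ K≢0 → output (sym (nontrivial (K≢0 ∘ trans K≡)))
          (compare-run {b = λ x → does (x ∈? independentSetOf v)} {b₀ = λ x → does (x ∈? independentSetOf v₀)}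
             N≡ K≡ one≡ (first (n≢0⇒n>0 (K≢0 ∘ trans K≡))) chosen≡))
        (λ K≡0 → output (sym (trivial (trans (sym K≡) K≡0))) (block skip tt)))
        where
        trivial : k ≡ 0 → encodeSystem (comparisonsAt v) ≡ []
        trivial k≡0 rewrite k≡0 = refl
        nontrivial : ¬ (k ≡ 0) → encodeSystem (comparisonsAt v) ≡ comparison (λ x → does (x ∈? independentSetOf v)) (λ x → does (x ∈? independentSetOf v₀))
        nontrivial k≢0 with toℕ v
        ... | zero  = contradiction refl k≢0
        ... | suc _ = trans (++-identityʳ _) (encode-difference (independentSetOf v) (independentSetOf v₀))
        rearrange : ∀ x → suc (6 + x + 1) ≡ 8 + x
        rearrange = solve-∀
        budget : suc (6 + n * 13 + 1) ≤ 21 * volume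
        budget = ≤-trans (≤-reflexive (rearrange (n * 13))) (scaled 8 13 1≤volume n≤volume)

      iteration-run : ∀ {s rest} → Base k s → Between k (row v ++ rest) s →
        Exec (iteration p) s (encodeSystem (equationsAt v)) (128 * volume + 16 * time v) λ s′ →
          reg s′ roundsᵣ ≡ reg s roundsᵣ ∸ 1 × Between (suc k) rest s′
      iteration-run {s} {rest} b (between K≡ ahead left≡ due≡ fresh first) = weaken budget (λ _ q → q) (output outputs≡
        (prepare-run v b ahead (λ i → fresh 1 i k ≤-refl k<n) >> λ { {s₁} uc₁ pr →
          let open Prepared pr
              b₁ = keep uc₁ refl refl refl refl b in
          simulate-run b₁ (trans (regs uc₁ leftᵣ refl) left≡) (trans (regs uc₁ dueᵣ refl) due≡) graph
            (λ r → trans (arrs uc₁ 5 refl _) (fresh 0 r k ≤-refl k<n))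
            (λ a i → trans (arrs uc₁ (7 + a) refl _) (fresh (2 + a) i k ≤-refl k<n)) old≡ >>
          λ { {s₂} uc₂ (left≡₂ , due≡₂ , others₂) →
          let b₂ = keep uc₂ (inSlice-regs Nᵣ refl refl refl refl refl refl p) (inSlice-regs Kᵣ refl refl refl refl refl refl p)
                            (inSlice-regs oneᵣ refl refl refl refl refl refl p) (inSlice-arrs input refl (λ _ → refl) p) b₁
              indep₂ = arrs uc₂ sets (inSlice-arrs sets refl (λ _ → refl) p)
              -- For k > 0 the cells of row 0 have indices below n ≤ k * n, the range that `choose`
              -- leaves alone.
              first₁ : FirstRow k s₁
              first₁ 0<k x = trans (earlier (toℕ x) (<-≤-trans (Fin.toℕ<n x) (first-rows 0<k))) (first 0<k x)
              first₂ : FirstRow k s₂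
              first₂ 0<k x = trans (indep₂ _) (first₁ 0<k x) in
          compare-step b₂ first₂ (λ x → trans (indep₂ _) (chosen≡ x)) >>
          λ { {s₃} uc₃ _ → let b₃ = keep uc₃ refl refl refl refl b₂ in block (incr Kᵣ ︔ decr roundsᵣ)
            (cong₂ _∸_ (trans (regs uc₃ roundsᵣ refl) (trans (regs uc₂ roundsᵣ (inSlice-regs roundsᵣ refl refl refl refl refl refl p)) (regs uc₁ roundsᵣ refl))) (Base.one≡ b₃) ,
             between (increment (Base.K≡ b₃) (Base.one≡ b₃))
               (stream-cong (λ i → trans (arrs uc₃ input refl i) (arrs uc₂ input (inSlice-arrs input refl (λ _ → refl) p) i))
                 (trans (regs uc₃ nextᵣ refl) (regs uc₂ nextᵣ (inSlice-regs nextᵣ refl refl refl refl refl refl p))) stream′)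
               (trans (regs uc₃ leftᵣ refl) left≡₂) (trans (regs uc₃ dueᵣ refl) due≡₂)
               (λ a i k′ k<k′ k′<n → trans (arrs uc₃ (5 + a) refl _)
                 (trans (OtherSlicesEqual.equal others₂ a i k′ k′<n (>⇒≢ k<k′))
                   (trans (OtherSlicesEqual.equal others a i k′ k′<n (>⇒≢ k<k′)) (fresh a i k′ (<⇒≤ k<k′) k′<n))))
               (λ _ x → trans (arrs uc₃ sets refl _) (trans (indep₂ _) (next-first {s₁} first₁ chosen≡ x (k ≟ 0))))) } } }))
        where
        first-rows : 0 < k → n ≤ k * n
        first-rows 0<k = ≤-trans (≤-reflexive (sym (*-identityˡ n))) (*-monoˡ-≤ n 0<k)
        next-first : ∀ {s₁} → FirstRow k s₁ → Row (arr s₁ sets) k v → ∀ x → Dec (k ≡ 0) →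
                     arr s₁ sets (toℕ x) ≡ bit (does (x ∈? independentSetOf v₀))
        next-first {s₁} f r x (no k≢0)  = f (n≢0⇒n>0 k≢0) x
        -- In iteration 0 the row just chosen is itself row 0, and v is `v₀`.
        next-first {s₁} f r x (yes k≡0) = trans (cong (λ k → arr s₁ sets (k * n + toℕ x)) (sym k≡0))
          (trans (r x) (cong (λ v → bit (does (x ∈? independentSetOf v))) (Fin.toℕ-injective (trans k≡0 (sym v₀≡0)))))
        outputs≡ : encodeSystem (map (relabel ι) (eqs v)) ++ encodeSystem (comparisonsAt v) ++ [] ≡ encodeSystem (equationsAt v)
        outputs≡ = trans (cong (encodeSystem (map (relabel ι) (eqs v)) ++_) (++-identityʳ _))
                         (sym (encodeSystem-++ (map (relabel ι) (eqs v)) (comparisonsAt v)))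
        collect : ∀ V t → 105 * V + (t + (21 * V + 2 * V)) ≡ 128 * V + t
        collect = solve-∀
        -- 105 for the preparation, 21 for the comparison and 2 for updating the counters make 128.
        budget : 105 * volume + (16 * time v + (21 * volume + 2)) ≤ 128 * volume + 16 * time v
        budget = ≤-trans (+-monoʳ-≤ (105 * volume) (+-monoʳ-≤ (16 * time v) (+-monoʳ-≤ (21 * volume) (*-monoʳ-≤ 2 1≤volume))))
                         (≤-reflexive (collect volume (16 * time v)))

    equations : List (SparseEquation n)
    equations = concatMap equationsAt vertices

    compute-run : ∀ t̂ → (∀ v → time v ≤ t̂) →
      Exec (compute p) (initial (encodeGraph n nbrs)) (encodeSystem equations) (n * (135 * volume + 16 * t̂)) (λ _ → ⊤)
    compute-run t̂ time≤ = weaken budget (λ _ _ → tt) (output (sym (encodeSystem-concatMap equationsAt vertices))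
      (start then forEach (encodeSystem ∘ equationsAt) (λ v → 128 * volume + 16 * time v) roundsᵣ (iteration p) s₁ vertices Inv step
        (between refl st₁ refl refl (λ { zero _ _ _ _ → refl ; (suc _) _ _ _ _ → refl }) (λ ())) (sym #vertices)))
      where
      start = const oneᵣ 1 ︔ load Nᵣ input zeroᵣ ︔ const nextᵣ 1 ︔ move roundsᵣ Nᵣ
      s₁ = effect start (initial (encodeGraph n nbrs))
      st₁ : Stream (arr s₁ input) 1 (concatMap row vertices)
      st₁ = stream λ _ → refl
      Inv : List (Vertex G) → List (Vertex G) → State → Set
      Inv done todo s = Between (length done) (concatMap row todo) s
      step : ∀ done v todo s → done ++ v ∷ todo ≡ vertices → Unchanged (iteration p) s₁ s →
             Inv done (v ∷ todo) s → reg s roundsᵣ ≡ suc (length todo) →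
             Exec (iteration p) s (encodeSystem (equationsAt v)) (128 * volume + 16 * time v)
               λ s′ → reg s′ roundsᵣ ≡ length todo × Inv (done ∷ʳ v) todo s′
      step done v todo s eq uc bw L≡ = weaken ≤-refl
        (λ { _ (L≡′ , bw′) → trans L≡′ (cong (_∸ 1) L≡) ,
             subst (λ l → Between l _ _) (trans (cong suc v≡) (sym (length-∷ʳ done))) bw′ })
        (iteration-run v
          (base (regs uc Nᵣ (cong (_∨ false) (inSlice-regs Nᵣ refl refl refl refl refl refl p))) (trans (Between.K≡ bw) (sym v≡))
            (regs uc oneᵣ (cong (_∨ false) (inSlice-regs oneᵣ refl refl refl refl refl refl p)))
            (stream-cong (arrs uc input (cong (_∨ false) (inSlice-arrs input refl (λ _ → refl) p))) refl st₁))
          (subst (λ l → Between l _ s) (sym v≡) bw))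
        where v≡ = position done eq
      total : ∀ us → sum (map (λ v → suc (128 * volume + 16 * time v)) us) ≤ length us * (129 * volume + 16 * t̂)
      total []       = z≤n
      total (u ∷ us) = +-mono-≤ (≤-trans (+-mono-≤ (+-monoˡ-≤ (128 * volume) 1≤volume) (*-monoʳ-≤ 16 (time≤ u))) (≤-reflexive (rearrange volume t̂))) (total us)
        where
        rearrange : ∀ V t → (V + 128 * V) + 16 * t ≡ 129 * V + 16 * t
        rearrange = solve-∀
      -- The loop test raises 128 to 129. The 5 initial units and the final test give 6 more, which
      -- are spread over the iterations because n and the volume are positive.
      budget : 5 + suc (sum (map (λ v → suc (128 * volume + 16 * time v)) vertices)) ≤ n * (135 * volume + 16 * t̂)
      budget = begin
        6 + sum (map (λ v → suc (128 * volume + 16 * time v)) vertices)  ≤⟨ +-monoʳ-≤ 6 (total vertices) ⟩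
        6 + length vertices * (129 * volume + 16 * t̂)  ≡⟨ cong (λ l → 6 + l * (129 * volume + 16 * t̂)) #vertices ⟩
        6 + n * (129 * volume + 16 * t̂)  ≤⟨ +-monoˡ-≤ (n * (129 * volume + 16 * t̂)) (*-mono-≤ {6} {6} ≤-refl (*-mono-≤ (m<n⇒0<n (Fin.toℕ<n v₀)) 1≤volume)) ⟩
        6 * (n * volume) + n * (129 * volume + 16 * t̂)  ≡⟨ rearrange n volume t̂ ⟩
        n * (135 * volume + 16 * t̂)  ∎
        where
        open ≤-Reasoning
        rearrange : ∀ n V t → 6 * (n * V) + n * (129 * V + 16 * t) ≡ n * (135 * V + 16 * t)
        rearrange = solve-∀

-- Real numbers

-- Equality of reals only depends on the termwise difference of the sequences. Hence common summands
-- cancel among rationals, and no laws of real arithmetic enter.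
transfer : ∀ {x y x′ y′} → (∀ m → seq x m ℚ.- seq y m ≃ seq x′ m ℚ.- seq y′ m) → x ≃ᴿ y → x′ ≃ᴿ y′
transfer same (*≃* close) = *≃* λ ε → proj₁ (close ε) , λ m N≤m →
  ℚ.≤-trans (ℚ.≤-reflexive (ℚ.∣-∣-cong (ℚ.≃-sym (same m)))) (proj₂ (close ε) m N≤m)

pointwise⇒≃ᴿ : ∀ {x y} → (∀ m → seq x m ≃ seq y m) → x ≃ᴿ y
pointwise⇒≃ᴿ {x} {y} same = *≃* λ ε → 0 , λ m _ → begin
  ℚ.∣ seq x m ℚ.- seq y m ∣  ≃⟨ ℚ.∣-∣-cong (ℚ.+-congʳ (seq x m) (ℚ.-‿cong (ℚ.≃-sym (same m)))) ⟩
  ℚ.∣ seq x m ℚ.- seq x m ∣  ≃⟨ ℚ.∣-∣-cong (ℚ.+-inverseʳ (seq x m)) ⟩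
  0ℚᵘ                        ≤⟨ ℚ.<⇒≤ (ℚ.positive⁻¹ ε) ⟩
  ε                          ∎
  where open ℚ.≤-Reasoning

≃ᴿ-sym : ∀ {x y} → x ≃ᴿ y → y ≃ᴿ x
≃ᴿ-sym {x} {y} (*≃* close) = *≃* λ ε → proj₁ (close ε) , λ m N≤m →
  ℚ.≤-trans (ℚ.≤-reflexive (ℚ.≃-trans (ℚ.∣-∣-cong (flip (seq y m) (seq x m))) (ℚ.≃-reflexive (ℚ.∣-p∣≡∣p∣ (seq x m ℚ.- seq y m)))))
    (proj₂ (close ε) m N≤m)
  where
  flip : ∀ a b → a ℚ.- b ≃ ℚ.- (b ℚ.- a)
  flip = solve 2 (λ a b → a :- b := :- (b :- a)) ℚ.≃-refl
    where open +-*-Solver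

≃ᴿ-trans : ∀ {x y z} → x ≃ᴿ y → y ≃ᴿ z → x ≃ᴿ z
≃ᴿ-trans {x} {y} {z} (*≃* f) (*≃* g) = *≃* close
  where
  open ℚ.≤-Reasoning
  through : ∀ a b c → a ℚ.- c ≃ (a ℚ.- b) ℚ.+ (b ℚ.- c)
  through = solve 3 (λ a b c → a :- c := (a :- b) :+ (b :- c)) ℚ.≃-refl
    where open +-*-Solver
  close : ∀ ε → .{{ℚ.Positive ε}} → ∃ λ N → ∀ n → N ℕ.≤ n → ℚ.∣ seq x n ℚ.- seq z n ∣ ℚ.≤ ε
  close ε with f (½ ℚ.* ε) {{half-pos ε}} | g (½ ℚ.* ε) {{half-pos ε}}
  ... | N₁ , h₁ | N₂ , h₂ = N₁ ℕ.⊔ N₂ , λ n N≤n → begin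
    ℚ.∣ seq x n ℚ.- seq z n ∣  ≃⟨ ℚ.∣-∣-cong (through (seq x n) (seq y n) (seq z n)) ⟩
    ℚ.∣ (seq x n ℚ.- seq y n) ℚ.+ (seq y n ℚ.- seq z n) ∣  ≤⟨ ℚ.∣p+q∣≤∣p∣+∣q∣ (seq x n ℚ.- seq y n) (seq y n ℚ.- seq z n) ⟩
    ℚ.∣ seq x n ℚ.- seq y n ∣ ℚ.+ ℚ.∣ seq y n ℚ.- seq z n ∣
      ≤⟨ ℚ.+-mono-≤ (h₁ n (ℕ.m⊔n≤o⇒m≤o N₁ N₂ N≤n)) (h₂ n (ℕ.m⊔n≤o⇒n≤o N₁ N₂ N≤n)) ⟩
    ½ ℚ.* ε ℚ.+ ½ ℚ.* ε  ≃⟨ half+half ε ⟩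
    ε ∎

≤ᴿ-trans : ∀ {x y z} → x ≤ᴿ y → y ≤ᴿ z → x ≤ᴿ z
≤ᴿ-trans {x} {y} {z} (*≤* f) (*≤* g) = *≤* close
  where
  open ℚ.≤-Reasoning
  close : ∀ ε → .{{ℚ.Positive ε}} → ∃ λ N → ∀ n → N ℕ.≤ n → seq x n ℚ.≤ seq z n ℚ.+ ε
  close ε with f (½ ℚ.* ε) {{half-pos ε}} | g (½ ℚ.* ε) {{half-pos ε}}
  ... | N₁ , h₁ | N₂ , h₂ = N₁ ℕ.⊔ N₂ , λ n N≤n → begin
    seq x n  ≤⟨ h₁ n (ℕ.m⊔n≤o⇒m≤o N₁ N₂ N≤n) ⟩
    seq y n ℚ.+ ½ ℚ.* ε  ≤⟨ ℚ.+-monoˡ-≤ (½ ℚ.* ε) (h₂ n (ℕ.m⊔n≤o⇒n≤o N₁ N₂ N≤n)) ⟩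
    (seq z n ℚ.+ ½ ℚ.* ε) ℚ.+ ½ ℚ.* ε  ≃⟨ ℚ.+-assoc (seq z n) (½ ℚ.* ε) (½ ℚ.* ε) ⟩
    seq z n ℚ.+ (½ ℚ.* ε ℚ.+ ½ ℚ.* ε)  ≃⟨ ℚ.+-congʳ (seq z n) (half+half ε) ⟩
    seq z n ℚ.+ ε ∎

fromℕℚ : ℕ → ℚᵘ
fromℕℚ n = mkℚᵘ (pos n) 0

fromℕℚ-+ : ∀ a b → fromℕℚ (a ℕ.+ b) ≃ fromℕℚ a ℚ.+ fromℕℚ b
fromℕℚ-+ a b = ℚ.*≡* (cong (ℤ._* pos 1) (sym (cong₂ ℤ._+_ (ℤ.*-identityʳ (pos a)) (ℤ.*-identityʳ (pos b)))))

fromℕℚ-* : ∀ a b → fromℕℚ (a ℕ.* b) ≃ fromℕℚ a ℚ.* fromℕℚ b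
fromℕℚ-* a b = ℚ.*≡* (cong (ℤ._* pos 1) (ℤ.pos-* a b))

fromℕℚ-mono : ∀ {a b} → a ℕ.≤ b → fromℕℚ a ℚ.≤ fromℕℚ b
fromℕℚ-mono a≤b = ℚ.*≤* (ℤ.*-monoʳ-≤-nonNeg (pos 1) (ℤ.+≤+ a≤b))

≤+pos : ∀ {p q} ε → .{{ℚ.Positive ε}} → p ℚ.≤ q → p ℚ.≤ q ℚ.+ ε
≤+pos {p} {q} ε p≤q = ℚ.≤-trans p≤q (ℚ.≤-trans (ℚ.≤-reflexive (ℚ.≃-sym (ℚ.+-identityʳ q))) (ℚ.+-monoʳ-≤ q (ℚ.<⇒≤ (ℚ.positive⁻¹ ε))))

fromℕ-mono : ∀ {a b} → a ℕ.≤ b → fromℕ a ≤ᴿ fromℕ b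
fromℕ-mono a≤b = *≤* λ ε → 0 , λ _ _ → ≤+pos ε (fromℕℚ-mono a≤b)

-- The factor suc c is positive so that it can be divided out of the error term.
affine-bound : ∀ c d {x F y} → (∀ m → fromℕℚ (suc c) ℚ.* seq F m ℚ.+ fromℕℚ d ≃ seq y m) →
               fromℕ x ≤ᴿ F → fromℕ (suc c ℕ.* x ℕ.+ d) ≤ᴿ y
affine-bound c d {x} {F} {y} y≃ (*≤* f) = *≤* close
  where
  open ℚ.≤-Reasoning
  regroup : ∀ a p q r → a ℚ.* (p ℚ.+ q) ℚ.+ r ≃ (a ℚ.* p ℚ.+ r) ℚ.+ a ℚ.* q
  regroup = solve 4 (λ a p q r → a :* (p :+ q) :+ r := (a :* p :+ r) :+ a :* q) ℚ.≃-refl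
    where open +-*-Solver
  half≤ : ∀ ε → .{{ℚ.Positive ε}} → ½ ℚ.* ε ℚ.≤ ε
  half≤ ε = ℚ.≤-trans (≤+pos (½ ℚ.* ε) {{half-pos ε}} ℚ.≤-refl) (ℚ.≤-reflexive (half+half ε))
  close : ∀ ε → .{{ℚ.Positive ε}} → ∃ λ N → ∀ n → N ℕ.≤ n → fromℕℚ (suc c ℕ.* x ℕ.+ d) ℚ.≤ seq y n ℚ.+ ε
  close ε with shrink (fromℕℚ (suc c)) ε
  ... | δ , δ>0 , cδ with f δ {{δ>0}}
  ... | N , h = N , λ n N≤n → begin
    fromℕℚ (suc c ℕ.* x ℕ.+ d)  ≃⟨ fromℕℚ-+ (suc c ℕ.* x) d ⟩
    fromℕℚ (suc c ℕ.* x) ℚ.+ fromℕℚ d  ≃⟨ ℚ.+-congˡ (fromℕℚ d) (fromℕℚ-* (suc c) x) ⟩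
    fromℕℚ (suc c) ℚ.* fromℕℚ x ℚ.+ fromℕℚ d  ≤⟨ ℚ.+-monoˡ-≤ (fromℕℚ d) (ℚ.*-monoʳ-≤-nonNeg (fromℕℚ (suc c)) (h n N≤n)) ⟩
    fromℕℚ (suc c) ℚ.* (seq F n ℚ.+ δ) ℚ.+ fromℕℚ d  ≃⟨ regroup (fromℕℚ (suc c)) (seq F n) δ (fromℕℚ d) ⟩
    (fromℕℚ (suc c) ℚ.* seq F n ℚ.+ fromℕℚ d) ℚ.+ fromℕℚ (suc c) ℚ.* δ  ≃⟨ ℚ.+-cong (y≃ n) cδ ⟩
    seq y n ℚ.+ ½ ℚ.* ε  ≤⟨ ℚ.+-monoʳ-≤ (seq y n) (half≤ ε) ⟩
    seq y n ℚ.+ ε ∎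

-- Finite sums of rationals

module _ {A : Set} where

  Σℚ : (A → ℚᵘ) → List A → ℚᵘ
  Σℚ h = foldr (λ x c → h x ℚ.+ c) 0ℚᵘ

  Σ-cong : ∀ {g h} → (∀ x → g x ≃ h x) → ∀ xs → Σℚ g xs ≃ Σℚ h xs
  Σ-cong g≃h []       = ℚ.≃-refl
  Σ-cong g≃h (x ∷ xs) = ℚ.+-cong (g≃h x) (Σ-cong g≃h xs)

  Σ-+ : ∀ g h xs → Σℚ (λ x → g x ℚ.+ h x) xs ≃ Σℚ g xs ℚ.+ Σℚ h xs
  Σ-+ g h []       = ℚ.≃-sym (ℚ.+-identityʳ 0ℚᵘ)
  Σ-+ g h (x ∷ xs) = ℚ.≃-trans (ℚ.+-congʳ (g x ℚ.+ h x) (Σ-+ g h xs)) (swap (g x) (h x) (Σℚ g xs) (Σℚ h xs))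
    where
    swap : ∀ a b c d → (a ℚ.+ b) ℚ.+ (c ℚ.+ d) ≃ (a ℚ.+ c) ℚ.+ (b ℚ.+ d)
    swap = solve 4 (λ a b c d → (a :+ b) :+ (c :+ d) := (a :+ c) :+ (b :+ d)) ℚ.≃-refl
      where open +-*-Solver

  Σ-zero : ∀ {h} xs → (∀ {x} → x ∈ xs → h x ≃ 0ℚᵘ) → Σℚ h xs ≃ 0ℚᵘ
  Σ-zero []       _   = ℚ.≃-refl
  Σ-zero (x ∷ xs) h≃0 = ℚ.≃-trans (ℚ.+-cong (h≃0 (here refl)) (Σ-zero xs (h≃0 ∘ there))) (ℚ.+-identityʳ 0ℚᵘ)

  Σ-single : ∀ {h v xs} → Unique xs → v ∈ xs → (∀ x → ¬ (x ≡ v) → h x ≃ 0ℚᵘ) → Σℚ h xs ≃ h v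
  Σ-single {h} {xs = x ∷ xs} (x∉ ∷ _) (here refl) h≃0 =
    ℚ.≃-trans (ℚ.+-congʳ (h x) (Σ-zero xs λ y∈ → h≃0 _ λ { refl → All.lookup x∉ y∈ refl })) (ℚ.+-identityʳ (h x))
  Σ-single {h} {v} {x ∷ xs} (x∉ ∷ u) (there v∈) h≃0 =
    ℚ.≃-trans (ℚ.+-cong (h≃0 x λ { refl → All.lookup x∉ v∈ refl }) (Σ-single u v∈ h≃0)) (ℚ.+-identityˡ (h v))

  -- The complementary part stays a sum over the whole list, with zeros filled in, so that
  -- `Σ-single` applies to it directly.
  Σ-filter : ∀ {Q : Pred A 0ℓ} (Q? : Decidable Q) h xs →
             Σℚ h xs ≃ Σℚ (λ x → if does (Q? x) then 0ℚᵘ else h x) xs ℚ.+ Σℚ h (filter Q? xs)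
  Σ-filter Q? h []       = ℚ.≃-sym (ℚ.+-identityʳ 0ℚᵘ)
  Σ-filter Q? h (x ∷ xs) with does (Q? x)
  ... | true  = ℚ.≃-trans (ℚ.+-congʳ (h x) (Σ-filter Q? h xs)) (swap (h x) (Σℚ (λ x → if does (Q? x) then 0ℚᵘ else h x) xs) (Σℚ h (filter Q? xs)))
    where
    swap : ∀ a b c → a ℚ.+ (b ℚ.+ c) ≃ (0ℚᵘ ℚ.+ b) ℚ.+ (a ℚ.+ c)
    swap = solve 3 (λ a b c → a :+ (b :+ c) := (con 0ℚᵘ :+ b) :+ (a :+ c)) ℚ.≃-refl
      where open +-*-Solver
  ... | false = ℚ.≃-trans (ℚ.+-congʳ (h x) (Σ-filter Q? h xs)) (ℚ.≃-sym (ℚ.+-assoc (h x) _ _))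

Σ-map : ∀ {A B : Set} (f : A → B) h xs → Σℚ h (map f xs) ≡ Σℚ (h ∘ f) xs
Σ-map f h []       = refl
Σ-map f h (x ∷ xs) = cong (h (f x) ℚ.+_) (Σ-map f h xs)

seq-sum-tabulate : ∀ {A : Set} (f : A → ℝ) m {n} (φ : Fin n → A) → seq (sumᴿ (f ∘ φ)) m ≡ Σℚ (λ x → seq (f x) m) (tabulate φ)
seq-sum-tabulate f m {zero}  φ = refl
seq-sum-tabulate f m {suc n} φ = cong (seq (f (φ Fin.zero)) m ℚ.+_) (seq-sum-tabulate f m (φ ∘ Fin.suc))

seq-sum : ∀ {n} (f : Fin n → ℝ) m → seq (sumᴿ f) m ≡ Σℚ (λ x → seq (f x) m) (allFin n)
seq-sum f m = seq-sum-tabulate f m id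

weightℚ : ∀ {n} → (Fin n → ℚᵘ) → Subset n → Fin n → ℚᵘ
weightℚ x S v = if does (v ∈ˢ? S) then x v else 0ℚᵘ

seq-weight : ∀ {n} (w : Fin n → ℝ) S m → seq (weight w S) m ≃ Σℚ (weightℚ (λ v → seq (w v) m) S) (allFin n)
seq-weight w S m = ℚ.≃-trans (ℚ.≃-reflexive (seq-sum (λ v → if does (v ∈ˢ? S) then w v else 0ᴿ) m)) (Σ-cong term (allFin _))
  where
  term : ∀ v → seq (if does (v ∈ˢ? S) then w v else 0ᴿ) m ≃ weightℚ (λ v → seq (w v) m) S v
  term v with does (v ∈ˢ? S)
  ... | true  = ℚ.≃-refl
  ... | false = ℚ.≃-refl

-- Sparse equations

evaluate : ∀ {n} → SparseEquation n → (Fin n → ℚᵘ) → ℚᵘ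
evaluate ts x = Σℚ (λ (u , q) → q ℚ.* x u) ts

-- Terms may repeat a variable, so the induction peels off one term at a time: its contribution to
-- the sum over all vertices is concentrated at its own vertex.
Σ-coefficient : ∀ {n} (ts : SparseEquation n) x → Σℚ (λ v → coefficient ts v ℚ.* x v) (allFin n) ≃ evaluate ts x
Σ-coefficient {n} []             x = Σ-zero (allFin n) λ {v} _ → ℚ.*-zeroˡ (x v)
Σ-coefficient {n} ((u , q) ∷ ts) x = begin
  Σℚ (λ v → coefficient ((u , q) ∷ ts) v ℚ.* x v) (allFin n)
    ≈⟨ Σ-cong split (allFin n) ⟩
  Σℚ (λ v → single v ℚ.+ coefficient ts v ℚ.* x v) (allFin n)
    ≈⟨ Σ-+ single (λ v → coefficient ts v ℚ.* x v) (allFin n) ⟩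
  Σℚ single (allFin n) ℚ.+ Σℚ (λ v → coefficient ts v ℚ.* x v) (allFin n)
    ≈⟨ ℚ.+-cong (ℚ.≃-trans (Σ-single (UniqueProperties.allFin⁺ n) (∈-allFin u) off) on) (Σ-coefficient ts x) ⟩
  q ℚ.* x u ℚ.+ evaluate ts x ∎
  where
  open SetoidReasoning ℚ.≃-setoid
  single : Fin n → ℚᵘ
  single v = if does (u Fin.≟ v) then q ℚ.* x v else 0ℚᵘ
  split : ∀ v → coefficient ((u , q) ∷ ts) v ℚ.* x v ≃ single v ℚ.+ coefficient ts v ℚ.* x v
  split v with does (u Fin.≟ v)
  ... | true  = ℚ.*-distribʳ-+ (x v) q (coefficient ts v)
  ... | false = ℚ.≃-sym (ℚ.+-identityˡ _)
  off : ∀ v → ¬ (v ≡ u) → single v ≃ 0ℚᵘ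
  off v v≢u with u Fin.≟ v
  ... | yes refl = contradiction refl v≢u
  ... | no _     = ℚ.≃-refl
  on : single u ≃ q ℚ.* x u
  on with u Fin.≟ u
  ... | yes _  = ℚ.≃-refl
  ... | no u≢u = contradiction refl u≢u

SolvedBy : ∀ {n} → (Fin n → ℝ) → SparseEquation n → Set
SolvedBy w ts = sumᴿ (λ v → fromℚ (coefficient ts v) *ᴿ w v) ≃ᴿ 0ᴿ

seq-equation : ∀ {n} (w : Fin n → ℝ) ts m → seq (sumᴿ (λ v → fromℚ (coefficient ts v) *ᴿ w v)) m ≃ evaluate ts (λ v → seq (w v) m)
seq-equation w ts m = ℚ.≃-trans (ℚ.≃-reflexive (seq-sum (λ v → fromℚ (coefficient ts v) *ᴿ w v) m)) (Σ-coefficient ts _)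

-- Maximal independent sets

module _ {n : ℕ} {Q : Pred (Fin n) 0ℓ} (Q? : Decidable Q) where

  subset : Subset n
  subset = Vec.tabulate (does ∘ Q?)

  ∈-subset⁺ : ∀ {v} → Q v → v ∈ˢ subset
  ∈-subset⁺ {v} q = lookup⇒[]= v subset (trans (lookup∘tabulate (does ∘ Q?) v) (dec-true (Q? v) q))

  ∈-subset⁻ : ∀ {v} → v ∈ˢ subset → Q v
  ∈-subset⁻ {v} v∈ with Q? v | trans (sym (lookup∘tabulate (does ∘ Q?) v)) ([]=⇒lookup v∈)
  ... | yes q | _ = q
  ... | no _  | ()

Dominating : (G : Graph) → Subset (order G) → Set
Dominating G S = ∀ u → ¬ u ∈ˢ S → ∃ λ y → y ∈ˢ S × Graph.Adj G u y

-- A finite search finds a neighbour of u in S; if there is none, adding u to S gives a larger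
-- independent set.
maximal⇒dominating : ∀ G {S} → MaximalIndependent G S → Dominating G S
maximal⇒dominating G {S} (indep , max) u u∉ with Fin.any? (λ y → (y ∈ˢ? S) ×-dec Graph.adj? G u y)
... | yes y = y
... | no ∄y = contradiction ((λ {x} x∈ → ∈-subset⁺ Q? (inj₂ x∈)) , u , ∈-subset⁺ Q? (inj₁ refl) , u∉) (max (subset Q?) λ x∈ y∈ → go (∈-subset⁻ Q? x∈) (∈-subset⁻ Q? y∈))
  where
  Q : Pred (Vertex G) 0ℓ
  Q x = x ≡ u ⊎ x ∈ˢ S
  Q? : Decidable Q
  Q? x = (x Fin.≟ u) ⊎-dec (x ∈ˢ? S)
  go : ∀ {x y} → Q x → Q y → ¬ Graph.Adj G x y
  go (inj₁ refl) (inj₁ refl) = Graph.irrefl G refl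
  go (inj₁ refl) (inj₂ y∈)   = λ adj → ∄y (_ , y∈ , adj)
  go (inj₂ x∈)   (inj₁ refl) = λ adj → ∄y (_ , x∈ , Graph.sym G adj)
  go (inj₂ x∈)   (inj₂ y∈)   = indep x∈ y∈

dominating⇒maximal : ∀ G {S} → Independent G S → Dominating G S → MaximalIndependent G S
dominating⇒maximal G indep dom = indep , λ J indepJ (S⊆J , x , x∈J , x∉S) →
  let y , y∈S , adj = dom x x∉S in indepJ x∈J (S⊆J y∈S) adj

module Local (G : Graph) (nbrs : Vertex G → List (Vertex G)) (adjacency : IsAdjacencyLists G nbrs) (v : Vertex G) where

  open OnGraph G nbrs adjacency
  open Iteration v
  open SubgraphLists G nbrs adjacency
  open Deleting v

  Agree : Subset (order H) → Subset (order G) → Set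
  Agree S′ S = ∀ j → (j ∈ˢ S′ → ι j ∈ˢ S) × (ι j ∈ˢ S → j ∈ˢ S′)

  -- An independent set containing v meets N[v] in v alone; its other members are far and hence
  -- vertices of H.
  weight-split : ∀ {S S′} → v ∈ˢ S → Independent G S → Agree S′ S → ∀ w m →
                 seq (weight w S) m ≃ seq (w v) m ℚ.+ seq (weight (w ∘ ι) S′) m
  weight-split {S} {S′} v∈ indep agree w m = begin
    seq (weight w S) m
      ≈⟨ seq-weight w S m ⟩
    Σℚ h vertices
      ≈⟨ Σ-filter far? h vertices ⟩
    Σℚ near vertices ℚ.+ Σℚ h (filter far? vertices)
      ≈⟨ ℚ.+-cong (ℚ.≃-trans (Σ-single (UniqueProperties.allFin⁺ n) (∈-allFin v) off) on) inside ⟩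
    x v ℚ.+ seq (weight (w ∘ ι) S′) m ∎
    where
    open SetoidReasoning ℚ.≃-setoid
    x : Vertex G → ℚᵘ
    x u = seq (w u) m
    h near : Vertex G → ℚᵘ
    h = weightℚ x S
    near u = if does (far? u) then 0ℚᵘ else h u
    off : ∀ u → ¬ (u ≡ v) → near u ≃ 0ℚᵘ
    off u u≢v = go (far? u)
      where
      go : Dec (Far u) → near u ≃ 0ℚᵘ
      go (yes far) rewrite dec-true (far? u) far = ℚ.≃-refl
      go (no ¬far) rewrite dec-false (far? u) ¬far
                         | dec-false (u ∈ˢ? S) (λ u∈ → ¬far [ u≢v , indep v∈ u∈ ]′) = ℚ.≃-refl
    on : near v ≃ x v
    on rewrite dec-false (far? v) (λ far → far (inj₁ refl)) | dec-true (v ∈ˢ? S) v∈ = ℚ.≃-refl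
    term : ∀ j → h (ι j) ≃ weightℚ (x ∘ ι) S′ j
    term j rewrite does-⇔ (mk⇔ (proj₂ (agree j)) (proj₁ (agree j))) (ι j ∈ˢ? S) (j ∈ˢ? S′) = ℚ.≃-refl
    inside : Σℚ h (filter far? vertices) ≃ seq (weight (w ∘ ι) S′) m
    inside = begin
      Σℚ h (filter far? vertices)                     ≡⟨ cong (Σℚ h) (map-lookup-allFin (filter far? vertices)) ⟨
      Σℚ h (map ι (allFin (order H)))                 ≡⟨ Σ-map ι h (allFin (order H)) ⟩
      Σℚ (h ∘ ι) (allFin (order H))                   ≈⟨ Σ-cong term (allFin (order H)) ⟩
      Σℚ (weightℚ (x ∘ ι) S′) (allFin (order H))      ≈⟨ seq-weight (w ∘ ι) S′ m ⟨
      seq (weight (w ∘ ι) S′) m                       ∎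

  restrict : Subset (order G) → Subset (order H)
  restrict S = subset (λ j → ι j ∈ˢ? S)

  restrict-agree : ∀ S → Agree (restrict S) S
  restrict-agree S j = ∈-subset⁻ (λ j → ι j ∈ˢ? S) , ∈-subset⁺ (λ j → ι j ∈ˢ? S)

  restrict-maximal : ∀ {S} → v ∈ˢ S → MaximalIndependent G S → MaximalIndependent H (restrict S)
  restrict-maximal {S} v∈ max@(indep , _) = dominating⇒maximal H
    (λ i∈ j∈ → indep (proj₁ (restrict-agree S _) i∈) (proj₁ (restrict-agree S _) j∈)) dom
    where
    dom : Dominating H (restrict S)
    dom j j∉ with maximal⇒dominating G max (ι j) (j∉ ∘ proj₂ (restrict-agree S j))
    -- The dominating vertex y lies in H: it is not v because `ι j` is far from v, and it is not
    -- adjacent to v because S is independent.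
    ... | y , y∈ , adj with ι-onto {y} [ (λ { refl → ι-far j (inj₂ (Graph.sym G adj)) }) , indep v∈ y∈ ]′
    ...   | i , refl = i , proj₂ (restrict-agree S i) y∈ , adj

  Extended : Subset (order H) → Pred (Vertex G) 0ℓ
  Extended S′ u = u ≡ v ⊎ ∃ λ j → j ∈ˢ S′ × ι j ≡ u

  extended? : ∀ S′ → Decidable (Extended S′)
  extended? S′ u = (u Fin.≟ v) ⊎-dec Fin.any? (λ j → (j ∈ˢ? S′) ×-dec (ι j Fin.≟ u))

  extend : Subset (order H) → Subset (order G)
  extend S′ = subset (extended? S′)

  extend-agree : ∀ S′ → Agree S′ (extend S′)
  extend-agree S′ j = (λ j∈ → ∈-subset⁺ (extended? S′) (inj₂ (j , j∈ , refl))) , back ∘ ∈-subset⁻ (extended? S′)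
    where
    back : Extended S′ (ι j) → j ∈ˢ S′
    back (inj₁ ιj≡v)            = contradiction (inj₁ ιj≡v) (ι-far j)
    back (inj₂ (i , i∈ , ιi≡ιj)) = subst (_∈ˢ S′) (ι-injective ιi≡ιj) i∈

  v∈extend : ∀ S′ → v ∈ˢ extend S′
  v∈extend S′ = ∈-subset⁺ (extended? S′) (inj₁ refl)

  extend-maximal : ∀ {S′} → MaximalIndependent H S′ → MaximalIndependent G (extend S′)
  extend-maximal {S′} max@(indep , _) = dominating⇒maximal G
    (λ x∈ y∈ → go (∈-subset⁻ (extended? S′) x∈) (∈-subset⁻ (extended? S′) y∈)) dom
    where
    go : ∀ {x y} → Extended S′ x → Extended S′ y → ¬ Graph.Adj G x y
    go (inj₁ refl)              (inj₁ refl)              = Graph.irrefl G refl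
    go (inj₁ refl)              (inj₂ (j , _ , refl))    = ι-far j ∘ inj₂
    go (inj₂ (i , _ , refl))    (inj₁ refl)              = ι-far i ∘ inj₂ ∘ Graph.sym G
    go (inj₂ (i , i∈ , refl))   (inj₂ (j , j∈ , refl))   = indep i∈ j∈
    dom : Dominating G (extend S′)
    dom u u∉ with closedNbhd? G v u
    ... | yes (inj₁ refl) = contradiction (v∈extend S′) u∉
    ... | yes (inj₂ adj)  = v , v∈extend S′ , Graph.sym G adj
    ... | no far with ι-onto far
    ...   | j , refl with maximal⇒dominating H max j (u∉ ∘ proj₁ (extend-agree S′ j))
    ...     | i , i∈ , adj = ι i , proj₁ (extend-agree S′ i) i∈ , adj

  -- Adding v raises both weights by w(v), which cancels in their difference. The converse removes v
  -- from both sets in the same way.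
  same-weight⇒local : ∀ {w} → WellCoveredWeighting G w → WellCoveredWeighting H (w ∘ ι)
  same-weight⇒local {w} wc S T S-max T-max = transfer same (wc (extend S) (extend T) (extend-maximal S-max) (extend-maximal T-max))
    where
    cancel : ∀ a b c → (a ℚ.+ b) ℚ.- (a ℚ.+ c) ≃ b ℚ.- c
    cancel = solve 3 (λ a b c → (a :+ b) :- (a :+ c) := b :- c) ℚ.≃-refl
      where open +-*-Solver
    split : ∀ {S} → MaximalIndependent H S → ∀ m → seq (weight w (extend S)) m ≃ seq (w v) m ℚ.+ seq (weight (w ∘ ι) S) m
    split {S} S-max = weight-split (v∈extend S) (proj₁ (extend-maximal S-max)) (extend-agree S) w
    same : ∀ m → seq (weight w (extend S)) m ℚ.- seq (weight w (extend T)) m ≃ seq (weight (w ∘ ι) S) m ℚ.- seq (weight (w ∘ ι) T) m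
    same m = ℚ.≃-trans (ℚ.+-cong (split S-max m) (ℚ.-‿cong (split T-max m))) (cancel (seq (w v) m) _ _)

  local⇒same-weight : ∀ {w} → WellCoveredWeighting H (w ∘ ι) → ∀ {S T} → v ∈ˢ S → v ∈ˢ T →
                      MaximalIndependent G S → MaximalIndependent G T → weight w S ≃ᴿ weight w T
  local⇒same-weight {w} wc {S} {T} v∈S v∈T S-max T-max =
    transfer same (wc (restrict S) (restrict T) (restrict-maximal v∈S S-max) (restrict-maximal v∈T T-max))
    where
    cancel : ∀ a b c → b ℚ.- c ≃ (a ℚ.+ b) ℚ.- (a ℚ.+ c)
    cancel = solve 3 (λ a b c → b :- c := (a :+ b) :- (a :+ c)) ℚ.≃-refl
      where open +-*-Solver
    split : ∀ {S} → v ∈ˢ S → MaximalIndependent G S → ∀ m → seq (weight w S) m ≃ seq (w v) m ℚ.+ seq (weight (w ∘ ι) (restrict S)) m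
    split {S} v∈S S-max = weight-split v∈S (proj₁ S-max) (restrict-agree S) w
    same : ∀ m → seq (weight (w ∘ ι) (restrict S)) m ℚ.- seq (weight (w ∘ ι) (restrict T)) m ≃ seq (weight w S) m ℚ.- seq (weight w T) m
    same m = ℚ.≃-trans (cancel (seq (w v) m) _ _) (ℚ.≃-sym (ℚ.+-cong (split v∈S S-max m) (ℚ.-‿cong (split v∈T T-max m))))

  open DecMembership {A = Vertex G} Fin._≟_ using (_∈?_)

  chosenSet : Subset (order G)
  chosenSet = subset (_∈? independentSet)

  v∈chosenSet : v ∈ˢ chosenSet
  v∈chosenSet = ∈-subset⁺ (_∈? independentSet) (here refl)

  record Compatible (sel : List (Vertex G)) : Set where
    field
      far   : ∀ {x} → x ∈ sel → Far x
      indep : ∀ {x y} → x ∈ sel → y ∈ sel → ¬ Graph.Adj G x y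

  greedy-compatible : ∀ {sel} u → Compatible sel → Compatible (greedy sel u)
  greedy-compatible {sel} u c with blocked? sel u
  ... | yes b = subst Compatible (sym (greedy-blocked b)) c
  ... | no ¬b = subst Compatible (sym (greedy-free ¬b)) record
    { far   = λ { (here refl) → ¬b ∘ inj₁ ; (there x∈) → Compatible.far c x∈ }
    ; indep = λ { (here refl) (here refl) → Graph.irrefl G refl
                ; (here refl) (there y∈)  → λ adj → ¬b (inj₂ (lose y∈ (Graph.sym G adj)))
                ; (there x∈)  (here refl) → λ adj → ¬b (inj₂ (lose x∈ adj))
                ; (there x∈)  (there y∈)  → Compatible.indep c x∈ y∈ } }

  foldl-compatible : ∀ us {sel} → Compatible sel → Compatible (foldl greedy sel us)
  foldl-compatible []       c = c
  foldl-compatible (u ∷ us) c = foldl-compatible us (greedy-compatible u c)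

  foldl-⊇ : ∀ us {sel x} → x ∈ sel → x ∈ foldl greedy sel us
  foldl-⊇ []       x∈ = x∈
  foldl-⊇ (u ∷ us) x∈ = foldl-⊇ us (greedy-⊇ x∈)

  -- A vertex is selected or found blocked when it is met, and either outcome persists because the
  -- selection only grows.
  foldl-dominates : ∀ us {sel u} → u ∈ us → u ∈ foldl greedy sel us ⊎ Blocked (foldl greedy sel us) u
  foldl-dominates (u ∷ us) (there u∈) = foldl-dominates us u∈
  foldl-dominates (u ∷ us) {sel} (here refl) with blocked? sel u
  ... | yes (inj₁ near) = inj₂ (inj₁ near)
  ... | yes (inj₂ adj) = let y , y∈ , y~u = find adj in inj₂ (inj₂ (lose (foldl-⊇ us (greedy-⊇ y∈)) y~u))
  ... | no ¬b = inj₁ (foldl-⊇ us (subst (u ∈_) (sym (greedy-free ¬b)) (here refl)))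

  chosenSet-maximal : MaximalIndependent G chosenSet
  chosenSet-maximal = dominating⇒maximal G (λ x∈ y∈ → go (∈-subset⁻ in? x∈) (∈-subset⁻ in? y∈)) dom
    where
    in? = _∈? independentSet
    c : Compatible (chosen vertices)
    c = foldl-compatible vertices record { far = λ () ; indep = λ () }
    go : ∀ {x y} → x ∈ independentSet → y ∈ independentSet → ¬ Graph.Adj G x y
    go (here refl) (here refl) = Graph.irrefl G refl
    go (here refl) (there y∈)  = Compatible.far c y∈ ∘ inj₂
    go (there x∈)  (here refl) = Compatible.far c x∈ ∘ inj₂ ∘ Graph.sym G
    go (there x∈)  (there y∈)  = Compatible.indep c x∈ y∈
    dom : Dominating G chosenSet
    dom u u∉ with foldl-dominates vertices {[]} (∈-allFin u)
    ... | inj₁ u∈ = contradiction (∈-subset⁺ in? (there u∈)) u∉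
    ... | inj₂ (inj₁ (inj₁ u≡v)) = contradiction (∈-subset⁺ in? (here u≡v)) u∉
    ... | inj₂ (inj₁ (inj₂ v~u)) = v , v∈chosenSet , Graph.sym G v~u
    ... | inj₂ (inj₂ adj) = let y , y∈ , y~u = find adj in y , ∈-subset⁺ in? (there y∈) , Graph.sym G y~u

-- Satisfaction of relabelled equations and of differences

evaluate-relabel : ∀ {m n} (φ : Fin m → Fin n) ts x → evaluate (relabel φ ts) x ≡ evaluate ts (x ∘ φ)
evaluate-relabel φ ts x = Σ-map (λ (j , q) → φ j , q) (λ (u , q) → q ℚ.* x u) ts

solved-relabel : ∀ {m n} (φ : Fin m → Fin n) ts w → SolvedBy (w ∘ φ) ts ⇔ SolvedBy w (relabel φ ts)
solved-relabel φ ts w = mk⇔ (transfer same) (transfer (ℚ.≃-sym ∘ same))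
  where
  same : ∀ m → seq (sumᴿ (λ v → fromℚ (coefficient ts v) *ᴿ w (φ v))) m ℚ.- 0ℚᵘ ≃
               seq (sumᴿ (λ v → fromℚ (coefficient (relabel φ ts) v) *ᴿ w v)) m ℚ.- 0ℚᵘ
  same m = ℚ.+-congˡ (ℚ.- 0ℚᵘ) (ℚ.≃-trans (seq-equation (w ∘ φ) ts m)
    (ℚ.≃-trans (ℚ.≃-reflexive (sym (evaluate-relabel φ ts _))) (ℚ.≃-sym (seq-equation w (relabel φ ts) m))))

module _ {n : ℕ} where

  open DecMembership {A = Fin n} Fin._≟_ using (_∈?_)

  -- At every index of the sequences, the first weight is the value of the equation plus the second
  -- weight; the signs 1, -1 and 0 are checked vertex by vertex.
  solved-difference : ∀ us vs (w : Fin n → ℝ) → weight w (subset (_∈? us)) ≃ᴿ weight w (subset (_∈? vs)) ⇔ SolvedBy w (difference us vs)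
  solved-difference us vs w = mk⇔ (transfer (ℚ.≃-sym ∘ same)) (transfer same)
    where
    open SetoidReasoning ℚ.≃-setoid
    module At (m : ℕ) where
      x : Fin n → ℚᵘ
      x v = seq (w v) m
      eqn wt₁ wt₂ : ℚᵘ
      eqn = seq (sumᴿ (λ v → fromℚ (coefficient (difference us vs) v) *ᴿ w v)) m
      wt₁ = seq (weight w (subset (_∈? us))) m
      wt₂ = seq (weight w (subset (_∈? vs))) m
      does-subset : ∀ ws v → does (v ∈ˢ? subset (_∈? ws)) ≡ does (v ∈? ws)
      does-subset ws v = does-⇔ (mk⇔ (∈-subset⁻ (_∈? ws)) (∈-subset⁺ (_∈? ws))) (v ∈ˢ? subset (_∈? ws)) (v ∈? ws)
      signed : ∀ b c y → (if b then y else 0ℚᵘ) ≃ sign b c ℚ.* y ℚ.+ (if c then y else 0ℚᵘ)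
      signed true true = solve 1 (λ y → y := con 0ℚᵘ :* y :+ y) ℚ.≃-refl
        where open +-*-Solver
      signed true false = solve 1 (λ y → y := con 1ℚᵘ :* y :+ con 0ℚᵘ) ℚ.≃-refl
        where open +-*-Solver
      signed false true = solve 1 (λ y → con 0ℚᵘ := con (ℚ.- 1ℚᵘ) :* y :+ y) ℚ.≃-refl
        where open +-*-Solver
      signed false false = solve 1 (λ y → con 0ℚᵘ := con 0ℚᵘ :* y :+ con 0ℚᵘ) ℚ.≃-refl
        where open +-*-Solver
      coeff : Fin n → ℚᵘ
      coeff v = sign (does (v ∈? us)) (does (v ∈? vs))
      term : ∀ v → weightℚ x (subset (_∈? us)) v ≃ coeff v ℚ.* x v ℚ.+ weightℚ x (subset (_∈? vs)) v
      term v rewrite does-subset us v | does-subset vs v = signed (does (v ∈? us)) (does (v ∈? vs)) (x v)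
      split : wt₁ ≃ eqn ℚ.+ wt₂
      split = begin
        wt₁  ≈⟨ seq-weight w (subset (_∈? us)) m ⟩
        Σℚ (weightℚ x (subset (_∈? us))) (allFin n)  ≈⟨ Σ-cong term (allFin n) ⟩
        Σℚ (λ v → coeff v ℚ.* x v ℚ.+ weightℚ x (subset (_∈? vs)) v) (allFin n)
          ≈⟨ Σ-+ (λ v → coeff v ℚ.* x v) (weightℚ x (subset (_∈? vs))) (allFin n) ⟩
        Σℚ (λ v → coeff v ℚ.* x v) (allFin n) ℚ.+ Σℚ (weightℚ x (subset (_∈? vs))) (allFin n)
          ≈⟨ ℚ.+-cong (ℚ.≃-reflexive (Σ-map (λ v → v , coeff v) (λ (u , q) → q ℚ.* x u) (allFin n))) (seq-weight w (subset (_∈? vs)) m) ⟨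
        evaluate (difference us vs) x ℚ.+ wt₂  ≈⟨ ℚ.+-congˡ wt₂ (seq-equation w (difference us vs) m) ⟨
        eqn ℚ.+ wt₂ ∎
      cancel : ∀ a b → a ℚ.- 0ℚᵘ ≃ (a ℚ.+ b) ℚ.- b
      cancel = solve 2 (λ a b → a :- con 0ℚᵘ := (a :+ b) :- b) ℚ.≃-refl
        where open +-*-Solver
      same : eqn ℚ.- 0ℚᵘ ≃ wt₁ ℚ.- wt₂
      same = ℚ.≃-trans (cancel eqn wt₂) (ℚ.+-congˡ (ℚ.- wt₂) (ℚ.≃-sym split))
    open At using (same)

all-concatMap⁺ : ∀ {A B : Set} {Q : Pred B 0ℓ} (f : A → List B) xs → (∀ x → All Q (f x)) → All Q (concatMap f xs)
all-concatMap⁺ f []       _ = []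
all-concatMap⁺ f (x ∷ xs) q = All.++⁺ (q x) (all-concatMap⁺ f xs q)

all-concatMap⁻ : ∀ {A B : Set} {Q : Pred B 0ℓ} (f : A → List B) {x xs} → x ∈ xs → All Q (concatMap f xs) → All Q (f x)
all-concatMap⁻ f (here refl)            q = All.++⁻ˡ (f _) q
all-concatMap⁻ f {xs = y ∷ _} (there x∈) q = all-concatMap⁻ f x∈ (All.++⁻ʳ (f y) q)

-- Kinds of coefficients

of-kind-resp : ∀ κ {p q} → p ≃ q → CoefficientOfKind κ (fromℚ q) → CoefficientOfKind κ (fromℚ p)
of-kind-resp κ {p} {q} p≃q = go κ
  where
  same : fromℚ p ≃ᴿ fromℚ q
  same = pointwise⇒≃ᴿ λ _ → p≃q
  go : ∀ κ → CoefficientOfKind κ (fromℚ q) → CoefficientOfKind κ (fromℚ p)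
  go rational (r , eq)        = r , ≃ᴿ-trans same eq
  go integer  (z , eq)        = z , ≃ᴿ-trans same eq
  go unit     (inj₁ eq)        = inj₁ (≃ᴿ-trans same eq)
  go unit     (inj₂ (inj₁ eq)) = inj₂ (inj₁ (≃ᴿ-trans same eq))
  go unit     (inj₂ (inj₂ eq)) = inj₂ (inj₂ (≃ᴿ-trans same eq))

≃ᴿ-refl : ∀ {x} → x ≃ᴿ x
≃ᴿ-refl = pointwise⇒≃ᴿ λ _ → ℚ.≃-refl

sign-of-kind : ∀ κ b c → CoefficientOfKind κ (fromℚ (sign b c))
sign-of-kind rational b     c     = sign b c , ≃ᴿ-refl
sign-of-kind integer  true  true  = pos 0 , ≃ᴿ-refl
sign-of-kind integer  true  false = pos 1 , ≃ᴿ-refl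
sign-of-kind integer  false true  = -[1+ 0 ] , ≃ᴿ-refl
sign-of-kind integer  false false = pos 0 , ≃ᴿ-refl
sign-of-kind unit     true  true  = inj₂ (inj₁ (pointwise⇒≃ᴿ λ _ → ℚ.≃-refl))
sign-of-kind unit     true  false = inj₂ (inj₂ (pointwise⇒≃ᴿ λ _ → ℚ.≃-refl))
sign-of-kind unit     false true  = inj₁ (pointwise⇒≃ᴿ λ _ → ℚ.≃-refl)
sign-of-kind unit     false false = inj₂ (inj₁ (pointwise⇒≃ᴿ λ _ → ℚ.≃-refl))

module _ {m n : ℕ} (φ : Fin m → Fin n) where

  -- Injectivity prevents coefficients of different variables from being added up, which could leave
  -- the range of a unit system.
  coefficient-relabel : (∀ {i j} → φ i ≡ φ j → i ≡ j) → ∀ ts j → coefficient (relabel φ ts) (φ j) ≡ coefficient ts j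
  coefficient-relabel inj []             j = refl
  coefficient-relabel inj ((i , q) ∷ ts) j
    rewrite does-⇔ (mk⇔ inj (cong φ)) (φ i Fin.≟ φ j) (i Fin.≟ j) | coefficient-relabel inj ts j = refl

  coefficient-outside : ∀ {u} → (∀ j → ¬ (φ j ≡ u)) → ∀ ts → coefficient (relabel φ ts) u ≡ 0ℚᵘ
  coefficient-outside     out []             = refl
  coefficient-outside {u} out ((i , q) ∷ ts) rewrite dec-false (φ i Fin.≟ u) (out i) = coefficient-outside out ts

module _ {n : ℕ} (q : Fin n → ℚᵘ) where

  coefficient-absent : ∀ us {v} → ¬ (v ∈ us) → coefficient (map (λ u → u , q u) us) v ≡ 0ℚᵘ
  coefficient-absent []           v∉ = refl
  coefficient-absent (u ∷ us) {v} v∉ rewrite dec-false (u Fin.≟ v) (λ { refl → v∉ (here refl) }) = coefficient-absent us (v∉ ∘ there)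

  coefficient-present : ∀ {us v} → Unique us → v ∈ us → coefficient (map (λ u → u , q u) us) v ≃ q v
  coefficient-present {u ∷ us} (u∉ ∷ _) (here refl)
    rewrite dec-true (u Fin.≟ u) refl | coefficient-absent us (λ u∈ → All.lookup u∉ u∈ refl) = ℚ.+-identityʳ (q u)
  coefficient-present {u ∷ us} {v} (u∉ ∷ uniq) (there v∈)
    rewrite dec-false (u Fin.≟ v) (λ { refl → All.lookup u∉ v∈ refl }) = coefficient-present uniq v∈

-- The combined system covers G and keeps its kind

module Covering (G : Graph) (nbrs : Vertex G → List (Vertex G)) (adjacency : IsAdjacencyLists G nbrs)
                (p : Program) (v₀ : Vertex G) (v₀≡0 : toℕ v₀ ≡ 0)
                (eqs : ∀ v → List (SparseEquation (order (G -N[ v ])))) (time : Vertex G → ℕ)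
                (runs : ∀ v → Runs p (encodeGraph (order (G -N[ v ])) (SubgraphLists.Deleting.farNbrs G nbrs adjacency v)) (encodeSystem (eqs v)) (time v)) where

  open OnGraph G nbrs adjacency
  open SubgraphLists G nbrs adjacency
  open Correctness G nbrs adjacency
  open Main p v₀ v₀≡0 eqs time runs
  private module At v = Local G nbrs adjacency v

  comparisons-first : ∀ {v} → toℕ v ≡ 0 → comparisonsAt v ≡ []
  comparisons-first v≡0 rewrite v≡0 = refl

  comparisons-later : ∀ {v} → ¬ (toℕ v ≡ 0) → comparisonsAt v ≡ [ difference (independentSetOf v) (independentSetOf v₀) ]
  comparisons-later {v} v≢0 rewrite dec-false (toℕ v ℕ.≟ 0) v≢0 = refl

  covering : (∀ v → IsWellCoveringSystem (G -N[ v ]) (toSystem (eqs v))) → IsWellCoveringSystem G (toSystem equations)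
  covering local w = mk⇔ (λ wc → All.map⁺ (all-concatMap⁺ equationsAt vertices (solved wc))) (λ sat → well-covered (All.map⁻ sat))
    where
    solved : WellCoveredWeighting G w → ∀ v → All (SolvedBy w) (equationsAt v)
    solved wc v = All.++⁺
      (All.map⁺ (All.map (λ {ts} → Equivalence.to (solved-relabel (Deleting.ι v) ts w))
        (All.map⁻ (Equivalence.to (local v (w ∘ Deleting.ι v)) (At.same-weight⇒local v wc)))))
      (comparison-solved (toℕ v ℕ.≟ 0))
      where
      comparison-solved : Dec (toℕ v ≡ 0) → All (SolvedBy w) (comparisonsAt v)
      comparison-solved (yes v≡0) = subst (All _) (sym (comparisons-first v≡0)) []
      comparison-solved (no v≢0)  = subst (All _) (sym (comparisons-later v≢0))
        (Equivalence.to (solved-difference (independentSetOf v) (independentSetOf v₀) w)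
          (wc (At.chosenSet v) (At.chosenSet v₀) (At.chosenSet-maximal v) (At.chosenSet-maximal v₀)) ∷ [])
    well-covered : All (SolvedBy w) equations → WellCoveredWeighting G w
    well-covered sat S T S-max T-max = ≃ᴿ-trans (to-first S-max) (≃ᴿ-sym (to-first T-max))
      where
      at : ∀ v → All (SolvedBy w) (equationsAt v)
      at v = all-concatMap⁻ equationsAt (∈-allFin v) sat
      -- Either `v₀` itself or a neighbour dominating it belongs to S.
      nonempty : ∀ {S} → MaximalIndependent G S → ∃ λ v → v ∈ˢ S
      nonempty {S} max with v₀ ∈ˢ? S
      ... | yes v₀∈ = v₀ , v₀∈
      ... | no v₀∉  = let y , y∈ , _ = maximal⇒dominating G max v₀ v₀∉ in y , y∈
      link : ∀ v → Dec (toℕ v ≡ 0) → weight w (At.chosenSet v) ≃ᴿ weight w (At.chosenSet v₀)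
      link v (yes v≡0) rewrite Fin.toℕ-injective {i = v} {v₀} (trans v≡0 (sym v₀≡0)) = ≃ᴿ-refl
      link v (no v≢0) with subst (All (SolvedBy w)) (comparisons-later v≢0) (All.++⁻ʳ (map (relabel (Deleting.ι v)) (eqs v)) (at v))
      ... | s ∷ [] = Equivalence.from (solved-difference (independentSetOf v) (independentSetOf v₀) w) s
      to-first : ∀ {S} → MaximalIndependent G S → weight w S ≃ᴿ weight w (At.chosenSet v₀)
      to-first max with nonempty max
      ... | v , v∈ = ≃ᴿ-trans
        (At.local⇒same-weight v (Equivalence.from (local v (w ∘ Deleting.ι v))
            (All.map⁺ (All.map (λ {ts} → Equivalence.from (solved-relabel (Deleting.ι v) ts w))
              (All.map⁻ (All.++⁻ˡ (map (relabel (Deleting.ι v)) (eqs v)) (at v))))))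
          v∈ (At.v∈chosenSet v) max (At.chosenSet-maximal v))
        (link v (toℕ v ℕ.≟ 0))

  ofKind : ∀ κ → (∀ v → SystemOfKind κ (toSystem (eqs v))) → SystemOfKind κ (toSystem equations)
  ofKind κ local = All.map⁺ (all-concatMap⁺ equationsAt vertices λ v →
      All.++⁺ (All.map⁺ (All.map (λ {ts} → relabelled v ts) (All.map⁻ (local v)))) (compared v (toℕ v ℕ.≟ 0)))
    where
    OfKind : ∀ {n} → SparseEquation n → Set
    OfKind ts = ∀ u → CoefficientOfKind κ (fromℚ (coefficient ts u))
    relabelled : ∀ v ts → OfKind ts → OfKind (relabel (Deleting.ι v) ts)
    relabelled v ts k u with Fin.any? (λ j → Deleting.ι v j Fin.≟ u)
    ... | yes (j , refl) = of-kind-resp κ (ℚ.≃-reflexive (coefficient-relabel (Deleting.ι v) (Deleting.ι-injective v) ts j)) (k j)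
    -- Vertices of N[v] get coefficient 0, which is `sign true true` and of every kind.
    ... | no ∄j = of-kind-resp κ (ℚ.≃-reflexive (coefficient-outside (Deleting.ι v) (λ j eq → ∄j (j , eq)) ts)) (sign-of-kind κ true true)
    compared : ∀ v → Dec (toℕ v ≡ 0) → All OfKind (comparisonsAt v)
    compared v (yes v≡0) = subst (All OfKind) (sym (comparisons-first v≡0)) []
    compared v (no v≢0)  = subst (All OfKind) (sym (comparisons-later v≢0))
      ((λ u → of-kind-resp κ (coefficient-present _ (UniqueProperties.allFin⁺ n) (∈-allFin u)) (sign-of-kind κ _ _)) ∷ [])

-- Counting

unique-⊆-length : ∀ {A : Set} {xs ys : List A} → Unique xs → (∀ {x} → x ∈ xs → x ∈ ys) → length xs ≤ length ys
unique-⊆-length []                  _     = z≤n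
unique-⊆-length {A} {x ∷ xs} (x∉ ∷ u) xs⊆ys with ∈-∃++ (xs⊆ys (here refl))
... | as , bs , refl = ≤-trans (s≤s (unique-⊆-length u shrunk))
    (≤-reflexive (trans (cong suc (length-++ as)) (trans (sym (+-suc (length as) (length bs))) (sym (length-++ as)))))
  where
  shrunk : ∀ {y} → y ∈ xs → y ∈ as ++ bs
  shrunk y∈ with ∈-++⁻ as (xs⊆ys (there y∈))
  ... | inj₁ y∈as         = ∈-++⁺ˡ y∈as
  ... | inj₂ (here refl)  = contradiction refl (All.lookup x∉ y∈)
  ... | inj₂ (there y∈bs) = ∈-++⁺ʳ as y∈bs

edges : (G : Graph) → List (Vertex G × Vertex G)
edges G = filter (λ e → (proj₁ e Fin.<? proj₂ e) ×-dec Graph.adj? G (proj₁ e) (proj₂ e))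
                 (cartesianProduct (allFin (order G)) (allFin (order G)))

edges-unique : ∀ G → Unique (edges G)
edges-unique G = UniqueProperties.filter⁺ _ (UniqueProperties.cartesianProduct⁺ (UniqueProperties.allFin⁺ (order G)) (UniqueProperties.allFin⁺ (order G)))

∈-edges⁺ : ∀ G {u v} → u Fin.< v → Graph.Adj G u v → (u , v) ∈ edges G
∈-edges⁺ G {u} {v} u<v adj = ∈-filter⁺ (λ e → (proj₁ e Fin.<? proj₂ e) ×-dec Graph.adj? G (proj₁ e) (proj₂ e))
  (∈-cartesianProduct⁺ (∈-allFin u) (∈-allFin v)) (u<v , adj)

∈-edges⁻ : ∀ G {u v} → (u , v) ∈ edges G → u Fin.< v × Graph.Adj G u v
∈-edges⁻ G e∈ = proj₂ (∈-filter⁻ (λ e → (proj₁ e Fin.<? proj₂ e) ×-dec Graph.adj? G (proj₁ e) (proj₂ e))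
  {xs = cartesianProduct (allFin (order G)) (allFin (order G))} e∈)

module Counting (G : Graph) (nbrs : Vertex G → List (Vertex G)) (adjacency : IsAdjacencyLists G nbrs) where

  open OnGraph G nbrs adjacency
  open SubgraphLists G nbrs adjacency

  order-deleted : ∀ v → order (G -N[ v ]) ≤ n
  order-deleted v = ≤-trans (length-filter (Iteration.far? v) vertices) (≤-reflexive #vertices)

  -- The embedding is injective and increasing, so it maps the edge list of H injectively into that
  -- of G.
  size-deleted : ∀ v → size (G -N[ v ]) ≤ size G
  size-deleted v = ≤-trans (≤-reflexive (sym (length-map φ (edges (G -N[ v ])))))
      (unique-⊆-length (UniqueProperties.map⁺ φ-injective (edges-unique (G -N[ v ]))) inside)
    where
    open Deleting v
    φ : Vertex H × Vertex H → Vertex G × Vertex G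
    φ (i , j) = ι i , ι j
    φ-injective : ∀ {e f} → φ e ≡ φ f → e ≡ f
    φ-injective eq = cong₂ _,_ (ι-injective (cong proj₁ eq)) (ι-injective (cong proj₂ eq))
    inside : ∀ {e} → e ∈ map φ (edges H) → e ∈ edges G
    inside e∈ with ∈-map⁻ φ e∈
    ... | (i , j) , ij∈ , refl with ∈-edges⁻ H ij∈
    ...   | i<j , adj = ∈-edges⁺ G (ι-mono i<j) adj

  arcs : List (Vertex G) → List (Vertex G × Vertex G)
  arcs = concatMap (λ u → map (u ,_) (nbrs u))

  length-arcs : ∀ us → length (arcs us) ≡ sum (map (length ∘ nbrs) us)
  length-arcs []       = refl
  length-arcs (u ∷ us) = trans (length-++ (map (u ,_) (nbrs u))) (cong₂ _+_ (length-map (u ,_) (nbrs u)) (length-arcs us))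

  ∈-arcs⁻ : ∀ us {x y} → (x , y) ∈ arcs us → x ∈ us × Graph.Adj G x y
  ∈-arcs⁻ (u ∷ us) e∈ with ∈-++⁻ (map (u ,_) (nbrs u)) e∈
  ... | inj₂ e∈us = let x∈ , adj = ∈-arcs⁻ us e∈us in there x∈ , adj
  ... | inj₁ e∈u with ∈-map⁻ (u ,_) e∈u
  ...   | y , y∈ , refl = here refl , Equivalence.to (nbr⇔ u y) y∈

  arcs-unique : ∀ {us} → Unique us → Unique (arcs us)
  arcs-unique []              = []
  arcs-unique {u ∷ us} (u∉ ∷ uniq) = UniqueProperties.++⁺ (UniqueProperties.map⁺ (cong proj₂) (proj₁ (adjacency u))) (arcs-unique uniq) disjoint
    where
    disjoint : ∀ {e} → ¬ (e ∈ map (u ,_) (nbrs u) × e ∈ arcs us)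
    disjoint (e∈u , e∈us) with ∈-map⁻ (u ,_) e∈u
    ... | y , y∈ , refl = All.lookup u∉ (proj₁ (∈-arcs⁻ us e∈us)) refl

  -- The handshake count: each pair of a vertex and a listed neighbour is an edge or a reversed
  -- edge, and no pair occurs twice.
  degrees≤ : degrees ≤ size G + size G
  degrees≤ = begin
    degrees                                                  ≡⟨ length-arcs vertices ⟨
    length (arcs vertices)                                   ≤⟨ unique-⊆-length (arcs-unique (UniqueProperties.allFin⁺ n)) oriented ⟩
    length (edges G ++ map swapped (edges G))                ≡⟨ length-++ (edges G) ⟩
    size G + length (map swapped (edges G))                  ≡⟨ cong (size G +_) (length-map swapped (edges G)) ⟩
    size G + size G                                          ∎
    where
    open ≤-Reasoning
    swapped : Vertex G × Vertex G → Vertex G × Vertex G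
    swapped (x , y) = y , x
    oriented : ∀ {e} → e ∈ arcs vertices → e ∈ edges G ++ map swapped (edges G)
    oriented {x , y} e∈ with proj₂ (∈-arcs⁻ vertices e∈) | Fin.<-cmp x y
    ... | adj | tri< x<y _ _  = ∈-++⁺ˡ (∈-edges⁺ G x<y adj)
    ... | adj | tri≈ _ refl _ = contradiction adj (Graph.irrefl G refl)
    ... | adj | tri> _ _ y<x  = ∈-++⁺ʳ (edges G) (∈-map⁺ swapped (∈-edges⁺ G y<x (Graph.sym G adj)))

  volume≤ : 0 < n → volume ≤ 2 * (n + size G)
  volume≤ 0<n = ≤-trans (+-mono-≤ 0<n (+-monoʳ-≤ n degrees≤)) (≤-reflexive (double n (size G)))
    where
    double : ∀ a b → a + (a + (b + b)) ≡ 2 * (a + b)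
    double = solve-∀

-- From natural counts to the real bounds

-- The maximum is taken among naturals, whose order is decidable. As it is attained, it inherits the
-- real bound; in the empty case it is 0.
uniform-bound : ∀ {n} (h : Fin n → ℕ) {F} → 0ᴿ ≤ᴿ F → (∀ v → fromℕ (h v) ≤ᴿ F) → ∃ λ ĥ → (∀ v → h v ≤ ĥ) × fromℕ ĥ ≤ᴿ F
uniform-bound {zero}  h 0≤F h≤F = 0 , (λ ()) , 0≤F
uniform-bound {suc n} h 0≤F h≤F with uniform-bound (h ∘ Fin.suc) 0≤F (h≤F ∘ Fin.suc)
... | ĥ , h≤ĥ , ĥ≤F with ≤-total (h Fin.zero) ĥ
...   | inj₁ h₀≤ĥ = ĥ , (λ { Fin.zero → h₀≤ĥ ; (Fin.suc v) → h≤ĥ v }) , ĥ≤F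
...   | inj₂ ĥ≤h₀ = h Fin.zero , (λ { Fin.zero → ≤-refl ; (Fin.suc v) → ≤-trans (h≤ĥ v) ĥ≤h₀ }) , h≤F Fin.zero

-- The strict hypothesis expresses l ≤ n * l̂ + n - 1 without truncated subtraction.
size-bound : ∀ n {l l̂ F} → 0 < n → l < n * suc l̂ → fromℕ l̂ ≤ᴿ F → fromℕ l ≤ᴿ fromℕ n *ᴿ F +ᴿ fromℕ n -ᴿ 1ᴿ
size-bound (suc n) {l} {l̂} {F} _ l< l̂≤F = ≤ᴿ-trans (fromℕ-mono (s≤s⁻¹ (≤-trans l< (≤-reflexive (rearrange n l̂)))))
    (affine-bound n n {F = F} same l̂≤F)
  where
  open SetoidReasoning ℚ.≃-setoid
  rearrange : ∀ n l → suc n * suc l ≡ suc (suc n * l + n)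
  rearrange = solve-∀
  regroup : ∀ a b → a ℚ.+ b ≃ (a ℚ.+ (1ℚᵘ ℚ.+ b)) ℚ.- 1ℚᵘ
  regroup = solve 2 (λ a b → a :+ b := (a :+ (con 1ℚᵘ :+ b)) :- con 1ℚᵘ) ℚ.≃-refl
    where open +-*-Solver
  same : ∀ m → fromℕℚ (suc n) ℚ.* seq F m ℚ.+ fromℕℚ n ≃ (fromℕℚ (suc n) ℚ.* seq F m ℚ.+ fromℕℚ (suc n)) ℚ.- 1ℚᵘ
  same m = ℚ.≃-trans (regroup (fromℕℚ (suc n) ℚ.* seq F m) (fromℕℚ n))
    (ℚ.+-congˡ (ℚ.- 1ℚᵘ) (ℚ.+-congʳ (fromℕℚ (suc n) ℚ.* seq F m) (ℚ.≃-sym (fromℕℚ-+ 1 n))))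

time-bound : ∀ n m {V t t̂ F} → 0 < n → V ≤ 2 * (n + m) → t ≤ n * (135 * V + 16 * t̂) → fromℕ t̂ ≤ᴿ F →
             fromℕ t ≤ᴿ fromℕ 270 *ᴿ (fromℕ n *ᴿ (fromℕ n +ᴿ fromℕ m +ᴿ F))
-- Matching n as a successor makes 270 * n a successor too, the shape `affine-bound` asks for. The
-- 270 is 135 doubled by the bound on V and also covers the 16 of the simulation.
time-bound n@(suc _) m {V} {t} {t̂} {F} _ V≤ t≤ t̂≤F = ≤ᴿ-trans (fromℕ-mono total) (affine-bound (ℕ.pred (270 * n)) (270 * n * (n + m)) {F = F} same t̂≤F)
  where
  rearrange : ∀ n s t → n * (135 * (2 * s) + 270 * t) ≡ 270 * n * t + 270 * n * s
  rearrange = solve-∀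
  total : t ≤ 270 * n * t̂ + 270 * n * (n + m)
  total = ≤-trans t≤ (≤-trans (*-monoʳ-≤ n (+-mono-≤ (*-monoʳ-≤ 135 V≤) (*-monoˡ-≤ t̂ (≤ᵇ⇒≤ 16 270 _)))) (≤-reflexive (rearrange n (n + m) t̂)))
  regroup : ∀ c a b f → (c ℚ.* a) ℚ.* f ℚ.+ (c ℚ.* a) ℚ.* (a ℚ.+ b) ≃ c ℚ.* (a ℚ.* ((a ℚ.+ b) ℚ.+ f))
  regroup = solve 4 (λ c a b f → (c :* a) :* f :+ (c :* a) :* (a :+ b) := c :* (a :* ((a :+ b) :+ f))) ℚ.≃-refl
    where open +-*-Solver
  same : ∀ i → fromℕℚ (270 * n) ℚ.* seq F i ℚ.+ fromℕℚ (270 * n * (n + m)) ≃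
               fromℕℚ 270 ℚ.* (fromℕℚ n ℚ.* ((fromℕℚ n ℚ.+ fromℕℚ m) ℚ.+ seq F i))
  same i = ℚ.≃-trans (ℚ.+-cong (ℚ.*-congʳ {seq F i} (fromℕℚ-* 270 n))
    (ℚ.≃-trans (fromℕℚ-* (270 * n) (n + m)) (ℚ.*-cong (fromℕℚ-* 270 n) (fromℕℚ-+ n m)))) (regroup (fromℕℚ 270) (fromℕℚ n) (fromℕℚ m) (seq F i))

-- The one element v whose list is shorter makes the inequality strict, and this strictness becomes
-- the -1 of the size bound.
length-concatMap : ∀ {A B : Set} (f : A → List B) {l̂ v xs} → (∀ x → length (f x) ≤ suc l̂) → length (f v) ≤ l̂ → v ∈ xs →
                   length (concatMap f xs) < length xs * suc l̂
length-concatMap {A} f {l̂} {v} f≤ fv≤ = go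
  where
  all : ∀ xs → length (concatMap f xs) ≤ length xs * suc l̂
  all []       = z≤n
  all (x ∷ xs) = ≤-trans (≤-reflexive (length-++ (f x))) (+-mono-≤ (f≤ x) (all xs))
  go : ∀ {xs} → v ∈ xs → length (concatMap f xs) < length xs * suc l̂
  go {x ∷ xs} (here refl) = ≤-trans (≤-reflexive (cong suc (length-++ (f x)))) (+-mono-≤ (s≤s fv≤) (all xs))
  go {x ∷ xs} (there v∈)  = ≤-trans (≤-reflexive (trans (cong suc (length-++ (f x))) (sym (+-suc (length (f x)) _)))) (+-mono-≤ (f≤ x) (go v∈))

theorem5p3 : ∀ {ℓ ℓ* : Level} (κ : Kind) (𝒢 : GraphClass ℓ) (𝒢* : GraphClass ℓ*) →
    (∀ G → Member 𝒢 G → ∀ v → Member 𝒢* (G -N[ v ])) →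
    (f g : ℝ⁺ → ℝ⁺ → ℝ⁺) → Nondecreasing f → Nondecreasing g →
    (∃ λ (p : Program) → ∀ G → Member 𝒢* G →
    ComputesWellCoveringSystem κ p G (f at G) (g at G)) →
    ∃ λ (p : Program) → ∃ λ (C : ℕ) → ∀ G → Member 𝒢 G → 0 < order G →
    ComputesWellCoveringSystem κ p G
    (fromℕ C *ᴿ (fromℕ (order G) *ᴿ (fromℕ (order G) +ᴿ fromℕ (size G) +ᴿ f at G)))
    (fromℕ (order G) *ᴿ (g at G) +ᴿ fromℕ (order G) -ᴿ 1ᴿ)
theorem5p3 κ 𝒢 𝒢* deleted f g f↗ g↗ (p , solves) = compute p , 270 , computes
  where
  computes : ∀ G → Member 𝒢 G → 0 < order G → ComputesWellCoveringSystem κ (compute p) G _ _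
  computes G G∈ 0<n nbrs adjacency = record
    { equations = equations
    ; time      = Exec.time computation
    ; runs      = Exec.final computation , Exec.run computation
    ; time≤     = time-bound n (size G) 0<n (volume≤ 0<n) (Exec.time≤ computation) (proj₂ (proj₂ max-time))
    ; covering  = covering (covering′ ∘ result)
    ; ofKind    = ofKind κ (ofKind′ ∘ result)
    ; size≤     = size-bound n 0<n (subst₂ _<_ (sym (length-map _ equations)) (cong (_* suc l̂) #vertices)
                    (length-concatMap equationsAt lengths first-length (∈-allFin v₀))) (proj₂ (proj₂ max-length))
    }
    where
    open OnGraph G nbrs adjacency
    open SubgraphLists G nbrs adjacency
    open Correctness G nbrs adjacency
    open Counting G nbrs adjacency
    open WritesWellCoveringSystem using () renaming (covering to covering′; ofKind to ofKind′)
    module W = WritesWellCoveringSystem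
    result : ∀ v → WritesWellCoveringSystem κ p (encodeGraph (order (G -N[ v ])) (Deleting.farNbrs v)) (G -N[ v ]) (f at (G -N[ v ])) (g at (G -N[ v ]))
    result v = solves (G -N[ v ]) (deleted G G∈ v) (Deleting.farNbrs v) (Deleting.farNbrs-adjacency v)
    v₀ : Vertex G
    v₀ = fromℕ< 0<n
    open Main p v₀ (Fin.toℕ-fromℕ< 0<n) (W.equations ∘ result) (W.time ∘ result) (λ v → W.runs (result v))
    open Covering G nbrs adjacency p v₀ (Fin.toℕ-fromℕ< 0<n) (W.equations ∘ result) (W.time ∘ result) (λ v → W.runs (result v))
    -- Monotonicity moves the bounds for each subgraph to the single pair (n, m) of G.
    at-deleted : ∀ (h : ℝ⁺ → ℝ⁺ → ℝ⁺) → Nondecreasing h → ∀ v → h at (G -N[ v ]) ≤ᴿ h at G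
    at-deleted h h↗ v = h↗ _ _ _ _ (fromℕ-mono (order-deleted v)) (fromℕ-mono (size-deleted v))
    max-time = uniform-bound (W.time ∘ result) (proj₂ (f (fromℕ⁺ n) (fromℕ⁺ (size G)))) (λ v → ≤ᴿ-trans (W.time≤ (result v)) (at-deleted f f↗ v))
    max-length = uniform-bound (λ v → length (toSystem (W.equations (result v)))) (proj₂ (g (fromℕ⁺ n) (fromℕ⁺ (size G))))
      (λ v → ≤ᴿ-trans (W.size≤ (result v)) (at-deleted g g↗ v))
    l̂ = proj₁ max-length
    computation = compute-run (proj₁ max-time) (proj₁ (proj₂ max-time))
    local-length : ∀ v → length (map (relabel (Deleting.ι v)) (W.equations (result v))) ≤ l̂
    local-length v = ≤-trans (≤-reflexive (trans (length-map _ (W.equations (result v))) (sym (length-map _ (W.equations (result v))))))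
      (proj₁ (proj₂ max-length) v)
    lengths : ∀ v → length (equationsAt v) ≤ suc l̂
    lengths v = ≤-trans (≤-reflexive (length-++ (map (relabel (Deleting.ι v)) (W.equations (result v)))))
      (≤-trans (+-mono-≤ (local-length v) (one-comparison (toℕ v ≟ 0))) (≤-reflexive (+-comm l̂ 1)))
      where
      one-comparison : Dec (toℕ v ≡ 0) → length (comparisonsAt v) ≤ 1
      one-comparison (yes v≡0) rewrite comparisons-first {v} v≡0 = z≤n
      one-comparison (no v≢0)  rewrite comparisons-later {v} v≢0 = ≤-refl
    -- No comparison is added at `v₀`, so it supplies the shorter list.
    first-length : length (equationsAt v₀) ≤ l̂
    first-length = ≤-trans (≤-reflexive (trans (length-++ (map (relabel (Deleting.ι v₀)) (W.equations (result v₀))))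
      (trans (cong (λ xs → length (map (relabel (Deleting.ι v₀)) (W.equations (result v₀))) + length xs) (comparisons-first {v₀} (Fin.toℕ-fromℕ< 0<n))) (+-identityʳ _)))) (local-length v₀)
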